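{- Let $p$ be a prime, $n\ge2$, $1\le k\le n-1$. The minimum weight of $C_k(n,p)^\perp$ is $2p^{n-k}$, and the codewords of weight $2p^{n-k}$ are exactly the scalar multiples of $S_1-S_2$, where $S_1,S_2$ are incidence vectors of two $(n-k)$-dimensional subspaces of $PG(n,p)$ meeting in an $(n-k-1)$-dimensional subspace.
   Context: $C_k(n,p)$ is the $p$-ary linear code spanned over $\mathbb{F}_p$ by the rows of the incidence matrix of $k$-dimensional subspaces versus points of $PG(n,p)$; $C_k(n,p)^\perp$ is its dual code with respect to the standard scalar product; weight is the number of nonzero coordinates. -}

module Defs where

open import Data.Nat using (ℕ; zero; suc; _+_; _*_; _∸_; NonZero; nonTrivial⇒nonZero)
open import Data.Nat.DivMod using (_mod_)
open import Data.Nat.Primality using (Prime; prime)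
open import Data.Fin using (Fin; toℕ)
open import Data.Fin.Properties using (_≟_)
open import Data.Bool using (Bool; true; false; not)
open import Data.Maybe using (Maybe; just; nothing)
open import Data.List using (List; []; _∷_; [_]; map; concatMap; filterᵇ; length; lookup; allFin)
open import Data.Product using (Σ; _×_; ∃)
open import Relation.Nullary using (¬_; does)
open import Relation.Binary.PropositionalEquality using (_≡_)
open import Function.Bundles using (_⇔_)

primeNZ : {p : ℕ} → Prime p → NonZero p
primeNZ {p} (prime _) = nonTrivial⇒nonZero p

module PG (p : ℕ) .{{nz : NonZero p}} where

  F : Set
  F = Fin p

  0F 1F : F
  0F = 0 mod p
  1F = 1 mod p

  _+F_ _*F_ _-F_ : F → F → F
  a +F b = (toℕ a + toℕ b) mod p
  a *F b = (toℕ a * toℕ b) mod p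
  a -F b = (toℕ a + (p ∸ toℕ b)) mod p

  isZero : F → Bool
  isZero a = does (a ≟ 0F)

  sumF : {m : ℕ} → (Fin m → F) → F
  sumF {zero}  f = 0F
  sumF {suc m} f = f Fin.zero +F sumF (λ i → f (Fin.suc i))

  Vect : ℕ → Set
  Vect m = Fin m → F

  cons : {m : ℕ} → F → Vect m → Vect (suc m)
  cons a v Fin.zero    = a
  cons a v (Fin.suc i) = v i

  allVecs : (m : ℕ) → List (Vect m)
  allVecs zero    = [ (λ ()) ]
  allVecs (suc m) = concatMap (λ a → map (cons a) (allVecs m)) (allFin p)

  -- normalized representative: the first nonzero coordinate equals 1
  -- (the zero vector is not normalized)
  normalized : {m : ℕ} → Vect m → Bool
  normalized {zero}  v = false
  normalized {suc m} v with isZero (v Fin.zero)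
  ... | true  = normalized (λ i → v (Fin.suc i))
  ... | false = does (v Fin.zero ≟ 1F)

  points : (n : ℕ) → List (Vect (suc n))
  points n = filterᵇ normalized (allVecs (suc n))

  N : ℕ → ℕ
  N n = length (points n)

  point : (n : ℕ) → Fin (N n) → Vect (suc n)
  point n i = lookup (points n) i

  Word : ℕ → Set
  Word n = Fin (N n) → F

  weight : {n : ℕ} → Word n → ℕ
  weight {n} c = length (filterᵇ (λ i → not (isZero (c i))) (allFin (N n)))

  dot : {n : ℕ} → Word n → Word n → F
  dot c w = sumF (λ i → c i *F w i)

  -- a projective d-space of PG(n,p) is the span of d+1 linearly
  -- independent vectors of F^(n+1)
  Basis : (n d : ℕ) → Set
  Basis n d = Fin (suc d) → Vect (suc n)

  comb : {n d : ℕ} → (Fin (suc d) → F) → Basis n d → Vect (suc n)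
  comb a B j = sumF (λ i → a i *F B i j)

  Independent : {n d : ℕ} → Basis n d → Set
  Independent B = ∀ a → (∀ j → comb a B j ≡ 0F) → ∀ i → a i ≡ 0F

  record Subspace (n d : ℕ) : Set where
    field
      basis : Basis n d
      indep : Independent basis

  open Subspace public

  _∈S_ : {n d : ℕ} → Vect (suc n) → Subspace n d → Set
  x ∈S S = Σ (Fin (suc _) → F) λ a → ∀ j → x j ≡ comb a (basis S) j

  IsIncidence : {n d : ℕ} → Word n → Subspace n d → Set
  IsIncidence {n} c S =
    ∀ i → (point n i ∈S S → c i ≡ 1F) × (¬ (point n i ∈S S) → c i ≡ 0F)

  InC : (n k : ℕ) → Word n → Set
  InC n k c =
    Σ ℕ λ m → Σ (Fin m → F) λ a → Σ (Fin m → Subspace n k) λ S →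
    Σ (Fin m → Word n) λ χ →
      (∀ j → IsIncidence (χ j) (S j)) × (∀ i → c i ≡ sumF (λ j → a j *F χ j i))

  InDual : (n k : ℕ) → Word n → Set
  InDual n k c = ∀ w → InC n k w → dot c w ≡ 0F

  NonZeroWord : {n : ℕ} → Word n → Set
  NonZeroWord {n} c = Σ (Fin (N n)) λ i → ¬ (c i ≡ 0F)

  -- two d-spaces (d ≥ 1) meeting in a (d-1)-space
  MeetIn : {n d : ℕ} → Subspace n d → Subspace n d → Set
  MeetIn {n} {d} S₁ S₂ =
    Σ (Subspace n (d ∸ 1)) λ D → ∀ x → ((x ∈S S₁ × x ∈S S₂) ⇔ x ∈S D)

  ScalarMultOfDiff : (n d : ℕ) → Word n → Set
  ScalarMultOfDiff n d c =
    Σ F λ l → ¬ (l ≡ 0F) ×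
    Σ (Subspace n d) λ S₁ → Σ (Subspace n d) λ S₂ → MeetIn S₁ S₂ ×
    Σ (Word n) λ χ₁ → Σ (Word n) λ χ₂ →
      IsIncidence χ₁ S₁ × IsIncidence χ₂ S₂ × (∀ i → c i ≡ l *F (χ₁ i -F χ₂ i))

{-# OPTIONS --safe #-}
module Submission where

-- A word c of the dual code sums to zero on every subspace of codimension at most r = n - k.
--
-- For r = 1 this says that Σ c(P) ℓ(P)^(p-1) = 0 for all linear forms ℓ, by Fermat, and as p is prime c is then
-- orthogonal to every product of p - 1 linear forms. Letting the factors vanish at two support points each, one finds
-- a line rich in support points. Hyperplanes meeting the support in a single point do not exist, and this turns
-- the rich line into the bound 2p, with equality only for the difference of two lines meeting in a point.
--
-- In general, averaging over linear maps onto F^r gives a subspace of codimension r through a given support point P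
-- with exactly one further support point Q. The subspaces of codimension r - 1 through it fall under the case r = 1,
-- so the weight is at least 2 + (2p - 2)(p^r - 1)/(p - 1) = 2p^r. When equality holds, each of them carries two lines
-- through P and Q meeting in a point z. Translation by these z preserves c, as every pair of support points with
-- opposite values may take the role of P and Q, hence the z form a subspace D and the support lies on ⟨P, D⟩ and ⟨Q, D⟩.

open import Defs
open import Data.Nat as ℕ using (ℕ; zero; suc; s≤s; z≤n; NonZero)
import Data.Nat.Properties as ℕ
open import Data.Nat.DivMod using (_mod_; _%_; m%n<n; m<n⇒m%n≡m; %-distribˡ-+; %-distribˡ-*; n%n≡0; [m+kn]%n≡m%n; m*n%n≡0)
open import Data.Nat.Primality using (Prime; prime⇒nonTrivial)
open import Data.Nat.Coprimality using (prime⇒coprime; coprime-Bézout)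
open import Data.Nat.GCD using (module Bézout)
open import Data.Nat.Solver using (module +-*-Solver)
open import Data.Integer as ℤ using (ℤ; -[1+_])
import Data.Integer.Properties as ℤ
import Data.Sign as Sign
open import Data.Bool using (Bool; true; false; T; if_then_else_)
open import Data.Bool.Properties using (T-≡)
open import Data.Fin using (Fin; zero; suc; toℕ; punchIn; punchOut; inject≤)
open import Data.Fin.Properties as Fin using (_≟_)
open import Data.Fin.Permutation using (Permutation; permutation)
open import Data.List using (allFin; map; filterᵇ; length; lookup; tabulate)
open import Data.List.Relation.Unary.Any as Any using (Any; here)
import Data.List.Relation.Unary.Any.Properties as Any
open import Data.List.Relation.Unary.All as All using (All)
import Data.List.Relation.Unary.All.Properties as All
open import Data.List.Relation.Unary.AllPairs as AllPairs using (AllPairs)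
import Data.List.Relation.Unary.AllPairs.Properties as AllPairs
open import Data.List.Membership.Propositional using (find)
open import Data.List.Membership.Propositional.Properties using (∈-lookup; ∈-filter⁺; ∈-filter⁻; ∈-allFin)
open import Data.Maybe using (Maybe; just; nothing)
open import Data.Vec.Functional as Vector using (_∷_; [])
open import Data.Product using (Σ; ∃; _×_; _,_; proj₁; proj₂)
open import Data.Sum using (_⊎_; inj₁; inj₂; [_,_]′)
open import Data.Unit using (⊤; tt)
open import Data.Empty using (⊥; ⊥-elim)
open import Function using (_∘_; id)
open import Function.Bundles using (_⇔_; mk⇔; Equivalence)
open import Relation.Nullary using (¬_; Dec; yes; no; does)
open import Relation.Nullary.Decidable using (¬?; _×-dec_; _⊎-dec_; decidable-stable; T?; dec-true) renaming (map′ to mapDec)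
open import Relation.Binary.Definitions using (Tri; tri<; tri≈; tri>)
open import Relation.Binary.PropositionalEquality
open import Algebra.Bundles using (CommutativeRing; Semiring)
import Algebra.Structures as Structures
import Algebra.Properties.Ring as RingProperties
import Algebra.Properties.CommutativeMonoid.Sum as MonoidSum
import Algebra.Properties.Semiring.Sum as SemiringSum
import Algebra.Solver.Ring as RingSolver
open import Algebra.Solver.Ring.AlmostCommutativeRing using (AlmostCommutativeRing; fromCommutativeRing; _-Raw-AlmostCommutative⟶_)

-- Prime fields

-- The count behind the case r = 1: p - 1 forms with two zeros each clear 2p - 2 points, so a
-- support of at most 2p - 1 points would be cleared down to a single one, unless every way of
-- pairing the points runs into a line through the point to be kept. This forces p + 1 support
-- points onto one line. On the other hand, if fewer than p support points lie off a line, then a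
-- hyperplane through one of its support points misses all others. Weight 2p is one point too many
-- for the first count, and a form with three zeros makes up for it. Primality enters when powers of
-- one form are replaced by products of forms, a step that divides by numbers below p.
--
-- The obstacle in the equality case is that averaging yields only one secant partner for each
-- support point. The quads found with this partner first have to show that all values agree up to
-- sign and that every opposite pair spans a secant. Only then can two quads through a common point
-- be compared, which turns an apex into a translation. For p = 2 the two signs coincide and cannot
-- tell the two lines of a quad apart; there two support points already make a rich line, so the
-- line can be prescribed instead.

iterate : ∀ {A : Set} → (A → A) → A → ℕ → A
iterate f x zero    = x
iterate f x (suc n) = f (iterate f x n)

-- With `Fin p` as carrier the scalars themselves index the members of a pencil, so that counts and
-- sums over a parameter t run over `Fin p`. The last two fields say that `1#` has additive order p.
record PrimeField (p : ℕ) : Set where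
  infixl 6 _+_
  infixl 7 _*_
  infix 8 -_
  field
    _+_ _*_ : Fin p → Fin p → Fin p
    -_ : Fin p → Fin p
    0# 1# : Fin p
    isCommutativeRing : Structures.IsCommutativeRing _≡_ _+_ _*_ -_ 0# 1#
    inverse : ∀ a → a ≢ 0# → ∃ λ b → a * b ≡ 1#
    1≢0 : 1# ≢ 0#
    characteristic : iterate (1# +_) 0# p ≡ 0#
    characteristic-minimal : ∀ n → 0 ℕ.< n → n ℕ.< p → iterate (1# +_) 0# n ≢ 0#

  commutativeRing : CommutativeRing _ _
  commutativeRing = record { isCommutativeRing = isCommutativeRing }

  open CommutativeRing commutativeRing public
    using (+-identityˡ; +-identityʳ; +-assoc; +-comm; *-identityˡ; *-identityʳ; *-assoc; *-comm;
           distribˡ; distribʳ; +-congˡ; +-congʳ; *-congˡ; *-congʳ; zeroˡ; zeroʳ; -‿inverseˡ; -‿inverseʳ; ring; isSemiring; *-commutativeMonoid)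

  cast : ℕ → Fin p
  cast = iterate (1# +_) 0#

module ZSolver {p} (K : PrimeField p) where
  open PrimeField K
  open RingProperties ring using (-‿distribˡ-*; -‿distribʳ-*; -‿involutive; -‿+-comm; -0#≈0#)

  cast-+ : ∀ m n → cast (m ℕ.+ n) ≡ cast m + cast n
  cast-+ zero    n = sym (+-identityˡ _)
  cast-+ (suc m) n = trans (cong (1# +_) (cast-+ m n)) (sym (+-assoc _ _ _))

  cast-* : ∀ m n → cast (m ℕ.* n) ≡ cast m * cast n
  cast-* zero    n = sym (zeroˡ _)
  cast-* (suc m) n = begin
    cast (n ℕ.+ m ℕ.* n)            ≡⟨ cast-+ n (m ℕ.* n) ⟩
    cast n + cast (m ℕ.* n)         ≡⟨ cong₂ _+_ (sym (*-identityˡ _)) (cast-* m n) ⟩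
    1# * cast n + cast m * cast n   ≡⟨ sym (distribʳ _ _ _) ⟩
    (1# + cast m) * cast n          ∎
    where open ≡-Reasoning

  castℤ : ℤ → Fin p
  castℤ (ℤ.+ n)  = cast n
  castℤ -[1+ n ] = - cast (suc n)

  castℤ-⊖ : ∀ m n → castℤ (m ℤ.⊖ n) ≡ cast m + - cast n
  castℤ-⊖ zero    zero    = sym (-‿inverseʳ 0#)
  castℤ-⊖ zero    (suc n) = sym (+-identityˡ _)
  castℤ-⊖ (suc m) zero    = sym (trans (cong (cast (suc m) +_) -0#≈0#) (+-identityʳ _))
  castℤ-⊖ (suc m) (suc n) = begin
    castℤ (suc m ℤ.⊖ suc n)               ≡⟨ cong castℤ (ℤ.[1+m]⊖[1+n]≡m⊖n m n) ⟩
    castℤ (m ℤ.⊖ n)                       ≡⟨ castℤ-⊖ m n ⟩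
    cast m + - cast n                     ≡⟨ cong (_+ - cast n) (sym (+-identityˡ _)) ⟩
    0# + cast m + - cast n                ≡⟨ cong (λ x → x + cast m + - cast n) (sym (-‿inverseʳ 1#)) ⟩
    1# + - 1# + cast m + - cast n         ≡⟨ cong (_+ - cast n) (trans (+-assoc _ _ _) (trans (cong (1# +_) (+-comm _ _)) (sym (+-assoc _ _ _)))) ⟩
    1# + cast m + - 1# + - cast n         ≡⟨ +-assoc _ _ _ ⟩
    1# + cast m + (- 1# + - cast n)       ≡⟨ cong (1# + cast m +_) (-‿+-comm 1# (cast n)) ⟩
    1# + cast m + - (1# + cast n)         ∎
    where open ≡-Reasoning

  castℤ-◃ : ∀ n → castℤ (Sign.- ℤ.◃ n) ≡ - cast n
  castℤ-◃ zero    = sym -0#≈0#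
  castℤ-◃ (suc n) = refl

  castℤ-◃⁺ : ∀ n → castℤ (Sign.+ ℤ.◃ n) ≡ cast n
  castℤ-◃⁺ zero    = refl
  castℤ-◃⁺ (suc n) = refl

  castℤ-+ : ∀ i j → castℤ (i ℤ.+ j) ≡ castℤ i + castℤ j
  castℤ-+ (ℤ.+ m)  (ℤ.+ n)  = cast-+ m n
  castℤ-+ (ℤ.+ m)  -[1+ n ] = castℤ-⊖ m (suc n)
  castℤ-+ -[1+ m ] (ℤ.+ n)  = trans (castℤ-⊖ n (suc m)) (+-comm _ _)
  castℤ-+ -[1+ m ] -[1+ n ] = trans
    (cong -_ (trans (cong cast (sym (ℕ.+-suc (suc m) n))) (cast-+ (suc m) (suc n))))
    (sym (-‿+-comm _ _))

  castℤ-* : ∀ i j → castℤ (i ℤ.* j) ≡ castℤ i * castℤ j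
  castℤ-* (ℤ.+ m)  (ℤ.+ n)  = trans (castℤ-◃⁺ (m ℕ.* n)) (cast-* m n)
  castℤ-* (ℤ.+ m)  -[1+ n ] = trans (castℤ-◃ (m ℕ.* suc n))
    (trans (cong -_ (cast-* m (suc n))) (-‿distribʳ-* _ _))
  castℤ-* -[1+ m ] (ℤ.+ n)  = trans (castℤ-◃ (suc m ℕ.* n))
    (trans (cong -_ (cast-* (suc m) n)) (-‿distribˡ-* _ _))
  castℤ-* -[1+ m ] -[1+ n ] = trans (castℤ-◃⁺ (suc m ℕ.* suc n))
    (trans (cast-* (suc m) (suc n)) (trans (sym (-‿involutive _))
      (trans (cong -_ (-‿distribʳ-* _ _)) (-‿distribˡ-* _ _))))

  castℤ-neg : ∀ i → castℤ (ℤ.- i) ≡ - castℤ i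
  castℤ-neg (ℤ.+ zero)  = sym -0#≈0#
  castℤ-neg (ℤ.+ suc n) = refl
  castℤ-neg -[1+ n ]    = sym (-‿involutive _)

  almostRing : AlmostCommutativeRing _ _
  almostRing = fromCommutativeRing commutativeRing

  -- The solver needs 1 to be interpreted by 1# itself, where castℤ gives 1# + 0#.
  interpretℕ : ℕ → Fin p
  interpretℕ zero          = 0#
  interpretℕ (suc zero)    = 1#
  interpretℕ (suc (suc n)) = 1# + interpretℕ (suc n)

  interpret : ℤ → Fin p
  interpret (ℤ.+ n)  = interpretℕ n
  interpret -[1+ n ] = - interpretℕ (suc n)

  interpretℕ≡cast : ∀ n → interpretℕ n ≡ cast n
  interpretℕ≡cast zero          = refl
  interpretℕ≡cast (suc zero)    = sym (+-identityʳ 1#)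
  interpretℕ≡cast (suc (suc n)) = cong (1# +_) (interpretℕ≡cast (suc n))

  interpret≡castℤ : ∀ i → interpret i ≡ castℤ i
  interpret≡castℤ (ℤ.+ n)  = interpretℕ≡cast n
  interpret≡castℤ -[1+ n ] = cong -_ (interpretℕ≡cast (suc n))

  private
    transport : (_∙_ : ℤ → ℤ → ℤ) (_∘_ : Fin p → Fin p → Fin p) → (∀ i j → castℤ (i ∙ j) ≡ castℤ i ∘ castℤ j) →
                ∀ i j → interpret (i ∙ j) ≡ interpret i ∘ interpret j
    transport _∙_ _∘_ homo i j = trans (interpret≡castℤ (i ∙ j)) (trans (homo i j)
      (cong₂ _∘_ (sym (interpret≡castℤ i)) (sym (interpret≡castℤ j))))

    morphism : AlmostCommutativeRing.rawRing (fromCommutativeRing ℤ.+-*-commutativeRing) -Raw-AlmostCommutative⟶ almostRing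
    morphism = record
      { ⟦_⟧ = interpret ; +-homo = transport ℤ._+_ _+_ castℤ-+ ; *-homo = transport ℤ._*_ _*_ castℤ-*
      ; -‿homo = λ i → trans (interpret≡castℤ (ℤ.- i)) (trans (castℤ-neg i) (cong -_ (sym (interpret≡castℤ i))))
      ; 0-homo = refl ; 1-homo = refl }

    weak : ∀ i j → Maybe (interpret i ≡ interpret j)
    weak i j with i ℤ.≟ j
    ... | yes eq = just (cong interpret eq)
    ... | no  _  = nothing

  open RingSolver _ almostRing morphism weak public
    using (solve; _:+_; _:*_; :-_; _:-_; _:=_; con)

-- Sums and counting

-- The sum is abstract so that unification can invert it.
module Sums {A : Set} {_+_ _*_ : A → A → A} {0# 1# : A} (isSemiring : Structures.IsSemiring _≡_ _+_ _*_ 0# 1#) where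
  private
    semiring : Semiring _ _
    semiring = record { isSemiring = isSemiring }
    module S = SemiringSum semiring

  private variable
    n m : ℕ

  abstract
    sum : (Fin n → A) → A
    sum = S.sum

    sum-empty : (f : Fin 0 → A) → sum f ≡ 0#
    sum-empty f = refl

    sum-suc : (f : Fin (suc n) → A) → sum f ≡ f zero + sum (f ∘ suc)
    sum-suc f = refl

    sum-cong : {f g : Fin n → A} → (∀ i → f i ≡ g i) → sum f ≡ sum g
    sum-cong = S.sum-cong-≗

    sum-+ : (f g : Fin n → A) → sum (λ i → f i + g i) ≡ sum f + sum g
    sum-+ = S.∑-distrib-+

    sum-comm : (f : Fin n → Fin m → A) → sum (λ i → sum (f i)) ≡ sum (λ j → sum (λ i → f i j))
    sum-comm = S.∑-comm

    sum-*ˡ : (a : A) (f : Fin n → A) → a * sum f ≡ sum (λ i → a * f i)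
    sum-*ˡ = S.*-distribˡ-sum

    sum-*ʳ : (a : A) (f : Fin n → A) → sum f * a ≡ sum (λ i → f i * a)
    sum-*ʳ = S.*-distribʳ-sum

    sum-0 : sum {n} (λ _ → 0#) ≡ 0#
    sum-0 {n} = S.sum-replicate-zero n

    sum-remove : (i : Fin (suc n)) (f : Fin (suc n) → A) → sum f ≡ f i + sum (f ∘ punchIn i)
    sum-remove i f = S.sum-remove {i = i} f

  sum-zero : {f : Fin n → A} → (∀ i → f i ≡ 0#) → sum f ≡ 0#
  sum-zero eq = trans (sum-cong eq) sum-0

  sum-single : {f : Fin n → A} (i : Fin n) → (∀ j → j ≢ i → f j ≡ 0#) → sum f ≡ f i
  sum-single {suc n} {f} i off = trans (sum-remove i f) (trans
    (cong (f i +_) (sum-zero (λ j → off (punchIn i j) (Fin.punchInᵢ≢i i j)))) (Semiring.+-identityʳ semiring _))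

  sum-pair : {f : Fin n → A} (i j : Fin n) → i ≢ j → (∀ k → k ≢ i → k ≢ j → f k ≡ 0#) → sum f ≡ f i + f j
  sum-pair {suc n} {f} i j i≢j off = trans (sum-remove i f) (cong (f i +_)
    (trans (sum-single (punchOut i≢j) off′) (cong f (Fin.punchIn-punchOut i≢j))))
    where
    off′ : ∀ k → k ≢ punchOut i≢j → f (punchIn i k) ≡ 0#
    off′ k k≢ = off (punchIn i k) (Fin.punchInᵢ≢i i k)
      (λ eq → k≢ (Fin.punchIn-injective i k _ (trans eq (sym (Fin.punchIn-punchOut i≢j)))))

module Counting where
  open Sums (Semiring.isSemiring ℕ.+-*-semiring) public

  ind : {A : Set} → Dec A → ℕ
  ind d = if does d then 1 else 0

  count : ∀ {n} {P : Fin n → Set} → (∀ i → Dec (P i)) → ℕ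
  count P? = sum (λ i → ind (P? i))

  private variable
    n m : ℕ
    A B : Set

  ind-yes : (d : Dec A) → A → ind d ≡ 1
  ind-yes (yes _) a = refl
  ind-yes (no ¬a) a = ⊥-elim (¬a a)

  ind-no : (d : Dec A) → ¬ A → ind d ≡ 0
  ind-no (yes a) ¬a = ⊥-elim (¬a a)
  ind-no (no _)  ¬a = refl

  ind-mono : (d : Dec A) (e : Dec B) → (A → B) → ind d ℕ.≤ ind e
  ind-mono (no _)  e f = z≤n
  ind-mono (yes a) e f = ℕ.≤-reflexive (sym (ind-yes e (f a)))

  ind-cong : (d : Dec A) (e : Dec B) → (A → B) → (B → A) → ind d ≡ ind e
  ind-cong d e f g = ℕ.≤-antisym (ind-mono d e f) (ind-mono e d g)

  ind-split : (d : Dec A) (e : Dec B) → ind d ≡ ind (d ×-dec e) ℕ.+ ind (d ×-dec ¬? e)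
  ind-split (no _)  e       = refl
  ind-split (yes _) (yes _) = refl
  ind-split (yes _) (no _)  = refl

  sum-mono : (f g : Fin n → ℕ) → (∀ i → f i ℕ.≤ g i) → sum f ℕ.≤ sum g
  sum-mono {zero}  f g le = ℕ.≤-reflexive (trans (sum-empty f) (sym (sum-empty g)))
  sum-mono {suc n} f g le = ℕ.≤-trans (ℕ.≤-reflexive (sum-suc f)) (ℕ.≤-trans
    (ℕ.+-mono-≤ (le zero) (sum-mono (f ∘ suc) (g ∘ suc) (le ∘ suc))) (ℕ.≤-reflexive (sym (sum-suc g))))

  sum-const : ∀ n a → sum {n} (λ _ → a) ≡ n ℕ.* a
  sum-const zero    a = sum-empty _
  sum-const (suc n) a = trans (sum-suc _) (cong (a ℕ.+_) (sum-const n a))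

  sum-≤⇒≡ : (f : Fin n → ℕ) {a : ℕ} → (∀ i → a ℕ.≤ f i) → sum f ℕ.≤ n ℕ.* a → ∀ i → f i ≡ a
  sum-≤⇒≡ {suc n} f {a} lo hi i = ℕ.≤-antisym
    (ℕ.+-cancelʳ-≤ (n ℕ.* a) _ _ (ℕ.≤-trans (ℕ.+-monoʳ-≤ (f i) rest)
      (ℕ.≤-trans (ℕ.≤-reflexive (sym (sum-remove i f))) hi))) (lo i)
    where
    rest : n ℕ.* a ℕ.≤ sum (f ∘ punchIn i)
    rest = ℕ.≤-trans (ℕ.≤-reflexive (sym (sum-const n a))) (sum-mono _ _ (lo ∘ punchIn i))

  sum-≥⇒≡ : (f : Fin n → ℕ) {a : ℕ} → (∀ i → f i ℕ.≤ a) → n ℕ.* a ℕ.≤ sum f → ∀ i → f i ≡ a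
  sum-≥⇒≡ {suc n} f {a} up lo i = ℕ.≤-antisym (up i)
    (ℕ.+-cancelʳ-≤ (n ℕ.* a) _ _ (ℕ.≤-trans lo
      (ℕ.≤-trans (ℕ.≤-reflexive (sum-remove i f)) (ℕ.+-monoʳ-≤ (f i) rest))))
    where
    rest : sum (f ∘ punchIn i) ℕ.≤ n ℕ.* a
    rest = ℕ.≤-trans (sum-mono _ _ (up ∘ punchIn i)) (ℕ.≤-reflexive (sum-const n a))

  minimum≤average : (f : Fin n → ℕ) {a : ℕ} → 0 ℕ.< n → sum f ℕ.≤ a → ∃ λ i → n ℕ.* f i ℕ.≤ a
  minimum≤average {n} f {a} pos le with Fin.any? (λ i → n ℕ.* f i ℕ.≤? a)
  ... | yes found = found
  ... | no none = ⊥-elim (ℕ.<⇒≱ big le′)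
    where
    le′ : n ℕ.* sum f ℕ.≤ n ℕ.* a
    le′ = ℕ.*-monoʳ-≤ n le
    big : n ℕ.* a ℕ.< n ℕ.* sum f
    big = ℕ.≤-trans (ℕ.≤-trans (ℕ.+-monoˡ-≤ (n ℕ.* a) pos)
           (ℕ.≤-reflexive (trans (sym (ℕ.*-suc n a)) (sym (sum-const n (suc a))))))
           (ℕ.≤-trans (sum-mono (λ _ → suc a) (λ i → n ℕ.* f i) (λ i → ℕ.≰⇒> (λ le → none (i , le))))
             (ℕ.≤-reflexive (sym (sum-*ˡ n f))))

  module _ {P : Fin n → Set} (P? : ∀ i → Dec (P i)) where

    module _ {Q : Fin n → Set} (Q? : ∀ i → Dec (Q i)) where

      count-mono : (∀ i → P i → Q i) → count P? ℕ.≤ count Q?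
      count-mono f = sum-mono _ _ (λ i → ind-mono (P? i) (Q? i) (f i))

      count-cong : (∀ i → P i → Q i) → (∀ i → Q i → P i) → count P? ≡ count Q?
      count-cong f g = sum-cong (λ i → ind-cong (P? i) (Q? i) (f i) (g i))

      count-split : count P? ≡ count (λ i → P? i ×-dec Q? i) ℕ.+ count (λ i → P? i ×-dec ¬? (Q? i))
      count-split = trans (sum-cong (λ i → ind-split (P? i) (Q? i))) (sum-+ _ _)

    count-zero : (∀ i → ¬ P i) → count P? ≡ 0
    count-zero none = sum-zero (λ i → ind-no (P? i) (none i))

    count-single : ∀ i → P i → (∀ j → P j → j ≡ i) → count P? ≡ 1
    count-single i pi uniq = trans
      (sum-single i (λ j j≢i → ind-no (P? j) (j≢i ∘ uniq j))) (ind-yes (P? i) pi)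

  count-remove : {P : Fin n → Set} (P? : ∀ i → Dec (P i)) → ∀ i → P i →
                 count P? ≡ suc (count (λ j → P? j ×-dec ¬? (j ≟ i)))
  count-remove P? i pi = trans (count-split P? (_≟ i)) (cong (ℕ._+ count (λ j → P? j ×-dec ¬? (j ≟ i)))
    (count-single (λ j → P? j ×-dec (j ≟ i)) i (pi , refl) (λ j → proj₂)))

  count-pos : {P : Fin n → Set} (P? : ∀ i → Dec (P i)) → ∀ i → P i → 0 ℕ.< count P?
  count-pos P? i pi = ℕ.≤-trans (s≤s z≤n) (ℕ.≤-reflexive (sym (count-remove P? i pi)))

  count≥2 : {P : Fin n → Set} (P? : ∀ i → Dec (P i)) → ∀ i j → P i → P j → i ≢ j → 2 ℕ.≤ count P?
  count≥2 P? i j pi pj i≢j = ℕ.≤-trans (s≤s (count-pos (λ k → P? k ×-dec ¬? (k ≟ i)) j (pj , i≢j ∘ sym)))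
    (ℕ.≤-reflexive (sym (count-remove P? i pi)))

  count-find : {P : Fin n → Set} (P? : ∀ i → Dec (P i)) → 0 ℕ.< count P? → ∃ P
  count-find P? pos with Fin.any? P?
  ... | yes found = found
  ... | no none = ⊥-elim (ℕ.<⇒≢ pos (sym (count-zero P? (λ i pi → none (i , pi)))))

  count-partition : {P : Fin n → Set} (P? : ∀ i → Dec (P i)) {R : Fin n → Fin m → Set} (R? : ∀ i t → Dec (R i t)) →
    (∀ i → P i → ∃ λ t → R i t × (∀ u → R i u → u ≡ t)) →
    count P? ≡ sum (λ t → count (λ i → P? i ×-dec R? i t))
  count-partition P? R? class = trans (sum-cong pointwise) (sum-comm (λ i t → ind (P? i ×-dec R? i t)))
    where
    pointwise : ∀ i → ind (P? i) ≡ count (λ t → P? i ×-dec R? i t)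
    pointwise i with P? i in eq
    ... | no ¬p = sym (sum-zero (λ t → refl))
    ... | yes p with class i p
    ...   | t , r , uniq = sym (count-single (λ t → yes p ×-dec R? i t) t (p , r) (λ u → uniq u ∘ proj₂))

  count-all : {P : Fin n → Set} (P? : ∀ i → Dec (P i)) → (∀ i → P i) → count P? ≡ n
  count-all {n} P? all = trans (sum-cong (λ i → ind-yes (P? i) (all i))) (trans (sum-const _ 1) (ℕ.*-identityʳ n))

-- Linear algebra

module Field {p} (K : PrimeField p) where
  open PrimeField K
  open ZSolver K

  solve-linear : ∀ {a} → a ≢ 0# → ∀ b → ∃ λ s → b + s * a ≡ 0#
  solve-linear {a} a≢0 b = - (b * proj₁ inv) , (begin
    b + - (b * i) * a   ≡⟨ solve 3 (λ b i a → b :+ :- (b :* i) :* a := b :+ :- (b :* (a :* i))) refl b i a ⟩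
    b + - (b * (a * i)) ≡⟨ cong (λ x → b + - (b * x)) (proj₂ inv) ⟩
    b + - (b * 1#)      ≡⟨ cong (λ x → b + - x) (*-identityʳ b) ⟩
    b + - b             ≡⟨ -‿inverseʳ b ⟩
    0#                  ∎)
    where
    open ≡-Reasoning
    inv = inverse a a≢0
    i = proj₁ inv

  zero-product : ∀ {a b} → a * b ≡ 0# → a ≢ 0# → b ≡ 0#
  zero-product {a} {b} ab≡0 a≢0 = begin
    b           ≡⟨ sym (*-identityˡ b) ⟩
    1# * b      ≡⟨ cong (_* b) (sym (proj₂ inv)) ⟩
    a * i * b   ≡⟨ solve 3 (λ a i b → a :* i :* b := i :* (a :* b)) refl a i b ⟩
    i * (a * b) ≡⟨ cong (i *_) ab≡0 ⟩
    i * 0#      ≡⟨ zeroʳ i ⟩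
    0#          ∎
    where
    open ≡-Reasoning
    inv = inverse a a≢0
    i = proj₁ inv

  *-nonzero : ∀ {a b} → a ≢ 0# → b ≢ 0# → a * b ≢ 0#
  *-nonzero a≢0 b≢0 ab≡0 = b≢0 (zero-product ab≡0 a≢0)

  nonzeroˡ : ∀ {a b} → a * b ≢ 0# → a ≢ 0#
  nonzeroˡ ab≢0 refl = ab≢0 (zeroˡ _)

  nonzeroʳ : ∀ {a b} → a * b ≢ 0# → b ≢ 0#
  nonzeroʳ ab≢0 refl = ab≢0 (zeroʳ _)

  +-cancel-zero : ∀ {a b c} → a + c ≡ 0# → b + c ≡ 0# → a ≡ b
  +-cancel-zero {a} {b} {c} eq₁ eq₂ = begin
    a                     ≡⟨ solve 3 (λ a b c → a := (a :+ c) :- (b :+ c) :+ b) refl a b c ⟩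
    (a + c) + - (b + c) + b ≡⟨ cong₂ (λ x y → x + - y + b) eq₁ eq₂ ⟩
    0# + - 0# + b         ≡⟨ cong (_+ b) (-‿inverseʳ 0#) ⟩
    0# + b                ≡⟨ +-identityˡ b ⟩
    b                     ∎
    where open ≡-Reasoning

module Linear {p} (K : PrimeField p) where
  open PrimeField K
  open ZSolver K using (solve; _:+_; _:*_; :-_; _:-_; _:=_; con)
  open Field K public
  open Sums isSemiring public

  F : Set
  F = Fin p

  Vect : ℕ → Set
  Vect m = Fin m → F

  private variable
    m k q : ℕ

  infix 4 _≋_
  _≋_ : Vect m → Vect m → Set
  u ≋ w = ∀ j → u j ≡ w j

  -- Vectors are functions, and `·-cong` stands in for extensionality: a form must not distinguish
  -- vectors that agree in every coordinate.
  record Form (m : ℕ) : Set where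
    infixl 9 _·_
    field
      _·_ : Vect m → F
      ·-cong : ∀ {u w} → u ≋ w → _·_ u ≡ _·_ w
      ·-linear : ∀ a u b w → _·_ (λ j → a * u j + b * w j) ≡ a * _·_ u + b * _·_ w
  open Form public

  lc : F → Vect m → F → Vect m → Vect m
  lc a u b w j = a * u j + b * w j

  absorb : ∀ {x y t} → y ≡ 0# → x + t * y ≡ x
  absorb {t = t} refl = trans (+-congˡ (zeroʳ t)) (+-identityʳ _)

  vanish-combination : ∀ {x y t} → x ≡ 0# → y ≡ 0# → x + t * y ≡ 0#
  vanish-combination x≡0 y≡0 = trans (absorb y≡0) x≡0

  ·-shift : (f : Form m) → ∀ u s w → f · (λ j → u j + s * w j) ≡ f · u + s * (f · w)
  ·-shift f u s w = begin
    f · (λ j → u j + s * w j)       ≡⟨ ·-cong f (λ j → cong (_+ s * w j) (sym (*-identityˡ _))) ⟩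
    f · (λ j → 1# * u j + s * w j)  ≡⟨ ·-linear f 1# u s w ⟩
    1# * (f · u) + s * (f · w)      ≡⟨ cong (_+ s * (f · w)) (*-identityˡ _) ⟩
    f · u + s * (f · w)             ∎
    where open ≡-Reasoning

  ·-zero : (f : Form m) → ∀ {u} → (∀ j → u j ≡ 0#) → f · u ≡ 0#
  ·-zero f {u} eq = begin
    f · u                           ≡⟨ ·-cong f (λ j → trans (eq j) (sym 0+0)) ⟩
    f · (λ j → 0# * u j + 0# * u j) ≡⟨ ·-linear f 0# u 0# u ⟩
    0# * (f · u) + 0# * (f · u)     ≡⟨ 0+0 ⟩
    0#                              ∎
    where
    open ≡-Reasoning
    0+0 : ∀ {x y} → 0# * x + 0# * y ≡ 0#
    0+0 = trans (cong₂ _+_ (zeroˡ _) (zeroˡ _)) (+-identityˡ 0#)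

  zeroForm : Form m
  zeroForm = record
    { _·_ = λ _ → 0# ; ·-cong = λ _ → refl
    ; ·-linear = λ a u b w → solve 2 (λ a b → con (ℤ.+ 0) := a :* con (ℤ.+ 0) :+ b :* con (ℤ.+ 0)) refl a b }

  coordinate : Fin m → Form m
  coordinate i = record { _·_ = λ v → v i ; ·-cong = λ eq → eq i ; ·-linear = λ a u b w → refl }

  infixl 6 _⊞_⊡_
  _⊞_⊡_ : Form m → F → Form m → Form m
  g ⊞ t ⊡ f = record
    { _·_ = λ v → g · v + t * (f · v)
    ; ·-cong = λ eq → cong₂ (λ x y → x + t * y) (·-cong g eq) (·-cong f eq)
    ; ·-linear = λ a u b w → trans (cong₂ (λ x y → x + t * y) (·-linear g a u b w) (·-linear f a u b w))
        (solve 7 (λ a gu b gw t fu fw → (a :* gu :+ b :* gw) :+ t :* (a :* fu :+ b :* fw)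
          := a :* (gu :+ t :* fu) :+ b :* (gw :+ t :* fw)) refl a (g · u) b (g · w) t (f · u) (f · w)) }

  comb : (Fin k → F) → (Fin k → Vect m) → Vect m
  comb a B j = sum (λ i → a i * B i j)

  infix 4 _∈⟨_⟩
  _∈⟨_⟩ : Vect m → (Fin k → Vect m) → Set
  v ∈⟨ B ⟩ = ∃ λ a → v ≋ comb a B

  Independent : (Fin k → Vect m) → Set
  Independent B = ∀ a → (∀ j → comb a B j ≡ 0#) → ∀ i → a i ≡ 0#

  ∈-resp : {B : Fin k → Vect m} → ∀ {u w} → u ≋ w → w ∈⟨ B ⟩ → u ∈⟨ B ⟩
  ∈-resp eq (a , e) = a , λ j → trans (eq j) (e j)

  ∈-cons : (B : Fin (suc k) → Vect m) → ∀ {v u} s → (∀ j → v j ≡ u j + s * B zero j) → u ∈⟨ B ∘ suc ⟩ → v ∈⟨ B ⟩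
  ∈-cons B {v} {u} s eq (a , e) = s ∷ a , λ j → begin
    v j                              ≡⟨ eq j ⟩
    u j + s * B zero j               ≡⟨ +-comm _ _ ⟩
    s * B zero j + u j               ≡⟨ cong (s * B zero j +_) (e j) ⟩
    s * B zero j + comb a (B ∘ suc) j ≡⟨ sym (sum-suc _) ⟩
    comb (s ∷ a) B j                 ∎
    where open ≡-Reasoning

  ∈-uncons : (B : Fin (suc k) → Vect m) → ∀ {v} → v ∈⟨ B ⟩ →
             ∃ λ s → ∃ λ u → u ∈⟨ B ∘ suc ⟩ × (∀ j → v j ≡ u j + s * B zero j)
  ∈-uncons B (a , e) = a zero , comb (a ∘ suc) (B ∘ suc) , (a ∘ suc , λ _ → refl) ,
    λ j → trans (e j) (trans (sum-suc _) (+-comm _ _))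

  zero∈ : {B : Fin k → Vect m} → ∀ {v} → (∀ j → v j ≡ 0#) → v ∈⟨ B ⟩
  zero∈ eq = (λ _ → 0#) , λ j → trans (eq j) (sym (sum-zero (λ i → zeroˡ _)))

  ∈-lc : {B : Fin k → Vect m} → ∀ {u w} x y → u ∈⟨ B ⟩ → w ∈⟨ B ⟩ → lc x u y w ∈⟨ B ⟩
  ∈-lc {B = B} {u} {w} x y (a , e) (b , e′) = (λ i → x * a i + y * b i) , λ j → begin
    x * u j + y * w j                 ≡⟨ cong₂ (λ s t → x * s + y * t) (e j) (e′ j) ⟩
    x * comb a B j + y * comb b B j   ≡⟨ cong₂ _+_ (sum-*ˡ x _) (sum-*ˡ y _) ⟩
    sum (λ i → x * (a i * B i j)) + sum (λ i → y * (b i * B i j)) ≡⟨ sym (sum-+ _ _) ⟩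
    sum (λ i → x * (a i * B i j) + y * (b i * B i j))
      ≡⟨ sum-cong (λ i → solve 5 (λ x a y b v → x :* (a :* v) :+ y :* (b :* v) := (x :* a :+ y :* b) :* v) refl x (a i) y (b i) (B i j)) ⟩
    comb (λ i → x * a i + y * b i) B j ∎
    where open ≡-Reasoning

  ∈-shift : {B : Fin k → Vect m} → ∀ {u w} s → u ∈⟨ B ⟩ → w ∈⟨ B ⟩ → (λ j → u j + s * w j) ∈⟨ B ⟩
  ∈-shift s u∈ w∈ = ∈-resp (λ j → +-congʳ (sym (*-identityˡ _))) (∈-lc 1# s u∈ w∈)

  ∈-scale : {B : Fin k → Vect m} → ∀ {u w} s → (∀ j → u j ≡ s * w j) → w ∈⟨ B ⟩ → u ∈⟨ B ⟩
  ∈-scale s eq w∈ = ∈-resp (λ j → trans (eq j) (sym (+-identityˡ _))) (∈-shift s (zero∈ (λ _ → refl)) w∈)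

  ∈-tail : (B : Fin (suc k) → Vect m) → ∀ {v} → v ∈⟨ B ∘ suc ⟩ → v ∈⟨ B ⟩
  ∈-tail B = ∈-cons B 0# (λ j → sym (trans (+-congˡ (zeroˡ _)) (+-identityʳ _)))

  ∈-head : (B : Fin (suc k) → Vect m) → B zero ∈⟨ B ⟩
  ∈-head B = ∈-cons B 1# (λ j → sym (trans (+-identityˡ _) (*-identityˡ _))) (zero∈ (λ _ → refl))

  ∈-member : (B : Fin k → Vect m) → ∀ i → B i ∈⟨ B ⟩
  ∈-member B zero    = ∈-head B
  ∈-member B (suc i) = ∈-tail B (∈-member (B ∘ suc) i)

  ∈-trans : (B : Fin k → Vect m) {C : Fin q → Vect m} → (∀ i → B i ∈⟨ C ⟩) → ∀ {v} → v ∈⟨ B ⟩ → v ∈⟨ C ⟩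
  ∈-trans {zero}  B sub (a , e) = zero∈ (λ j → trans (e j) (sum-empty _))
  ∈-trans {suc k} B sub v∈ with s , u , u∈ , eq ← ∈-uncons B v∈ =
    ∈-resp eq (∈-shift s (∈-trans (B ∘ suc) (sub ∘ suc) u∈) (sub zero))

  ·-span : (f : Form m) (B : Fin k → Vect m) → (∀ i → f · B i ≡ 0#) → ∀ {v} → v ∈⟨ B ⟩ → f · v ≡ 0#
  ·-span {k = zero}  f B kills (a , e) = ·-zero f (λ j → trans (e j) (sum-empty _))
  ·-span {k = suc k} f B kills v∈ with s , u , u∈ , eq ← ∈-uncons B v∈ =
    trans (·-cong f eq) (trans (·-shift f u s (B zero)) (trans
      (cong₂ (λ x y → x + s * y) (·-span f (B ∘ suc) (kills ∘ suc) u∈) (kills zero))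
      (trans (+-identityˡ _) (zeroʳ s))))

  independent-[] : (B : Fin 0 → Vect m) → Independent B
  independent-[] B a e ()

  independent-∷ : (B : Fin (suc k) → Vect m) → Independent (B ∘ suc) → ¬ (B zero ∈⟨ B ∘ suc ⟩) → Independent B
  independent-∷ B ind ∉ a e = λ { zero → a₀≡0 ; (suc i) → ind (a ∘ suc) rest i }
    where
    split : ∀ j → comb (a ∘ suc) (B ∘ suc) j + a zero * B zero j ≡ 0#
    split j = trans (+-comm _ _) (trans (sym (sum-suc _)) (e j))
    a₀≡0 : a zero ≡ 0#
    a₀≡0 with a zero ≟ 0#
    ... | yes eq = eq
    ... | no a₀≢0 with b , eq ← inverse (a zero) a₀≢0 = ⊥-elim (∉ (∈-scale (- b) scaled (a ∘ suc , λ _ → refl)))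
      where
      open ≡-Reasoning
      scaled : ∀ j → B zero j ≡ - b * comb (a ∘ suc) (B ∘ suc) j
      scaled j = begin
        B zero j                                      ≡⟨ sym (*-identityˡ _) ⟩
        1# * B zero j                                 ≡⟨ cong (_* B zero j) (sym eq) ⟩
        a zero * b * B zero j
          ≡⟨ solve 4 (λ a b v c → a :* b :* v := b :* (c :+ a :* v) :+ :- b :* c) refl (a zero) b (B zero j) (comb (a ∘ suc) (B ∘ suc) j) ⟩
        b * (comb (a ∘ suc) (B ∘ suc) j + a zero * B zero j) + - b * comb (a ∘ suc) (B ∘ suc) j ≡⟨ +-congʳ (*-congˡ (split j)) ⟩
        b * 0# + - b * comb (a ∘ suc) (B ∘ suc) j     ≡⟨ +-congʳ (zeroʳ b) ⟩
        0# + - b * comb (a ∘ suc) (B ∘ suc) j         ≡⟨ +-identityˡ _ ⟩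
        - b * comb (a ∘ suc) (B ∘ suc) j              ∎
    rest : ∀ j → comb (a ∘ suc) (B ∘ suc) j ≡ 0#
    rest j = trans (sym (trans (+-congˡ (*-congʳ a₀≡0)) (trans (+-congˡ (zeroˡ _)) (+-identityʳ _)))) (split j)

  independent-tail : (B : Fin (suc k) → Vect m) → Independent B → Independent (B ∘ suc)
  independent-tail B ind a e i = ind (0# ∷ a) (λ j → trans (sum-suc _)
    (trans (cong₂ _+_ (zeroˡ _) (e j)) (+-identityˡ 0#))) (suc i)

  independent-head : (B : Fin (suc k) → Vect m) → Independent B → ¬ (B zero ∈⟨ B ∘ suc ⟩)
  independent-head B ind (a , e) = 1≢0 (ind (1# ∷ (λ i → - a i)) vanish zero)
    where
    open ≡-Reasoning
    vanish : ∀ j → comb (1# ∷ (λ i → - a i)) B j ≡ 0#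
    vanish j = begin
      comb (1# ∷ (λ i → - a i)) B j                       ≡⟨ sum-suc _ ⟩
      1# * B zero j + sum (λ i → - a i * B (suc i) j)     ≡⟨ cong₂ _+_ (*-identityˡ _) (sum-cong (λ i → solve 2 (λ a v → :- a :* v := :- con (ℤ.+ 1) :* (a :* v)) refl (a i) (B (suc i) j))) ⟩
      B zero j + sum (λ i → - 1# * (a i * B (suc i) j)) ≡⟨ cong (B zero j +_) (sym (sum-*ˡ _ _)) ⟩
      B zero j + - 1# * comb a (B ∘ suc) j ≡⟨ cong (λ x → B zero j + - 1# * x) (sym (e j)) ⟩
      B zero j + - 1# * B zero j           ≡⟨ solve 1 (λ v → v :+ con (ℤ.- (ℤ.+ 1)) :* v := con (ℤ.+ 0)) refl (B zero j) ⟩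
      0#                                                  ∎

  Kills : (Fin q → Form m) → Vect m → Set
  Kills fs v = ∀ i → fs i · v ≡ 0#

  kills? : (fs : Fin q → Form m) → ∀ v → Dec (Kills fs v)
  kills? fs v = Fin.all? (λ i → fs i · v ≟ 0#)

  -- One step of elimination: the common kernel of `forms` is that of `fs` enlarged by the vector R,
  -- at the cost of one form.
  record Reduction (fs : Fin q → Form m) (R : Vect m) : Set where
    field
      size     : ℕ
      drop-one : q ≡ suc size
      forms    : Fin size → Form m
      kills    : Kills forms R
      weaker   : ∀ v → Kills fs v → Kills forms v
      shift    : ∀ v → Kills forms v → ∃ λ a → Kills fs (λ j → v j + a * R j)

  -- The first form that does not vanish at R is the pivot. A multiple of it is added to each later
  -- form so that these vanish at R, and the pivot is dropped.
  reduce : (fs : Fin q → Form m) → ∀ R → Kills fs R ⊎ Reduction fs R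
  reduce {zero}  fs R = inj₁ (λ ())
  reduce {suc q} fs R with fs zero · R ≟ 0#
  ... | no f₀R≢0 = inj₂ (record
    { size = q ; drop-one = refl
    ; forms = λ i → fs (suc i) ⊞ s i ⊡ fs zero
    ; kills = λ i → proj₂ (solve-linear f₀R≢0 (fs (suc i) · R))
    ; weaker = λ v kv i → trans (cong₂ (λ x y → x + s i * y) (kv (suc i)) (kv zero)) (trans (+-identityˡ _) (zeroʳ _))
    ; shift = λ v kv → proj₁ (coef v) , λ
        { zero → zeroth v
        ; (suc i) → begin
            fs (suc i) · (λ j → v j + proj₁ (coef v) * R j)           ≡⟨ ·-shift (fs (suc i)) v _ R ⟩
            fs (suc i) · v + proj₁ (coef v) * (fs (suc i) · R)
              ≡⟨ solve 6 (λ fv c fR s gv gR → fv :+ c :* fR := (fv :+ s :* gv) :+ c :* (fR :+ s :* gR) :- s :* (gv :+ c :* gR)) refl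
                   (fs (suc i) · v) (proj₁ (coef v)) (fs (suc i) · R) (s i) (fs zero · v) (fs zero · R) ⟩
            (fs (suc i) · v + s i * (fs zero · v)) + proj₁ (coef v) * (fs (suc i) · R + s i * (fs zero · R)) + - (s i * (fs zero · v + proj₁ (coef v) * (fs zero · R)))
              ≡⟨ cong₂ _+_ (cong₂ (λ x y → x + proj₁ (coef v) * y) (kv i) (proj₂ (solve-linear f₀R≢0 (fs (suc i) · R)))) (cong (λ x → - (s i * x)) (proj₂ (coef v))) ⟩
            0# + proj₁ (coef v) * 0# + - (s i * 0#)
              ≡⟨ solve 2 (λ c s → con (ℤ.+ 0) :+ c :* con (ℤ.+ 0) :- s :* con (ℤ.+ 0) := con (ℤ.+ 0)) refl (proj₁ (coef v)) (s i) ⟩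
            0# ∎ } })
    where
    open ≡-Reasoning
    s : Fin q → F
    s i = proj₁ (solve-linear f₀R≢0 (fs (suc i) · R))
    coef : ∀ v → ∃ λ c → fs zero · v + c * (fs zero · R) ≡ 0#
    coef v = solve-linear f₀R≢0 (fs zero · v)
    zeroth : ∀ v → fs zero · (λ j → v j + proj₁ (coef v) * R j) ≡ 0#
    zeroth v = trans (·-shift (fs zero) v _ R) (proj₂ (coef v))
  ... | yes f₀R≡0 with reduce (fs ∘ suc) R
  ...   | inj₁ kills = inj₁ (λ { zero → f₀R≡0 ; (suc i) → kills i })
  ...   | inj₂ red = inj₂ (record
    { size = suc (Reduction.size red) ; drop-one = cong suc (Reduction.drop-one red)
    ; forms = fs zero ∷ Reduction.forms red
    ; kills = λ { zero → f₀R≡0 ; (suc i) → Reduction.kills red i }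
    ; weaker = λ { v kv zero → kv zero ; v kv (suc i) → Reduction.weaker red v (kv ∘ suc) i }
    ; shift = λ v kv → let a , ka = Reduction.shift red v (kv ∘ suc) in a , λ
        { zero → trans (·-shift (fs zero) v a R) (trans (cong₂ (λ x y → x + a * y) (kv zero) f₀R≡0)
            (trans (+-identityˡ _) (zeroʳ a)))
        ; (suc i) → ka i } })

  -- Linear equations for ⟨B⟩. They make membership decidable and supply the forms of `separate`;
  -- `dimension` is what later forces two large subspaces to intersect.
  record Annihilator (B : Fin k → Vect m) : Set where
    field
      size      : ℕ
      forms     : Fin size → Form m
      kills     : ∀ i → Kills forms (B i)
      complete  : ∀ v → Kills forms v → v ∈⟨ B ⟩
      dimension : Independent B → size ℕ.+ k ≡ m

  annihilator : (B : Fin k → Vect m) → Annihilator B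
  annihilator {zero} {m} B = record
    { size = m ; forms = coordinate ; kills = λ () ; complete = λ v kv → zero∈ kv
    ; dimension = λ _ → ℕ.+-identityʳ m }
  annihilator {suc k} B with annihilator (B ∘ suc)
  ... | A with reduce (Annihilator.forms A) (B zero)
  ...   | inj₁ kills = record
    { size = size ; forms = forms ; kills = λ { zero → kills ; (suc i) → Annihilator.kills A i }
    ; complete = λ v kv → ∈-tail B (complete v kv)
    ; dimension = λ ind → ⊥-elim (independent-head B ind (complete (B zero) kills)) }
    where open Annihilator A hiding (kills)
  ...   | inj₂ red = record
    { size = Reduction.size red ; forms = Reduction.forms red
    ; kills = λ { zero → Reduction.kills red ; (suc i) → Reduction.weaker red _ (Annihilator.kills A i) }
    ; complete = λ v kv → let a , ka = Reduction.shift red v kv in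
        ∈-cons B (- a) (λ j → solve 3 (λ v a R → v := (v :+ a :* R) :+ :- a :* R) refl (v j) a (B zero j))
          (Annihilator.complete A _ ka)
    ; dimension = λ ind → trans (ℕ.+-suc _ k) (trans (cong (ℕ._+ k) (sym (Reduction.drop-one red))) (Annihilator.dimension A (independent-tail B ind))) }

  kills-span : {B : Fin k → Vect m} (A : Annihilator B) → ∀ {v} → v ∈⟨ B ⟩ → Kills (Annihilator.forms A) v
  kills-span {B = B} A v∈ i = ·-span (Annihilator.forms A i) B (λ j → Annihilator.kills A j i) v∈

  infix 4 _∈⟨_⟩?
  _∈⟨_⟩? : ∀ v (B : Fin k → Vect m) → Dec (v ∈⟨ B ⟩)
  v ∈⟨ B ⟩? = mapDec (complete v) (kills-span A) (kills? forms v)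
    where
    A = annihilator B
    open Annihilator A

  separate : (B : Fin k → Vect m) → ∀ {v} → ¬ (v ∈⟨ B ⟩) → ∃ λ f → (∀ {u} → u ∈⟨ B ⟩ → f · u ≡ 0#) × f · v ≢ 0#
  separate B {v} v∉ with Fin.any? (λ i → ¬? (forms i · v ≟ 0#))
    where
    A = annihilator B
    open Annihilator A
  ... | yes (i , fv≢0) = Annihilator.forms (annihilator B) i , (λ u∈ → kills-span (annihilator B) u∈ i) , fv≢0
  ... | no none = ⊥-elim (v∉ (Annihilator.complete (annihilator B) v kv))
    where
    kv : Kills (Annihilator.forms (annihilator B)) v
    kv i with Annihilator.forms (annihilator B) i · v ≟ 0#
    ... | yes eq = eq
    ... | no neq = ⊥-elim (none (i , neq))

  record Kernel (E : Fin k → Vect m) (f : Form m) : Set where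
    field
      size        : ℕ
      basis       : Fin size → Vect m
      independent : Independent basis
      bound       : k ℕ.≤ suc size
      sound       : ∀ {v} → v ∈⟨ basis ⟩ → v ∈⟨ E ⟩ × f · v ≡ 0#
      complete    : ∀ {v} → v ∈⟨ E ⟩ → f · v ≡ 0# → v ∈⟨ basis ⟩

  -- If f vanishes at the first basis vector, that vector is kept; otherwise its multiples are used
  -- to make f vanish at all the others, and it is dropped. So at most one dimension is lost.
  kernel : (E : Fin k → Vect m) → Independent E → (f : Form m) → Kernel E f
  kernel {zero} E ind f = record
    { size = 0 ; basis = E ; independent = ind ; bound = z≤n
    ; sound = λ v∈ → v∈ , ·-span f E (λ ()) v∈ ; complete = λ v∈ _ → v∈ }
  kernel {suc k} {m} E ind f with f · E zero ≟ 0#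
  ... | yes fE₀≡0 = record
    { size = suc size ; basis = E zero ∷ basis
    ; independent = independent-∷ (E zero ∷ basis) independent (independent-head E ind ∘ proj₁ ∘ sound)
    ; bound = s≤s bound
    ; sound = λ v∈ → let s , u , u∈ , eq = ∈-uncons (E zero ∷ basis) v∈ in
        ∈-cons E s eq (proj₁ (sound u∈)) ,
        trans (·-cong f eq) (trans (·-shift f u s (E zero)) (trans (cong₂ (λ x y → x + s * y) (proj₂ (sound u∈)) fE₀≡0)
          (trans (+-identityˡ _) (zeroʳ s))))
    ; complete = λ {v} v∈ fv≡0 → let s , u , u∈ , eq = ∈-uncons E v∈ in
        ∈-cons (E zero ∷ basis) s eq (complete u∈ (trans (sym (trans (cong (λ x → f · u + s * x) fE₀≡0)
          (trans (cong (f · u +_) (zeroʳ s)) (+-identityʳ _))))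
          (trans (sym (trans (·-cong f eq) (·-shift f u s (E zero)))) fv≡0))) }
    where open Kernel (kernel (E ∘ suc) (independent-tail E ind) f)
  ... | no fE₀≢0 = record
    { size = k ; basis = E′ ; independent = ind′ ; bound = ℕ.≤-refl ; sound = sound′ ; complete = complete′ }
    where
    open ≡-Reasoning
    s : Fin k → F
    s i = proj₁ (solve-linear fE₀≢0 (f · E (suc i)))
    E′ : Fin k → Vect m
    E′ i j = E (suc i) j + s i * E zero j
    fE′ : ∀ i → f · E′ i ≡ 0#
    fE′ i = trans (·-shift f (E (suc i)) (s i) (E zero)) (proj₂ (solve-linear fE₀≢0 (f · E (suc i))))
    comb-E′ : ∀ a j → comb a E′ j ≡ comb a (E ∘ suc) j + sum (λ i → a i * s i) * E zero j
    comb-E′ a j = begin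
      sum (λ i → a i * (E (suc i) j + s i * E zero j))
        ≡⟨ sum-cong (λ i → solve 4 (λ a e s z → a :* (e :+ s :* z) := a :* e :+ a :* s :* z) refl (a i) (E (suc i) j) (s i) (E zero j)) ⟩
      sum (λ i → a i * E (suc i) j + a i * s i * E zero j) ≡⟨ sum-+ _ _ ⟩
      comb a (E ∘ suc) j + sum (λ i → a i * s i * E zero j) ≡⟨ cong (comb a (E ∘ suc) j +_) (sym (sum-*ʳ _ _)) ⟩
      comb a (E ∘ suc) j + sum (λ i → a i * s i) * E zero j ∎
    ind′ : Independent E′
    ind′ a e i = ind (sum (λ i → a i * s i) ∷ a)
      (λ j → trans (sum-suc _) (trans (+-comm _ _) (trans (sym (comb-E′ a j)) (e j)))) (suc i)
    sound′ : ∀ {v} → v ∈⟨ E′ ⟩ → v ∈⟨ E ⟩ × f · v ≡ 0#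
    sound′ v∈@(a , e) = ∈-cons E _ (λ j → trans (e j) (comb-E′ a j)) (a , λ _ → refl) , ·-span f E′ fE′ v∈
    complete′ : ∀ {v} → v ∈⟨ E ⟩ → f · v ≡ 0# → v ∈⟨ E′ ⟩
    complete′ {v} (a , e) fv≡0 = a ∘ suc , λ j → begin
      v j                                            ≡⟨ difference j ⟩
      comb (a ∘ suc) E′ j + (a zero + - t) * E zero j ≡⟨ +-congˡ (*-congʳ c≡0) ⟩
      comb (a ∘ suc) E′ j + 0# * E zero j            ≡⟨ +-congˡ (zeroˡ _) ⟩
      comb (a ∘ suc) E′ j + 0#                       ≡⟨ +-identityʳ _ ⟩
      comb (a ∘ suc) E′ j                            ∎
      where
      t = sum (λ i → a (suc i) * s i)
      difference : ∀ j → v j ≡ comb (a ∘ suc) E′ j + (a zero + - t) * E zero j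
      difference j = begin
        v j                                          ≡⟨ trans (e j) (sum-suc _) ⟩
        a zero * E zero j + comb (a ∘ suc) (E ∘ suc) j
          ≡⟨ solve 4 (λ a₀ z w t → a₀ :* z :+ w := (w :+ t :* z) :+ (a₀ :- t) :* z) refl (a zero) (E zero j) (comb (a ∘ suc) (E ∘ suc) j) t ⟩
        (comb (a ∘ suc) (E ∘ suc) j + t * E zero j) + (a zero + - t) * E zero j ≡⟨ +-congʳ (sym (comb-E′ (a ∘ suc) j)) ⟩
        comb (a ∘ suc) E′ j + (a zero + - t) * E zero j ∎
      -- The form f vanishes at v and on ⟨E′⟩, so it also vanishes at their difference, a multiple
      -- of `E zero`; as f is nonzero there, the coefficient is zero.
      c≡0 : a zero + - t ≡ 0#
      c≡0 = zero-product (trans (*-comm _ _) (begin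
        (a zero + - t) * (f · E zero)                       ≡⟨ sym (+-identityˡ _) ⟩
        0# + (a zero + - t) * (f · E zero)                  ≡⟨ +-congʳ (sym (·-span f E′ fE′ (a ∘ suc , λ _ → refl))) ⟩
        f · comb (a ∘ suc) E′ + (a zero + - t) * (f · E zero) ≡⟨ sym (·-shift f _ _ _) ⟩
        f · (λ j → comb (a ∘ suc) E′ j + (a zero + - t) * E zero j) ≡⟨ sym (·-cong f difference) ⟩
        f · v                                               ≡⟨ fv≡0 ⟩
        0#                                                  ∎)) fE₀≢0

-- Orthogonality to forms of degree less than p

module Powers {p} (K : PrimeField p) where
  open PrimeField K
  open ZSolver K using (solve; _:+_; _:*_; :-_; _:-_; _:=_; con)
  open Field K

  infixr 8 _^_
  _^_ : Fin p → ℕ → Fin p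
  a ^ zero  = 1#
  a ^ suc d = a * a ^ d

  evaluate : ℕ → (ℕ → Fin p) → Fin p → Fin p
  evaluate zero    a t = 0#
  evaluate (suc k) a t = a 0 + t * evaluate k (a ∘ suc) t

  -- Synthetic division by t - r: the coefficient with index j is the value at r of the polynomial
  -- formed by the coefficients after index j.
  quotient : ℕ → (ℕ → Fin p) → Fin p → ℕ → Fin p
  quotient zero    a r j       = 0#
  quotient (suc k) a r zero    = evaluate (suc k) (a ∘ suc) r
  quotient (suc k) a r (suc j) = quotient k (a ∘ suc) r j

  evaluate-quotient : ∀ k a r t → evaluate (suc k) a t ≡ evaluate (suc k) a r + (t + - r) * evaluate k (quotient k a r) t
  evaluate-quotient zero a r t = solve 3 (λ a r t → a :+ t :* con (ℤ.+ 0) := a :+ r :* con (ℤ.+ 0) :+ (t :- r) :* con (ℤ.+ 0)) refl (a 0) r t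
  evaluate-quotient (suc k) a r t = trans
    (cong (λ x → a 0 + t * x) (evaluate-quotient k (a ∘ suc) r t))
    (solve 5 (λ a t r g q → a :+ t :* (g :+ (t :- r) :* q) := a :+ r :* g :+ (t :- r) :* (g :+ t :* q)) refl
      (a 0) t r (evaluate (suc k) (a ∘ suc) r) (evaluate k (quotient k (a ∘ suc) r) t))

  quotient-zero : ∀ k a r → evaluate (suc k) a r ≡ 0# → (∀ j → j ℕ.< k → quotient k a r j ≡ 0#) → ∀ j → j ℕ.< suc k → a j ≡ 0#
  quotient-zero zero a r root none zero (s≤s z≤n) = trans (sym (trans (+-congˡ (zeroʳ r)) (+-identityʳ _))) root
  quotient-zero (suc k) a r root none (suc j) (s≤s j<) = quotient-zero k (a ∘ suc) r (none 0 (s≤s z≤n)) (λ i i< → none (suc i) (s≤s i<)) j j<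
  quotient-zero (suc k) a r root none zero _ =
    trans (sym (trans (+-congˡ (trans (*-congˡ (none 0 (s≤s z≤n))) (zeroʳ r))) (+-identityʳ _))) root

  difference≢0 : ∀ {a b} → a ≢ b → a + - b ≢ 0#
  difference≢0 {a} {b} a≢b eq = a≢b (+-cancel-zero eq (-‿inverseʳ b))

  -- The first root is divided out, and the others are roots of the quotient because they differ
  -- from it. The lemma serves with all p scalars as roots: a polynomial of degree below p that
  -- vanishes everywhere has zero coefficients.
  vanishing-polynomial : ∀ k a (roots : Fin k → Fin p) → (∀ {i j} → roots i ≡ roots j → i ≡ j) →
    (∀ i → evaluate k a (roots i) ≡ 0#) → ∀ j → j ℕ.< k → a j ≡ 0#
  vanishing-polynomial (suc k) a roots inj root = quotient-zero k a r (root zero)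
    (vanishing-polynomial k (quotient k a r) (roots ∘ suc) (Fin.suc-injective ∘ inj) λ i →
      zero-product (begin
        (roots (suc i) + - r) * evaluate k (quotient k a r) (roots (suc i))   ≡⟨ sym (+-identityˡ _) ⟩
        0# + (roots (suc i) + - r) * evaluate k (quotient k a r) (roots (suc i)) ≡⟨ +-congʳ (sym (root zero)) ⟩
        evaluate (suc k) a r + (roots (suc i) + - r) * evaluate k (quotient k a r) (roots (suc i)) ≡⟨ sym (evaluate-quotient k a r _) ⟩
        evaluate (suc k) a (roots (suc i))                                    ≡⟨ root (suc i) ⟩
        0#                                                                    ∎)
        (difference≢0 (λ eq → case-0 (inj eq))))
    where
    open ≡-Reasoning
    r = roots zero
    case-0 : ∀ {i : Fin k} → Fin.suc i ≡ zero → ⊥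
    case-0 ()

  evaluate-linear : ∀ k x y a b t → evaluate k (λ j → x * a j + y * b j) t ≡ x * evaluate k a t + y * evaluate k b t
  evaluate-linear zero x y a b t = solve 2 (λ x y → con (ℤ.+ 0) := x :* con (ℤ.+ 0) :+ y :* con (ℤ.+ 0)) refl x y
  evaluate-linear (suc k) x y a b t = trans (cong (λ z → x * a 0 + y * b 0 + t * z) (evaluate-linear k x y (a ∘ suc) (b ∘ suc) t))
    (solve 7 (λ x y a b t p q → x :* a :+ y :* b :+ t :* (x :* p :+ y :* q) := x :* (a :+ t :* p) :+ y :* (b :+ t :* q)) refl
      x y (a 0) (b 0) t (evaluate k (a ∘ suc) t) (evaluate k (b ∘ suc) t))

  -- The coefficient of t^j in (x + t y)^d, by the recursion of Pascal's triangle.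
  binomial : Fin p → Fin p → ℕ → ℕ → Fin p
  binomial x y zero    zero    = 1#
  binomial x y zero    (suc j) = 0#
  binomial x y (suc d) zero    = x * binomial x y d zero
  binomial x y (suc d) (suc j) = x * binomial x y d (suc j) + y * binomial x y d j

  evaluate-0 : ∀ k t → evaluate k (λ _ → 0#) t ≡ 0#
  evaluate-0 zero    t = refl
  evaluate-0 (suc k) t = trans (+-identityˡ _) (trans (*-congˡ (evaluate-0 k t)) (zeroʳ t))

  evaluate-binomial : ∀ x y t d k → d ℕ.< k → evaluate k (binomial x y d) t ≡ (x + t * y) ^ d
  evaluate-binomial x y t zero (suc k) d<k = trans (+-congˡ (trans (*-congˡ (evaluate-0 k t)) (zeroʳ t))) (+-identityʳ 1#)
  evaluate-binomial x y t (suc d) (suc k) (s≤s d<k) = begin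
    x * b 0 + t * evaluate k (λ j → x * b (suc j) + y * b j) t
      ≡⟨ cong (λ z → x * b 0 + t * z) (evaluate-linear k x y (b ∘ suc) b t) ⟩
    x * b 0 + t * (x * evaluate k (b ∘ suc) t + y * evaluate k b t)
      ≡⟨ solve 6 (λ x b t q y r → x :* b :+ t :* (x :* q :+ y :* r) := x :* (b :+ t :* q) :+ t :* y :* r) refl x (b 0) t (evaluate k (b ∘ suc) t) y (evaluate k b t) ⟩
    x * evaluate (suc k) b t + t * y * evaluate k b t
      ≡⟨ cong₂ (λ q r → x * q + t * y * r) (evaluate-binomial x y t d (suc k) (ℕ.m≤n⇒m≤1+n d<k)) (evaluate-binomial x y t d k d<k) ⟩
    x * (x + t * y) ^ d + t * y * (x + t * y) ^ d ≡⟨ sym (distribʳ _ _ _) ⟩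
    (x + t * y) * (x + t * y) ^ d ∎
    where
    open ≡-Reasoning
    b = binomial x y d

  binomial-0 : ∀ x y d → binomial x y d 0 ≡ x ^ d
  binomial-0 x y zero    = refl
  binomial-0 x y (suc d) = *-congˡ (binomial-0 x y d)

  binomial-1 : ∀ x y d → binomial x y (suc d) 1 ≡ cast (suc d) * (x ^ d * y)
  binomial-1 x y zero = solve 2 (λ x y → x :* con (ℤ.+ 0) :+ y :* con (ℤ.+ 1) := (con (ℤ.+ 1) :+ con (ℤ.+ 0)) :* (con (ℤ.+ 1) :* y)) refl x y
  binomial-1 x y (suc d) = trans (cong₂ (λ a b → x * a + y * b) (binomial-1 x y d) (binomial-0 x y (suc d)))
    (solve 4 (λ x y c q → x :* (c :* (q :* y)) :+ y :* (x :* q) := (con (ℤ.+ 1) :+ c) :* (x :* q :* y)) refl x y (cast (suc d)) (x ^ d))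

-- Multiplication by a permutes the nonzero scalars, so their product is not changed by the factor
-- a^(p-1); the product is itself nonzero.
fermat : ∀ {p} (K : PrimeField p) → let open PrimeField K; open Powers K in ∀ {a} → a ≢ 0# → a ^ (p ℕ.∸ 1) ≡ 1#
fermat {zero}  K with () ← PrimeField.0# K
fermat {suc q} K {a} a≢0 = sym (+-cancel-zero {c = - 1#} (-‿inverseʳ 1#) (zero-product difference product≢0))
  where
  open PrimeField K
  open ZSolver K using (solve; _:+_; _:*_; :-_; _:-_; _:=_; con)
  open Field K
  open Powers K
  open MonoidSum *-commutativeMonoid using () renaming (sum to product; sum-remove to product-remove; sum-permute to product-permute; sum-cong-≗ to product-cong)
  open ≡-Reasoning

  b = proj₁ (inverse a a≢0)

  multiply : Permutation (suc q) (suc q)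
  multiply = permutation (a *_) (b *_)
    (λ x → cancel x (solve 3 (λ a b x → a :* (b :* x) := (a :* b) :* x) refl a b x))
    (λ x → cancel x (solve 3 (λ a b x → b :* (a :* x) := (a :* b) :* x) refl a b x))
    where
    cancel : ∀ x {y} → y ≡ a * b * x → y ≡ x
    cancel x eq = trans eq (trans (*-congʳ (proj₂ (inverse a a≢0))) (*-identityˡ x))

  -- The permutation acts on all of `Fin p`. Replacing 0 by 1 makes the product over all scalars
  -- equal to the product of the units.
  unit-part : Fin (suc q) → Fin (suc q)
  unit-part x with x ≟ 0#
  ... | yes _ = 1#
  ... | no  _ = x

  unit-part-0 : ∀ {x} → x ≡ 0# → unit-part x ≡ 1#
  unit-part-0 {x} eq with x ≟ 0#
  ... | yes _ = refl
  ... | no ne = ⊥-elim (ne eq)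

  unit-part-unit : ∀ {x} → x ≢ 0# → unit-part x ≡ x
  unit-part-unit {x} ne with x ≟ 0#
  ... | yes eq = ⊥-elim (ne eq)
  ... | no _ = refl

  units : Fin q → Fin (suc q)
  units = punchIn 0#

  product-scale : ∀ {n} (f : Fin n → Fin (suc q)) → product (λ i → a * f i) ≡ a ^ n * product f
  product-scale {zero}  f = sym (*-identityˡ 1#)
  product-scale {suc n} f = trans (cong (a * f zero *_) (product-scale (f ∘ suc)))
    (solve 4 (λ a x y z → a :* x :* (y :* z) := a :* y :* (x :* z)) refl a (f zero) (a ^ n) (product (f ∘ suc)))

  product-nonzero : ∀ {n} (f : Fin n → Fin (suc q)) → (∀ i → f i ≢ 0#) → product f ≢ 0#
  product-nonzero {zero}  f ne = 1≢0
  product-nonzero {suc n} f ne = *-nonzero (ne zero) (product-nonzero (f ∘ suc) (ne ∘ suc))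

  product≢0 : product units ≢ 0#
  product≢0 = product-nonzero units (Fin.punchInᵢ≢i 0#)

  product-units : product unit-part ≡ product units
  product-units = begin
    product unit-part                              ≡⟨ product-remove {i = 0#} unit-part ⟩
    unit-part 0# * product (unit-part ∘ units)     ≡⟨ cong₂ _*_ (unit-part-0 refl) (product-cong (λ i → unit-part-unit (Fin.punchInᵢ≢i 0# i))) ⟩
    1# * product units                             ≡⟨ *-identityˡ _ ⟩
    product units                                  ∎

  product-shifted : product (λ x → unit-part (a * x)) ≡ a ^ q * product units
  product-shifted = begin
    product (λ x → unit-part (a * x))              ≡⟨ product-remove {i = 0#} (λ x → unit-part (a * x)) ⟩
    unit-part (a * 0#) * product (λ i → unit-part (a * units i))
      ≡⟨ cong₂ _*_ (unit-part-0 (zeroʳ a)) (product-cong (λ i → unit-part-unit (*-nonzero a≢0 (Fin.punchInᵢ≢i 0# i)))) ⟩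
    1# * product (λ i → a * units i)               ≡⟨ *-identityˡ _ ⟩
    product (λ i → a * units i)                    ≡⟨ product-scale units ⟩
    a ^ q * product units                          ∎

  difference : product units * (a ^ q + - 1#) ≡ 0#
  difference = begin
    product units * (a ^ q + - 1#)                 ≡⟨ solve 2 (λ x y → x :* (y :- con (ℤ.+ 1)) := y :* x :- x) refl (product units) (a ^ q) ⟩
    a ^ q * product units + - product units        ≡⟨ +-congʳ (trans (sym product-shifted) (trans (sym (product-permute unit-part multiply)) product-units)) ⟩
    product units + - product units                ≡⟨ -‿inverseʳ _ ⟩
    0#                                             ∎

module Orthogonality {p} (K : PrimeField p) {m N : ℕ} (v : Fin N → Linear.Vect K m) where
  open PrimeField K
  open ZSolver K using (solve; _:+_; _:*_; :-_; _:-_; _:=_; con)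
  open Linear K
  open Powers K

  -- For d < p the d-th powers of linear forms span all forms of degree d; Perp-multiply is the substitute for this.
  Perp : ℕ → (Fin N → F) → Set
  Perp d c = ∀ f → sum (λ i → c i * (f · v i) ^ d) ≡ 0#

  -- The hypothesis for f + t g is a polynomial in t of degree d + 1 < p that vanishes for all p
  -- values of t. Its coefficient at t is d + 1 times the sum in question, and d + 1 is invertible.
  Perp-multiply : ∀ {d c} → suc d ℕ.< p → Perp (suc d) c → ∀ g → Perp d (λ i → c i * (g · v i))
  Perp-multiply {d} {c} d<p perp g f = begin
    sum (λ i → c i * (g · v i) * (f · v i) ^ d) ≡⟨ zero-product scaled (characteristic-minimal (suc d) (s≤s z≤n) d<p) ⟩
    0#                                          ∎
    where
    open ≡-Reasoning
    A : ℕ → F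
    A j = sum (λ i → c i * binomial (f · v i) (g · v i) (suc d) j)
    evaluate-A : ∀ k (b : Fin N → ℕ → F) t → evaluate k (λ j → sum (λ i → c i * b i j)) t ≡ sum (λ i → c i * evaluate k (b i) t)
    evaluate-A zero b t = sym (sum-zero (λ i → zeroʳ _))
    evaluate-A (suc k) b t = begin
      sum (λ i → c i * b i 0) + t * evaluate k (λ j → sum (λ i → c i * b i (suc j))) t
        ≡⟨ +-congˡ (*-congˡ (evaluate-A k (λ i j → b i (suc j)) t)) ⟩
      sum (λ i → c i * b i 0) + t * sum (λ i → c i * evaluate k (b i ∘ suc) t) ≡⟨ +-congˡ (sum-*ˡ _ _) ⟩
      sum (λ i → c i * b i 0) + sum (λ i → t * (c i * evaluate k (b i ∘ suc) t)) ≡⟨ sym (sum-+ _ _) ⟩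
      sum (λ i → c i * b i 0 + t * (c i * evaluate k (b i ∘ suc) t))
        ≡⟨ sum-cong (λ i → solve 4 (λ c b t e → c :* b :+ t :* (c :* e) := c :* (b :+ t :* e)) refl (c i) (b i 0) t (evaluate k (b i ∘ suc) t)) ⟩
      sum (λ i → c i * (b i 0 + t * evaluate k (b i ∘ suc) t)) ∎
    A-vanishes : ∀ t → evaluate p A t ≡ 0#
    A-vanishes t = trans (evaluate-A p _ t) (trans
      (sum-cong (λ i → *-congˡ (evaluate-binomial (f · v i) (g · v i) t (suc d) p d<p)))
      (perp (f ⊞ t ⊡ g)))
    scaled : cast (suc d) * sum (λ i → c i * (g · v i) * (f · v i) ^ d) ≡ 0#
    scaled = begin
      cast (suc d) * sum (λ i → c i * (g · v i) * (f · v i) ^ d) ≡⟨ sum-*ˡ _ _ ⟩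
      sum (λ i → cast (suc d) * (c i * (g · v i) * (f · v i) ^ d))
        ≡⟨ sum-cong (λ i → trans (solve 4 (λ s c y q → s :* (c :* y :* q) := c :* (s :* (q :* y))) refl (cast (suc d)) (c i) (g · v i) ((f · v i) ^ d))
             (*-congˡ (sym (binomial-1 (f · v i) (g · v i) d)))) ⟩
      A 1 ≡⟨ vanishing-polynomial p A id id A-vanishes 1 (ℕ.≤-trans (s≤s (s≤s z≤n)) d<p) ⟩
      0#  ∎

-- Spans of one and two vectors

module SmallSpans {p} (K : PrimeField p) where
  open PrimeField K
  open ZSolver K using (solve; _:+_; _:*_; :-_; _:-_; _:=_; con)
  open Linear K

  private variable
    m k : ℕ

  exchange : {B : Fin k → Vect m} → ∀ {u w} → u ∈⟨ w ∷ B ⟩ → ¬ (u ∈⟨ B ⟩) → w ∈⟨ u ∷ B ⟩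
  exchange {B = B} {u} {w} u∈ u∉ with ∈-uncons (w ∷ B) u∈
  ... | s , x , x∈ , eq with s ≟ 0#
  ...   | yes refl = ⊥-elim (u∉ (∈-resp (λ j → trans (eq j) (trans (+-congˡ (zeroˡ _)) (+-identityʳ _))) x∈))
  ...   | no s≢0 with b , sb≡1 ← inverse s s≢0 =
    ∈-cons (u ∷ B) b (λ j → begin
      w j                               ≡⟨ sym (*-identityˡ _) ⟩
      1# * w j                          ≡⟨ *-congʳ (sym sb≡1) ⟩
      s * b * w j                       ≡⟨ solve 4 (λ s b w x → s :* b :* w := :- b :* x :+ b :* (x :+ s :* w)) refl s b (w j) (x j) ⟩
      - b * x j + b * (x j + s * w j)   ≡⟨ +-congˡ (*-congˡ (sym (eq j))) ⟩
      - b * x j + b * u j               ∎) (∈-scale (- b) (λ j → refl) x∈)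
    where open ≡-Reasoning

  ∈₁-elim : ∀ {u w : Vect m} → u ∈⟨ w ∷ [] ⟩ → ∃ λ s → ∀ j → u j ≡ s * w j
  ∈₁-elim {w = w} u∈ with s , x , (_ , e) , eq ← ∈-uncons (w ∷ []) u∈ =
    s , λ j → trans (eq j) (trans (+-congʳ (trans (e j) (sum-empty _))) (+-identityˡ _))

  ∈₁-intro : ∀ {u w : Vect m} s → (∀ j → u j ≡ s * w j) → u ∈⟨ w ∷ [] ⟩
  ∈₁-intro {w = w} s eq = ∈-scale s eq (∈-head (w ∷ []))

  ∈₁-sub : ∀ {u w : Vect m} {B : Fin k → Vect m} → w ∈⟨ B ⟩ → u ∈⟨ w ∷ [] ⟩ → u ∈⟨ B ⟩
  ∈₁-sub {w = w} w∈ = ∈-trans (w ∷ []) (λ { zero → w∈ })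

  ∈₂-elim : ∀ {u w x : Vect m} → u ∈⟨ w ∷ x ∷ [] ⟩ → ∃ λ s → ∃ λ t → ∀ j → u j ≡ s * w j + t * x j
  ∈₂-elim {w = w} {x} u∈ with s , y , y∈ , eq ← ∈-uncons (w ∷ x ∷ []) u∈ with t , eq′ ← ∈₁-elim y∈ =
    s , t , λ j → trans (eq j) (trans (+-comm _ _) (+-congˡ (eq′ j)))

  ∈₂-intro : ∀ {u w x : Vect m} s t → (∀ j → u j ≡ s * w j + t * x j) → u ∈⟨ w ∷ x ∷ [] ⟩
  ∈₂-intro {w = w} {x} s t eq = ∈-resp eq (∈-lc s t (∈-head (w ∷ x ∷ [])) (∈-member (w ∷ x ∷ []) (suc zero)))

  ∈₂-sub : ∀ {u w x : Vect m} {B : Fin k → Vect m} → w ∈⟨ B ⟩ → x ∈⟨ B ⟩ → u ∈⟨ w ∷ x ∷ [] ⟩ → u ∈⟨ B ⟩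
  ∈₂-sub {w = w} {x} w∈ x∈ = ∈-trans (w ∷ x ∷ []) (λ { zero → w∈ ; (suc zero) → x∈ })

  ∈₂-left : ∀ {w x : Vect m} → w ∈⟨ w ∷ x ∷ [] ⟩
  ∈₂-left {w = w} {x} = ∈-head (w ∷ x ∷ [])

  ∈₂-right : ∀ {w x : Vect m} → x ∈⟨ w ∷ x ∷ [] ⟩
  ∈₂-right {w = w} {x} = ∈-member (w ∷ x ∷ []) (suc zero)

  ∈₂-swap : ∀ {u w x : Vect m} → u ∈⟨ w ∷ x ∷ [] ⟩ → u ∈⟨ x ∷ w ∷ [] ⟩
  ∈₂-swap = ∈₂-sub ∈₂-right ∈₂-left

  1<p : 1 ℕ.< p
  1<p = go K
    where
    go : ∀ {p} → PrimeField p → 1 ℕ.< p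
    go {0} K with () ← PrimeField.0# K
    go {1} K with PrimeField.0# K | PrimeField.1# K | PrimeField.1≢0 K
    ... | zero | zero | ne = ⊥-elim (ne refl)
    go {suc (suc p)} K = s≤s (s≤s z≤n)

  suc-pred-p : suc (p ℕ.∸ 1) ≡ p
  suc-pred-p = ℕ.m+[n∸m]≡n (ℕ.<⇒≤ 1<p)

  keep : {A : Set} → Dec A → F → F
  keep (yes _) a = a
  keep (no _)  a = 0#

  keep-yes : {A : Set} (d : Dec A) → A → ∀ {a} → keep d a ≡ a
  keep-yes (yes _) _ = refl
  keep-yes (no ¬a) a = ⊥-elim (¬a a)

  keep-no : {A : Set} (d : Dec A) → ¬ A → ∀ {a} → keep d a ≡ 0#
  keep-no (yes a) ¬a = ⊥-elim (¬a a)
  keep-no (no _)  _  = refl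

  keep-≢0 : {A : Set} (d : Dec A) → ∀ {a} → keep d a ≢ 0# → A × a ≢ 0#
  keep-≢0 (yes a) ne = a , ne
  keep-≢0 (no _)  ne = ⊥-elim (ne refl)

-- Words on a set of projective points

module PointSet {p} (K : PrimeField p) {m N : ℕ} (v : Fin N → Linear.Vect K m)
  (nonzero : ∀ i → ¬ (∀ j → v i j ≡ PrimeField.0# K))
  (unique : ∀ {i j} s → (∀ l → v i l ≡ PrimeField._*_ K s (v j l)) → i ≡ j) where
  open PrimeField K
  open ZSolver K using (solve; _:+_; _:*_; :-_; _:-_; _:=_; con)
  open Linear K
  open SmallSpans K
  open Powers K
  open Orthogonality K v
  open Counting hiding (sum; sum-empty; sum-suc; sum-cong; sum-+; sum-comm; sum-*ˡ; sum-*ʳ; sum-0; sum-remove; sum-zero; sum-single; sum-pair)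

  Word : Set
  Word = Fin N → F

  restrict : Form m → Word → Word
  restrict f c i = keep (f · v i ≟ 0#) (c i)

  -- The r forms may be dependent or zero, so all codimensions up to r are covered. In this
  -- recursive form `restrict f c` satisfies the same condition with r lowered by one, which drives
  -- the inductions on r.
  Dual : ℕ → Word → Set
  Dual zero    c = sum c ≡ 0#
  Dual (suc r) c = ∀ f → Dual r (restrict f c)

  supp? : (c : Word) → ∀ i → Dec (c i ≢ 0#)
  supp? c i = ¬? (c i ≟ 0#)

  weight : Word → ℕ
  weight c = count (supp? c)

  infixl 7 _⊙_
  _⊙_ : Word → Form m → Word
  (c ⊙ f) i = c i * (f · v i)

  private variable
    c : Word
    r s : ℕ

  Dual-cong : ∀ r {c c′} → (∀ i → c i ≡ c′ i) → Dual r c → Dual r c′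
  Dual-cong zero    eq z = trans (sum-cong (λ i → sym (eq i))) z
  Dual-cong (suc r) eq z f = Dual-cong r (λ i → cong (keep (f · v i ≟ 0#)) (eq i)) (z f)

  0^suc : ∀ d → 0 ℕ.< d → 0# ^ d ≡ 0#
  0^suc (suc d) _ = zeroˡ _

  -- By Fermat the power with exponent p - 1 of f is 1 off the kernel of f and 0 on it. The sum is
  -- therefore the sum of c over all points, which is the case of the zero form, minus its sum over
  -- the kernel of f.
  Dual⇒Perp : Dual 1 c → Perp (p ℕ.∸ 1) c
  Dual⇒Perp {c} dual f = begin
    sum (λ i → c i * (f · v i) ^ (p ℕ.∸ 1))                        ≡⟨ sum-cong pointwise ⟩
    sum (λ i → restrict zeroForm c i + - 1# * restrict f c i)     ≡⟨ sum-+ _ _ ⟩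
    sum (restrict zeroForm c) + sum (λ i → - 1# * restrict f c i) ≡⟨ cong₂ _+_ (dual zeroForm) (sym (sum-*ˡ _ _)) ⟩
    0# + - 1# * sum (restrict f c)                                ≡⟨ +-identityˡ _ ⟩
    - 1# * sum (restrict f c)                                     ≡⟨ *-congˡ (dual f) ⟩
    - 1# * 0#                                                     ≡⟨ zeroʳ _ ⟩
    0#                                                            ∎
    where
    open ≡-Reasoning
    pointwise : ∀ i → c i * (f · v i) ^ (p ℕ.∸ 1) ≡ restrict zeroForm c i + - 1# * restrict f c i
    pointwise i with f · v i ≟ 0#
    ... | yes eq = trans (*-congˡ (trans (cong (_^ (p ℕ.∸ 1)) eq) (0^suc _ (ℕ.m<n⇒0<n∸m 1<p))))
      (trans (solve 1 (λ c → c :* con (ℤ.+ 0) := c :+ :- con (ℤ.+ 1) :* c) refl (c i))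
        (cong (_+ - 1# * c i) (sym (keep-yes (0# ≟ 0#) refl))))
    ... | no ne = trans (*-congˡ (fermat K ne))
      (trans (solve 1 (λ c → c :* con (ℤ.+ 1) := c :+ :- con (ℤ.+ 1) :* con (ℤ.+ 0)) refl (c i))
        (cong (_+ - 1# * 0#) (sym (keep-yes (0# ≟ 0#) refl))))

  same-point : ∀ {i j} → v i ∈⟨ v j ∷ [] ⟩ → i ≡ j
  same-point v∈ = let s , eq = ∈₁-elim v∈ in unique s eq

  count-strict : {P Q : Fin N → Set} (P? : ∀ i → Dec (P i)) (Q? : ∀ i → Dec (Q i)) →
    (∀ i → P i → Q i) → ∀ j → Q j → ¬ P j → count P? ℕ.< count Q?
  count-strict P? Q? sub j qj ¬pj = ℕ.≤-trans
    (s≤s (count-mono P? (λ i → Q? i ×-dec ¬? (i ≟ j)) (λ i pi → sub i pi , λ { refl → ¬pj pi })))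
    (ℕ.≤-reflexive (sym (count-remove Q? j qj)))

  count-insert : {P : Fin N → Set} (P? : ∀ i → Dec (P i)) → ∀ j → count (λ i → P? i ⊎-dec (i ≟ j)) ℕ.≤ suc (count P?)
  count-insert P? j = ℕ.≤-trans (ℕ.≤-reflexive (count-remove (λ i → P? i ⊎-dec (i ≟ j)) j (inj₂ refl)))
    (s≤s (count-mono (λ i → (P? i ⊎-dec (i ≟ j)) ×-dec ¬? (i ≟ j)) P? (λ { i (inj₁ pi , _) → pi ; i (inj₂ eq , ne) → ⊥-elim (ne eq) })))

  weight-remove : ∀ i → c i ≢ 0# → weight c ≡ suc (count (λ j → supp? c j ×-dec ¬? (j ≟ i)))
  weight-remove {c} i ci = count-remove (supp? c) i ci

  -- A product of d forms, each vanishing at one point of each of the two sets, isolates i.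
  no-isolation : ∀ d → d ℕ.< p → Perp d c → ∀ i → c i ≢ 0# →
    {G : Fin N → Set} (G? : ∀ j → Dec (G j)) → G i →
    count (λ j → supp? c j ×-dec (G? j ×-dec ¬? (j ≟ i))) ℕ.≤ d →
    count (λ j → supp? c j ×-dec ¬? (G? j)) ℕ.≤ d →
    (∀ j k → G j → j ≢ i → ¬ G k → ¬ (v i ∈⟨ v k ∷ v j ∷ [] ⟩)) → ⊥
  no-isolation {c} zero d<p perp i ci G? gi few₁ few₂ general = ci (begin
    c i                              ≡⟨ sym (*-identityʳ _) ⟩
    c i * 1#                         ≡⟨ sym (sum-single i (λ j j≢i → trans (*-congʳ (off j j≢i)) (zeroˡ _))) ⟩
    sum (λ j → c j * 1#)             ≡⟨ perp zeroForm ⟩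
    0#                               ∎)
    where
    open ≡-Reasoning
    off : ∀ j → j ≢ i → c j ≡ 0#
    off j j≢i with c j ≟ 0# | G? j
    ... | yes eq | _     = eq
    ... | no ne  | yes g = ⊥-elim (ℕ.<⇒≱ (count-pos (λ j → supp? c j ×-dec (G? j ×-dec ¬? (j ≟ i))) j (ne , g , j≢i)) few₁)
    ... | no ne  | no ¬g = ⊥-elim (ℕ.<⇒≱ (count-pos (λ j → supp? c j ×-dec ¬? (G? j)) j (ne , ¬g)) few₂)
  no-isolation {c} (suc d) d<p perp i ci {G} G? gi few₁ few₂ general = split (Fin.any? first?) (Fin.any? second?)
    where
    first? : ∀ j → Dec (c j ≢ 0# × G j × j ≢ i)
    first? j = supp? c j ×-dec (G? j ×-dec ¬? (j ≟ i))
    second? : ∀ j → Dec (c j ≢ 0# × ¬ G j)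
    second? j = supp? c j ×-dec ¬? (G? j)
    first⊙? : ∀ f j → Dec ((c ⊙ f) j ≢ 0# × G j × j ≢ i)
    first⊙? f j = supp? (c ⊙ f) j ×-dec (G? j ×-dec ¬? (j ≟ i))
    second⊙? : ∀ f j → Dec ((c ⊙ f) j ≢ 0# × ¬ G j)
    second⊙? f j = supp? (c ⊙ f) j ×-dec ¬? (G? j)

    finish : ∀ f → f · v i ≢ 0# → count (first⊙? f) ℕ.≤ d → count (second⊙? f) ℕ.≤ d → ⊥
    finish f fi le₁ le₂ = no-isolation d (ℕ.<⇒≤ d<p) (Perp-multiply d<p perp f) i (*-nonzero ci fi) G? gi le₁ le₂ general

    fewer₁ : ∀ f j → c j ≢ 0# × G j × j ≢ i → f · v j ≡ 0# → count (first⊙? f) ℕ.≤ d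
    fewer₁ f j pj fj = ℕ.≤-pred (ℕ.≤-trans (count-strict (first⊙? f) first? (λ { k (ne , rest) → nonzeroˡ ne , rest })
      j pj (λ { (ne , _) → nonzeroʳ ne fj })) few₁)
    fewer₂ : ∀ f j → c j ≢ 0# × ¬ G j → f · v j ≡ 0# → count (second⊙? f) ℕ.≤ d
    fewer₂ f j pj fj = ℕ.≤-pred (ℕ.≤-trans (count-strict (second⊙? f) second? (λ { k (ne , rest) → nonzeroˡ ne , rest })
      j pj (λ { (ne , _) → nonzeroʳ ne fj })) few₂)
    none₁ : ∀ f → ¬ ∃ (λ j → c j ≢ 0# × G j × j ≢ i) → count (first⊙? f) ℕ.≤ d
    none₁ f none = ℕ.≤-trans (ℕ.≤-reflexive (count-zero (first⊙? f) (λ { j (ne , rest) → none (j , nonzeroˡ ne , rest) }))) z≤n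
    none₂ : ∀ f → ¬ ∃ (λ j → c j ≢ 0# × ¬ G j) → count (second⊙? f) ℕ.≤ d
    none₂ f none = ℕ.≤-trans (ℕ.≤-reflexive (count-zero (second⊙? f) (λ { j (ne , rest) → none (j , nonzeroˡ ne , rest) }))) z≤n

    -- The next form has a zero in each class that still contains a support point other than i; an
    -- exhausted class imposes no condition. `general` is what lets a form vanish at both points
    -- without vanishing at i.
    split : Dec (∃ λ j → c j ≢ 0# × G j × j ≢ i) → Dec (∃ λ j → c j ≢ 0# × ¬ G j) → ⊥
    split (yes (j , pj)) (yes (k , pk))
      with f , kills , fi ← separate (v k ∷ v j ∷ []) (general j k (proj₁ (proj₂ pj)) (proj₂ (proj₂ pj)) (proj₂ pk)) =
      finish f fi (fewer₁ f j pj (kills ∈₂-right)) (fewer₂ f k pk (kills ∈₂-left))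
    split (yes (j , pj)) (no none)
      with f , kills , fi ← separate (v j ∷ []) (λ v∈ → proj₂ (proj₂ pj) (sym (same-point v∈))) =
      finish f fi (fewer₁ f j pj (kills (∈-head (v j ∷ [])))) (none₂ f none)
    split (no none) (yes (k , pk))
      with f , kills , fi ← separate (v k ∷ []) (λ v∈ → proj₂ pk (subst G (same-point v∈) gi)) =
      finish f fi (none₁ f none) (fewer₂ f k pk (kills (∈-head (v k ∷ []))))
    split (no none) (no none′)
      with f , kills , fi ← separate [] (λ v∈ → nonzero i (λ j → trans (proj₂ v∈ j) (sum-empty _))) =
      finish f fi (none₁ f none) (none₂ f none′)

  -- A single class suffices here, with `G` everything: d forms clear up to d points besides i, so
  -- at least d + 1 others must exist.
  minimum-weight : ∀ d → d ℕ.< p → Perp d c → ∀ i → c i ≢ 0# → suc (suc d) ℕ.≤ weight c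
  minimum-weight {c} d d<p perp i ci = ℕ.≮⇒≥ λ small →
    no-isolation {c} d d<p perp i ci {λ _ → ⊤} (λ _ → yes tt) tt
      (ℕ.≤-trans (count-mono (λ j → supp? c j ×-dec (yes tt ×-dec ¬? (j ≟ i))) (λ j → supp? c j ×-dec ¬? (j ≟ i)) (λ { j (cj , _ , ne) → cj , ne }))
        (ℕ.≤-pred (ℕ.≤-trans (ℕ.≤-reflexive (sym (weight-remove {c} i ci))) (ℕ.≤-pred small))))
      (ℕ.≤-trans (ℕ.≤-reflexive (count-zero (λ j → supp? c j ×-dec ¬? (yes tt)) (λ { j (_ , ne) → ne tt }))) z≤n)
      (λ j k g ne ¬g → ⊥-elim (¬g tt))

  line? : ∀ i j k → Dec (v k ∈⟨ v i ∷ v j ∷ [] ⟩)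
  line? i j k = v k ∈⟨ v i ∷ v j ∷ [] ⟩?

  onLine? : (c : Word) → ∀ i j k → Dec (c k ≢ 0# × v k ∈⟨ v i ∷ v j ∷ [] ⟩)
  onLine? c i j k = supp? c k ×-dec line? i j k

  offLine? : (c : Word) → ∀ i j k → Dec (c k ≢ 0# × ¬ (v k ∈⟨ v i ∷ v j ∷ [] ⟩))
  offLine? c i j k = supp? c k ×-dec ¬? (line? i j k)

  record RichLine (c : Word) (size : ℕ) : Set where
    field
      {i j} : Fin N
      distinct : i ≢ j
      suppᵢ : c i ≢ 0#
      suppⱼ : c j ≢ 0#
      rich : size ℕ.≤ count (onLine? c i j)

  weight-line : ∀ i j → weight c ≡ count (onLine? c i j) ℕ.+ count (offLine? c i j)
  weight-line {c} i j = count-split (supp? c) (line? i j)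

  another-point : ∀ i → c i ≢ 0# → 2 ℕ.≤ weight c → ∃ λ j → c j ≢ 0# × j ≢ i
  another-point {c} i ci w = count-find (λ j → supp? c j ×-dec ¬? (j ≟ i))
    (ℕ.≤-pred (ℕ.≤-trans w (ℕ.≤-reflexive (weight-remove {c} i ci))))

  weight-multiply : ∀ f → count (λ k → supp? c k ×-dec (f · v k ≟ 0#)) ℕ.+ weight (c ⊙ f) ℕ.≤ weight c
  weight-multiply {c} f = ℕ.≤-trans
    (ℕ.+-monoʳ-≤ (count (λ k → supp? c k ×-dec (f · v k ≟ 0#)))
      (count-mono (supp? (c ⊙ f)) (λ k → supp? c k ×-dec ¬? (f · v k ≟ 0#)) (λ k ne → nonzeroˡ ne , nonzeroʳ ne)))
    (ℕ.≤-reflexive (sym (count-split (supp? c) (λ k → f · v k ≟ 0#))))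

  rich-line-multiply : ∀ f {size} → RichLine (c ⊙ f) size → RichLine c size
  rich-line-multiply {c} f R = record
    { distinct = distinct ; suppᵢ = nonzeroˡ suppᵢ ; suppⱼ = nonzeroˡ suppⱼ
    ; rich = ℕ.≤-trans rich (count-mono (onLine? (c ⊙ f) i j) (onLine? c i j) (λ { k (ne , l) → nonzeroˡ ne , l })) }
    where open RichLine R

  -- Induction on d. A form vanishing at two support points but not at a third lowers the degree by
  -- one and the weight by at least two, which yields a line with d + 1 support points. If it had no
  -- more, its points other than one point i, and the points off it, would be two classes of at most
  -- d points each. As i is never on a line joining the two classes, `no-isolation` applies. If the
  -- whole support is on a line, `minimum-weight` is enough.
  rich-line : ∀ d → d ℕ.< p → Perp d c → ∀ i → c i ≢ 0# → weight c ℕ.≤ suc (d ℕ.+ d) → RichLine c (suc (suc d))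
  rich-line {c} zero d<p perp i ci w = ⊥-elim (ℕ.<⇒≱ (minimum-weight {c} 0 d<p perp i ci) w)
  rich-line {c} (suc d) d<p perp i ci w = from-line (another-point {c} i ci (ℕ.≤-trans (s≤s (s≤s z≤n)) min))
    where
    min : suc (suc (suc d)) ℕ.≤ weight c
    min = minimum-weight {c} (suc d) d<p perp i ci

    improve : (R : RichLine c (suc (suc d))) → let open RichLine R using () renaming (i to i′; j to j′) in
              Dec (suc (suc (suc d)) ℕ.≤ count (onLine? c i′ j′)) → RichLine c (suc (suc (suc d)))
    improve R (yes rich) = record { RichLine R hiding (rich) ; rich = rich }
    improve R (no poor) = ⊥-elim (no-isolation {c} (suc d) d<p perp i′ suppᵢ (line? i′ j′) ∈₂-left
      (ℕ.≤-trans (count-mono (λ k → supp? c k ×-dec (line? i′ j′ k ×-dec ¬? (k ≟ i′)))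
          (λ k → onLine? c i′ j′ k ×-dec ¬? (k ≟ i′)) (λ { k (ck , l , ne) → (ck , l) , ne }))
        (ℕ.≤-pred (ℕ.≤-trans (ℕ.≤-reflexive (sym (count-remove (onLine? c i′ j′) i′ (suppᵢ , ∈₂-left)))) (ℕ.≤-pred (ℕ.≰⇒> poor)))))
      (ℕ.+-cancelˡ-≤ (suc (suc d)) _ _ (ℕ.≤-trans (ℕ.+-monoˡ-≤ (count (offLine? c i′ j′)) rich)
        (ℕ.≤-trans (ℕ.≤-reflexive (sym (weight-line {c} i′ j′))) w)))
      (λ j k lj j≢ k∉ i∈ → k∉ (∈₂-sub ∈₂-left lj (exchange i∈ (λ i∈j → j≢ (sym (same-point i∈j)))))))
      where
      open RichLine R renaming (i to i′; j to j′)

    from-form : ∀ j k → c j ≢ 0# → j ≢ i → c k ≢ 0# → ∀ f → f · v i ≡ 0# → f · v j ≡ 0# → f · v k ≢ 0# → RichLine c (suc (suc (suc d)))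
    from-form j k cj j≢i ck f fi fj fk = improve R (_ ℕ.≤? _)
      where
      smaller : weight (c ⊙ f) ℕ.≤ suc (d ℕ.+ d)
      smaller = ℕ.+-cancelˡ-≤ 2 _ _ (ℕ.≤-trans
        (ℕ.+-monoˡ-≤ (weight (c ⊙ f)) (count≥2 (λ k → supp? c k ×-dec (f · v k ≟ 0#)) i j (ci , fi) (cj , fj) (j≢i ∘ sym)))
        (ℕ.≤-trans (weight-multiply {c} f) (ℕ.≤-trans w (ℕ.≤-reflexive (cong (λ x → suc (suc x)) (ℕ.+-suc d d))))))
      R = rich-line-multiply {c} f (rich-line {c ⊙ f} d (ℕ.<⇒≤ d<p) (Perp-multiply d<p perp f) k (*-nonzero ck fk) smaller)

    from-line : ∃ (λ j → c j ≢ 0# × j ≢ i) → RichLine c (suc (suc (suc d)))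
    from-line (j , cj , j≢i) = decide (Fin.any? (offLine? c i j))
      where
      decide : Dec (∃ λ k → c k ≢ 0# × ¬ (v k ∈⟨ v i ∷ v j ∷ [] ⟩)) → RichLine c (suc (suc (suc d)))
      decide (no none) = record { distinct = j≢i ∘ sym ; suppᵢ = ci ; suppⱼ = cj
        ; rich = ℕ.≤-trans min (ℕ.≤-reflexive (trans (weight-line {c} i j) (trans
            (cong (count (onLine? c i j) ℕ.+_) (count-zero (offLine? c i j) (λ k off → none (k , off)))) (ℕ.+-identityʳ _)))) }
      decide (yes (k , ck , k∉)) =
        let f , kills , fk = separate (v i ∷ v j ∷ []) k∉
        in from-form j k cj j≢i ck f (kills ∈₂-left) (kills ∈₂-right) fk

  module _ {P : Fin N → Set} (P? : ∀ i → Dec (P i)) where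

    -- At a point where f is nonzero, exactly one member g + t f of the pencil vanishes.
    pencil-partition : ∀ f g → (∀ i → P i → f · v i ≢ 0#) →
      count P? ≡ Counting.sum (λ t → count (λ i → P? i ×-dec ((g ⊞ t ⊡ f) · v i ≟ 0#)))
    pencil-partition f g f≢0 = count-partition P? (λ i t → (g ⊞ t ⊡ f) · v i ≟ 0#) (λ i pi → class i pi)
      where
      class : ∀ i → P i → ∃ λ t → (g ⊞ t ⊡ f) · v i ≡ 0# × (∀ u → (g ⊞ u ⊡ f) · v i ≡ 0# → u ≡ t)
      class i pi with t , eq ← solve-linear (f≢0 i pi) (g · v i) = t , eq , λ u eq′ →
        +-cancel-zero {c = - t} (zero-product (trans (*-comm _ _) (begin
          (u + - t) * (f · v i)                                    ≡⟨ solve 4 (λ u t f g → (u :- t) :* f := (g :+ u :* f) :- (g :+ t :* f)) refl u t (f · v i) (g · v i) ⟩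
          (g · v i + u * (f · v i)) + - (g · v i + t * (f · v i)) ≡⟨ cong₂ (λ x y → x + - y) eq′ eq ⟩
          0# + - 0#                                                ≡⟨ -‿inverseʳ 0# ⟩
          0#                                                       ∎)) (f≢0 i pi)) (-‿inverseʳ t)
        where open ≡-Reasoning

    pencil-avoid : ∀ f g → (∀ i → P i → f · v i ≢ 0#) → count P? ℕ.< p → ∃ λ t → ∀ i → P i → (g ⊞ t ⊡ f) · v i ≢ 0#
    pencil-avoid f g f≢0 small =
      let t , le = minimum≤average (λ t → count (λ i → P? i ×-dec ((g ⊞ t ⊡ f) · v i ≟ 0#))) (ℕ.<⇒≤ 1<p)
                      (ℕ.≤-reflexive (sym (pencil-partition f g f≢0)))
      in t , λ i pi eq → ℕ.<⇒≱ small (ℕ.≤-trans (ℕ.≤-trans (ℕ.≤-reflexive (sym (ℕ.*-identityʳ p)))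
        (ℕ.*-monoʳ-≤ p (count-pos (λ i → P? i ×-dec ((g ⊞ t ⊡ f) · v i ≟ 0#)) i (pi , eq)))) le)

  -- If the first form has no zero in P, it is the form sought. Otherwise a form g built from the
  -- later ones is nonzero at those zeros, and remains so when a multiple of the first form is
  -- added. Fewer than p points are left, so one of the p multiples is good for all of them.
  avoid : ∀ {q} (fs : Fin q → Form m) {P : Fin N → Set} (P? : ∀ i → Dec (P i)) → (∀ i → P i → ¬ Kills fs (v i)) →
    count P? ℕ.≤ p → ∃ λ f → (∀ {u} → Kills fs u → f · u ≡ 0#) × (∀ i → P i → f · v i ≢ 0#)
  avoid {zero} fs P? free small = zeroForm , (λ _ → refl) , λ i pi _ → free i pi (λ ())
  avoid {suc q} fs {P} P? free small = decide (Fin.any? on?)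
    where
    on? : ∀ i → Dec (P i × fs zero · v i ≡ 0#)
    on? i = P? i ×-dec (fs zero · v i ≟ 0#)
    off? : ∀ i → Dec (P i × fs zero · v i ≢ 0#)
    off? i = P? i ×-dec ¬? (fs zero · v i ≟ 0#)
    parts : count on? ℕ.+ count off? ℕ.≤ p
    parts = ℕ.≤-trans (ℕ.≤-reflexive (sym (count-split P? (λ i → fs zero · v i ≟ 0#)))) small
    Goal = ∃ λ f → (∀ {u} → Kills fs u → f · u ≡ 0#) × (∀ i → P i → f · v i ≢ 0#)

    combine : ∀ g t → (∀ {u} → Kills (fs ∘ suc) u → g · u ≡ 0#) → (∀ i → P i × fs zero · v i ≡ 0# → g · v i ≢ 0#) →
      (∀ i → P i × fs zero · v i ≢ 0# → (g ⊞ t ⊡ fs zero) · v i ≢ 0#) → Goal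
    combine g t gkills g≢0 t≢0 = g ⊞ t ⊡ fs zero ,
      (λ kv → vanish-combination (gkills (kv ∘ suc)) (kv zero)) ,
      λ i pi → nonvanishing i pi (fs zero · v i ≟ 0#)
      where
      nonvanishing : ∀ i → P i → Dec (fs zero · v i ≡ 0#) → (g ⊞ t ⊡ fs zero) · v i ≢ 0#
      nonvanishing i pi (no ne) = t≢0 i (pi , ne)
      nonvanishing i pi (yes eq) = λ e → g≢0 i (pi , eq) (trans (sym (absorb eq)) e)

    decide : Dec (∃ λ i → P i × fs zero · v i ≡ 0#) → Goal
    decide (no none) = fs zero , (λ kv → kv zero) , λ i pi eq → none (i , pi , eq)
    decide (yes (i₀ , p₀)) =
      let g , gkills , g≢0 = avoid (fs ∘ suc) on? (λ { i (pi , eq) kv → free i pi (λ { zero → eq ; (suc j) → kv j }) })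
            (ℕ.≤-trans (ℕ.m≤m+n (count on?) (count off?)) parts)
          t , t≢0 = pencil-avoid off? (fs zero) g (λ i → proj₂)
            (ℕ.≤-trans (ℕ.+-monoˡ-≤ (count off?) (count-pos on? i₀ p₀)) parts)
      in combine g t gkills g≢0 t≢0

  avoid-span : ∀ {k} (B : Fin k → Vect m) {P : Fin N → Set} (P? : ∀ i → Dec (P i)) → (∀ i → P i → ¬ (v i ∈⟨ B ⟩)) →
    count P? ℕ.≤ p → ∃ λ f → (∀ {u} → u ∈⟨ B ⟩ → f · u ≡ 0#) × (∀ i → P i → f · v i ≢ 0#)
  avoid-span B P? free small =
    let A = annihilator B
        f , kills , f≢0 = avoid (Annihilator.forms A) P? (λ i pi kv → free i pi (Annihilator.complete A (v i) kv)) small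
    in f , kills ∘ kills-span A , f≢0

  -- The same induction as in `avoid`, with proportions: g treats the points where the first form
  -- vanishes, and for the remaining points the best of the p members of the pencil has at most a
  -- p-th part as zeros.
  average : ∀ {q} (fs : Fin q → Form m) {P : Fin N → Set} (P? : ∀ i → Dec (P i)) → (∀ i → P i → ¬ Kills fs (v i)) →
    ∃ λ f → (∀ {u} → Kills fs u → f · u ≡ 0#) × p ℕ.* count (λ i → P? i ×-dec (f · v i ≟ 0#)) ℕ.≤ count P?
  average {zero} fs P? free = zeroForm , (λ _ → refl) ,
    ℕ.≤-trans (ℕ.≤-reflexive (trans (cong (p ℕ.*_) (count-zero (λ i → P? i ×-dec (0# ≟ 0#)) (λ { i (pi , _) → free i pi (λ ()) }))) (ℕ.*-zeroʳ p))) z≤n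
  average {suc q} fs {P} P? free =
    let g , gkills , g≤ = average (fs ∘ suc) on? (λ { i (pi , eq) kv → free i pi (λ { zero → eq ; (suc j) → kv j }) })
        t , t≤ = minimum≤average (λ t → count (λ i → off? i ×-dec ((g ⊞ t ⊡ fs zero) · v i ≟ 0#))) (ℕ.<⇒≤ 1<p)
          (ℕ.≤-reflexive (sym (pencil-partition off? (fs zero) g (λ i → proj₂))))
    in g ⊞ t ⊡ fs zero ,
      (λ kv → vanish-combination (gkills (kv ∘ suc)) (kv zero)) ,
      bound g t g≤ t≤
    where
    open ℕ.≤-Reasoning
    on? : ∀ i → Dec (P i × fs zero · v i ≡ 0#)
    on? i = P? i ×-dec (fs zero · v i ≟ 0#)
    off? : ∀ i → Dec (P i × fs zero · v i ≢ 0#)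
    off? i = P? i ×-dec ¬? (fs zero · v i ≟ 0#)
    bound : ∀ g t → p ℕ.* count (λ i → on? i ×-dec (g · v i ≟ 0#)) ℕ.≤ count on? →
      p ℕ.* count (λ i → off? i ×-dec ((g ⊞ t ⊡ fs zero) · v i ≟ 0#)) ℕ.≤ count off? →
      p ℕ.* count (λ i → P? i ×-dec ((g ⊞ t ⊡ fs zero) · v i ≟ 0#)) ℕ.≤ count P?
    bound g t g≤ t≤ = begin
      p ℕ.* count killed?
        ≡⟨ cong (p ℕ.*_) (count-split killed? (λ i → fs zero · v i ≟ 0#)) ⟩
      p ℕ.* (count (λ i → killed? i ×-dec (fs zero · v i ≟ 0#)) ℕ.+ count (λ i → killed? i ×-dec ¬? (fs zero · v i ≟ 0#)))
        ≤⟨ ℕ.*-monoʳ-≤ p (ℕ.+-mono-≤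
             (count-mono (λ i → killed? i ×-dec (fs zero · v i ≟ 0#)) (λ i → on? i ×-dec (g · v i ≟ 0#)) (λ { i ((pi , e) , eq) → (pi , eq) ,
               trans (sym (absorb eq)) e }))
             (count-mono (λ i → killed? i ×-dec ¬? (fs zero · v i ≟ 0#)) (λ i → off? i ×-dec ((g ⊞ t ⊡ fs zero) · v i ≟ 0#)) (λ { i ((pi , e) , ne) → (pi , ne) , e }))) ⟩
      p ℕ.* (count (λ i → on? i ×-dec (g · v i ≟ 0#)) ℕ.+ count (λ i → off? i ×-dec ((g ⊞ t ⊡ fs zero) · v i ≟ 0#)))
        ≡⟨ ℕ.*-distribˡ-+ p _ _ ⟩
      p ℕ.* count (λ i → on? i ×-dec (g · v i ≟ 0#)) ℕ.+ p ℕ.* count (λ i → off? i ×-dec ((g ⊞ t ⊡ fs zero) · v i ≟ 0#))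
        ≤⟨ ℕ.+-mono-≤ g≤ t≤ ⟩
      count on? ℕ.+ count off?
        ≡⟨ sym (count-split P? (λ i → fs zero · v i ≟ 0#)) ⟩
      count P? ∎
      where
      killed? : ∀ i → Dec (P i × (g ⊞ t ⊡ fs zero) · v i ≡ 0#)
      killed? i = P? i ×-dec ((g ⊞ t ⊡ fs zero) · v i ≟ 0#)

  no-tangent : Dual 1 c → ∀ i → c i ≢ 0# → ∀ f → f · v i ≡ 0# → ¬ (∀ k → c k ≢ 0# → k ≢ i → f · v k ≢ 0#)
  no-tangent {c} dual i ci f fi off = ci (begin
    c i                ≡⟨ sym (keep-yes (f · v i ≟ 0#) fi) ⟩
    restrict f c i     ≡⟨ sym (sum-single i vanish) ⟩
    sum (restrict f c) ≡⟨ dual f ⟩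
    0#                 ∎)
    where
    open ≡-Reasoning
    vanish : ∀ k → k ≢ i → restrict f c k ≡ 0#
    vanish k k≢i = decidable-stable (restrict f c k ≟ 0#) λ ne →
      let fk , ck = keep-≢0 (f · v k ≟ 0#) ne in off k ck k≢i fk

  -- If there were fewer than p, then together with j they would be at most p points different from
  -- i, and some hyperplane through i would avoid them all. Missing j, it meets the line in i alone,
  -- so it would be tangent to the support.
  off-line : Dual 1 c → ∀ i j → i ≢ j → c i ≢ 0# → c j ≢ 0# → p ℕ.≤ count (offLine? c i j)
  off-line {c} dual i j i≢j ci cj = ℕ.≮⇒≥ λ small →
    let f , kills , f≢0 = avoid-span (v i ∷ []) P? free (ℕ.≤-trans (count-insert (offLine? c i j) j) small)
    in no-tangent {c} dual i ci f (kills (∈-head (v i ∷ []))) (λ k ck k≢i fk → not-killed f kills f≢0 k ck k≢i fk)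
    where
    P? : ∀ k → Dec ((c k ≢ 0# × ¬ (v k ∈⟨ v i ∷ v j ∷ [] ⟩)) ⊎ k ≡ j)
    P? k = offLine? c i j k ⊎-dec (k ≟ j)
    free : ∀ k → (c k ≢ 0# × ¬ (v k ∈⟨ v i ∷ v j ∷ [] ⟩)) ⊎ k ≡ j → ¬ (v k ∈⟨ v i ∷ [] ⟩)
    free k (inj₁ (_ , k∉)) k∈ = k∉ (∈₁-sub ∈₂-left k∈)
    free k (inj₂ refl) k∈ = i≢j (sym (same-point k∈))
    not-killed : ∀ f → (∀ {u} → u ∈⟨ v i ∷ [] ⟩ → f · u ≡ 0#) → (∀ k → (c k ≢ 0# × ¬ (v k ∈⟨ v i ∷ v j ∷ [] ⟩)) ⊎ k ≡ j → f · v k ≢ 0#) →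
      ∀ k → c k ≢ 0# → k ≢ i → f · v k ≢ 0#
    not-killed f kills f≢0 k ck k≢i fk with line? i j k
    ... | no k∉ = f≢0 k (inj₁ (ck , k∉)) fk
    ... | yes k∈ = f≢0 j (inj₂ refl) (·-span f (v k ∷ v i ∷ []) (λ { zero → fk ; (suc zero) → kills (∈-head (v i ∷ [])) })
      (exchange (∈₂-swap k∈) (λ k∈i → k≢i (same-point k∈i))))

  -- A weight of at most 2p - 1 is within reach of `rich-line` in degree p - 1, which puts p + 1
  -- support points on a line. Another p lie off it, a contradiction.
  weight≥2p : Dual 1 c → ∀ i → c i ≢ 0# → p ℕ.+ p ℕ.≤ weight c
  weight≥2p {c} dual i ci = ℕ.≮⇒≥ λ small →
    let q = p ℕ.∸ 1
        bound : weight c ℕ.≤ suc (q ℕ.+ q)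
        bound = ℕ.≤-pred (ℕ.≤-trans small (ℕ.≤-reflexive (trans (cong (λ x → x ℕ.+ x) (sym suc-pred-p)) (cong suc (ℕ.+-suc q q)))))
        R = rich-line {c} q (ℕ.≤-reflexive suc-pred-p) (Dual⇒Perp dual) i ci bound
        open RichLine R renaming (i to i′; j to j′)
        off = off-line {c} dual i′ j′ distinct suppᵢ suppⱼ
    in ℕ.<⇒≱ small (ℕ.≤-trans (ℕ.+-mono-≤ (ℕ.≤-trans (ℕ.≤-trans (ℕ.≤-reflexive (sym suc-pred-p)) (ℕ.n≤1+n _)) rich) off)
         (ℕ.≤-reflexive (sym (weight-line {c} i′ j′))))

  -- Words of weight 2p, codimension one

  rebase : ∀ {k} {B : Fin k → Vect m} {u w x} → u ∈⟨ w ∷ B ⟩ → ¬ (u ∈⟨ B ⟩) → x ∈⟨ w ∷ B ⟩ → x ∈⟨ u ∷ B ⟩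
  rebase {B = B} {u} {w} u∈ u∉ = ∈-trans (w ∷ B) λ { zero → exchange u∈ u∉ ; (suc l) → ∈-tail (u ∷ B) (∈-member B l) }

  ∈-weaken : ∀ {k} {B : Fin k → Vect m} {u} w → u ∈⟨ B ⟩ → u ∈⟨ w ∷ B ⟩
  ∈-weaken {B = B} w = ∈-tail (w ∷ B)

  ∈₁-reverse : ∀ {k} {u} → v k ∈⟨ u ∷ [] ⟩ → u ∈⟨ v k ∷ [] ⟩
  ∈₁-reverse {k} v∈ = exchange v∈ (λ v∈[] → nonzero k (λ j → trans (proj₂ v∈[] j) (sum-empty _)))

  same-line : ∀ {k k′ u} → v k ∈⟨ u ∷ [] ⟩ → v k′ ∈⟨ u ∷ [] ⟩ → k ≡ k′
  same-line {k} {k′} {u} k∈ k′∈ = same-point (∈₁-sub (∈₁-reverse k′∈) k∈)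

  point∉[] : ∀ k → ¬ (v k ∈⟨ [] ⟩)
  point∉[] k v∈[] = nonzero k (λ j → trans (proj₂ v∈[] j) (sum-empty _))

  independent₂ : ∀ {u z : Vect m} → Independent (u ∷ z ∷ []) → ∀ a b → (∀ j → a * u j + b * z j ≡ 0#) → a ≡ 0# × b ≡ 0#
  independent₂ {u} {z} ind a b eq = all zero , all (suc zero)
    where
    all : ∀ i → (a ∷ b ∷ []) i ≡ 0#
    all = ind (a ∷ b ∷ []) λ j → trans (sum-suc _) (trans (+-congˡ (trans (sum-suc _) (trans (+-congˡ (sum-empty _)) (+-identityʳ _)))) (eq j))

  independent-pair : ∀ {u z : Vect m} → ¬ (u ∈⟨ z ∷ [] ⟩) → ¬ (z ∈⟨ [] ⟩) → Independent (u ∷ z ∷ [])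
  independent-pair {u} {z} u∉ z≢ = independent-∷ (u ∷ z ∷ []) (independent-∷ (z ∷ []) (independent-[] []) z≢) u∉

  -- The line ⟨u, z⟩ has just p points besides z, so p points of P there are all of them.
  fill-line : ∀ {u z} → ¬ (u ∈⟨ z ∷ [] ⟩) → ¬ (z ∈⟨ [] ⟩) → {P : Fin N → Set} (P? : ∀ k → Dec (P k)) →
    (∀ k → P k → v k ∈⟨ u ∷ z ∷ [] ⟩ × ¬ (v k ∈⟨ z ∷ [] ⟩)) → p ℕ.≤ count P? →
    ∀ {x} → x ∈⟨ u ∷ z ∷ [] ⟩ → ¬ (x ∈⟨ z ∷ [] ⟩) → ∃ λ k → P k × v k ∈⟨ x ∷ [] ⟩
  fill-line {u} {z} u∉ z≢ {P} P? sub many {x} x∈ x∉ =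
    let τ , x∈τ = parameter x∈ x∉
        l , pl , l∈τ = count-find (λ i → P? i ×-dec on? i τ) (ℕ.≤-reflexive (sym (sum-≥⇒≡ classes at-most-one total τ)))
    in l , pl , ∈-trans _ (λ { zero → exchange x∈τ (λ x∈[] → x∉ (∈-weaken z x∈[])) }) l∈τ
    where
    on? : ∀ k τ → Dec (v k ∈⟨ (λ j → u j + τ * z j) ∷ [] ⟩)
    on? k τ = v k ∈⟨ (λ j → u j + τ * z j) ∷ [] ⟩?
    parameter : ∀ {x} → x ∈⟨ u ∷ z ∷ [] ⟩ → ¬ (x ∈⟨ z ∷ [] ⟩) → ∃ λ τ → x ∈⟨ (λ j → u j + τ * z j) ∷ [] ⟩
    parameter {x} x∈ x∉ with ∈₂-elim x∈
    ... | s , t , eq with s ≟ 0#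
    ...   | yes refl = ⊥-elim (x∉ (∈₁-intro t (λ j → trans (eq j) (trans (+-congʳ (zeroˡ _)) (+-identityˡ _)))))
    ...   | no s≢0 with b , sb≡1 ← inverse s s≢0 = b * t , ∈₁-intro s (λ j → begin
      x j                       ≡⟨ eq j ⟩
      s * u j + t * z j         ≡⟨ +-congˡ (*-congʳ (sym (*-identityˡ t))) ⟩
      s * u j + 1# * t * z j    ≡⟨ +-congˡ (*-congʳ (*-congʳ (sym sb≡1))) ⟩
      s * u j + s * b * t * z j ≡⟨ solve 5 (λ s b t u z → s :* u :+ s :* b :* t :* z := s :* (u :+ b :* t :* z)) refl s b t (u j) (z j) ⟩
      s * (u j + b * t * z j)   ∎)
      where open ≡-Reasoning
    uniqueness : ∀ k τ τ′ → v k ∈⟨ (λ j → u j + τ * z j) ∷ [] ⟩ → v k ∈⟨ (λ j → u j + τ′ * z j) ∷ [] ⟩ → τ′ ≡ τ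
    uniqueness k τ τ′ k∈ k∈′ =
      let s , eq = ∈₁-elim (∈₁-reverse k∈)
          s′ , eq′ = ∈₁-elim k∈′
          a≡0 , b≡0 = independent₂ (independent-pair u∉ z≢) (1# + - (s * s′)) (τ + - (s * s′ * τ′)) (λ j → trans
            (solve 5 (λ a τ τ′ u z → (con (ℤ.+ 1) :- a) :* u :+ (τ :- a :* τ′) :* z := (u :+ τ :* z) :- a :* (u :+ τ′ :* z)) refl (s * s′) τ τ′ (u j) (z j))
            (trans (cong (_+ - (s * s′ * (u j + τ′ * z j))) (trans (eq j) (trans (*-congˡ (eq′ j)) (sym (*-assoc s s′ _))))) (-‿inverseʳ _)))
          ss′ = +-cancel-zero {c = - (s * s′)} a≡0 (-‿inverseʳ _)
      in sym (+-cancel-zero {c = - (s * s′ * τ′)} b≡0 (trans (cong (λ x → τ′ + - (x * τ′)) (sym ss′)) (trans (cong (λ x → τ′ + - x) (*-identityˡ τ′)) (-‿inverseʳ τ′))))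
    classes : Fin p → ℕ
    classes τ = count (λ i → P? i ×-dec on? i τ)
    at-most-one : ∀ τ → classes τ ℕ.≤ 1
    at-most-one τ with Fin.any? (λ i → P? i ×-dec on? i τ)
    ... | no none = ℕ.≤-trans (ℕ.≤-reflexive (count-zero (λ i → P? i ×-dec on? i τ) (λ i h → none (i , h)))) z≤n
    ... | yes (i , h) = ℕ.≤-reflexive (count-single (λ i → P? i ×-dec on? i τ) i h (λ j h′ → same-line (proj₂ h′) (proj₂ h)))
    total : p ℕ.* 1 ℕ.≤ Counting.sum classes
    total = ℕ.≤-trans (ℕ.≤-reflexive (ℕ.*-identityʳ p)) (ℕ.≤-trans many (ℕ.≤-reflexive
      (count-partition P? on? (λ i pi → let k∈ , k∉ = sub i pi ; τ , h = parameter k∈ k∉ in τ , h , λ τ′ → uniqueness i τ τ′ h))))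

  -- In the plane ⟨P, Q, z⟩ the word is α times the difference of two lines meeting in z.
  record Quad (c : Word) (P Q z : Vect m) (α : F) : Set where
    field
      independent : Independent (P ∷ Q ∷ z ∷ [])
      left  : ∀ k → v k ∈⟨ P ∷ z ∷ [] ⟩ → ¬ (v k ∈⟨ z ∷ [] ⟩) → c k ≡ α
      right : ∀ k → v k ∈⟨ Q ∷ z ∷ [] ⟩ → ¬ (v k ∈⟨ z ∷ [] ⟩) → c k ≡ - α
      apex  : ∀ k → v k ∈⟨ z ∷ [] ⟩ → c k ≡ 0#
      off   : ∀ k → v k ∈⟨ P ∷ Q ∷ z ∷ [] ⟩ → ¬ (v k ∈⟨ P ∷ z ∷ [] ⟩) → ¬ (v k ∈⟨ Q ∷ z ∷ [] ⟩) → c k ≡ 0#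

  swap-front : ∀ {k} {B : Fin k → Vect m} {u w x} → x ∈⟨ u ∷ w ∷ B ⟩ → x ∈⟨ w ∷ u ∷ B ⟩
  swap-front {B = B} {u} {w} = ∈-trans (u ∷ w ∷ B) λ
    { zero → ∈-member (w ∷ u ∷ B) (suc zero) ; (suc zero) → ∈-head (w ∷ u ∷ B) ; (suc (suc l)) → ∈-member (w ∷ u ∷ B) (suc (suc l)) }

  swap-independent : ∀ {k} {B : Fin k → Vect m} {u w} → Independent (u ∷ w ∷ B) → Independent (w ∷ u ∷ B)
  swap-independent {B = B} {u} {w} ind = independent-∷ (w ∷ u ∷ B)
    (independent-∷ (u ∷ B) (independent-tail (w ∷ B) (independent-tail (u ∷ w ∷ B) ind)) (λ u∈ → independent-head (u ∷ w ∷ B) ind (∈-weaken w u∈)))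
    (λ w∈ → independent-head (u ∷ w ∷ B) ind (exchange w∈ (independent-head (w ∷ B) (independent-tail (u ∷ w ∷ B) ind))))

  Quad-swap : ∀ {P Q z α} → Quad c P Q z α → Quad c Q P z (- α)
  Quad-swap {α = α} quad = record
    { independent = swap-independent independent
    ; left = right
    ; right = λ k k∈ k∉ → trans (left k k∈ k∉) (solve 1 (λ a → a := :- (:- a)) refl α)
    ; apex = apex
    ; off = λ k k∈ k∉ k∉′ → off k (swap-front k∈) k∉′ k∉ }
    where open Quad quad

  Quad-rebase : ∀ {P P′ Q z α} → Quad c P Q z α → P′ ∈⟨ P ∷ z ∷ [] ⟩ → ¬ (P′ ∈⟨ z ∷ [] ⟩) → Quad c P′ Q z α
  Quad-rebase {P = P} {P′} {Q} {z} quad P′∈ P′∉ = record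
    { independent = independent-∷ (P′ ∷ Q ∷ z ∷ []) (independent-tail (P ∷ Q ∷ z ∷ []) independent)
        (λ P′∈Qz → independent-head (Q ∷ P′ ∷ z ∷ [])
          (independent-∷ (Q ∷ P′ ∷ z ∷ []) (independent-∷ (P′ ∷ z ∷ []) (independent-tail (Q ∷ z ∷ []) (independent-tail (P ∷ Q ∷ z ∷ []) independent)) P′∉)
            (λ Q∈ → independent-head (Q ∷ P ∷ z ∷ []) (swap-independent independent) (toP Q∈)))
          (exchange P′∈Qz P′∉))
    ; left = λ k k∈ → left k (toP k∈)
    ; right = right
    ; apex = apex
    ; off = λ k k∈ k∉ k∉′ → off k (∈-trans (P′ ∷ Q ∷ z ∷ []) (λ
        { zero → swap-front (∈-weaken Q P′∈) ; (suc l) → ∈-member (P ∷ Q ∷ z ∷ []) (suc l) }) k∈)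
        (k∉ ∘ rebase P′∈ P′∉) k∉′ }
    where
    open Quad quad
    toP : ∀ {x} → x ∈⟨ P′ ∷ z ∷ [] ⟩ → x ∈⟨ P ∷ z ∷ [] ⟩
    toP = ∈-trans (P′ ∷ z ∷ []) λ { zero → P′∈ ; (suc zero) → ∈₂-right }

  -- The bound of `off-line` is attained here. When one of the points off the line is set aside, the
  -- others and j are at most p points, and `avoid-span` finds hyperplanes through i that miss them.
  module Line (c : Word) (dual : Dual 1 c) (i j : Fin N) (i≢j : i ≢ j) (ci : c i ≢ 0#) (cj : c j ≢ 0#)
    (few : count (offLine? c i j) ℕ.≤ p) where

    On Off : Fin N → Set
    On k = c k ≢ 0# × v k ∈⟨ v i ∷ v j ∷ [] ⟩
    Off k = c k ≢ 0# × ¬ (v k ∈⟨ v i ∷ v j ∷ [] ⟩)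

    off? : ∀ k → Dec (Off k)
    off? = offLine? c i j

    spread : ∀ f → f · v i ≡ 0# → ∀ k → On k → k ≢ i → f · v k ≡ 0# → f · v j ≡ 0#
    spread f fi k (_ , k∈) k≢i fk = ·-span f (v k ∷ v i ∷ []) (λ { zero → fk ; (suc zero) → fi })
      (exchange (∈₂-swap k∈) (λ k∈i → k≢i (same-point k∈i)))

    not-tangent : ∀ f → f · v i ≡ 0# → f · v j ≢ 0# → ¬ (∀ k → Off k → f · v k ≢ 0#)
    not-tangent f fi fj off = no-tangent {c} dual i ci f fi λ k ck k≢i fk → case k ck k≢i fk (line? i j k)
      where
      case : ∀ k → c k ≢ 0# → k ≢ i → f · v k ≡ 0# → Dec (v k ∈⟨ v i ∷ v j ∷ [] ⟩) → ⊥
      case k ck k≢i fk (yes k∈) = fj (spread f fi k (ck , k∈) k≢i fk)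
      case k ck k≢i fk (no k∉) = off k (ck , k∉) fk

    without? : ∀ y k → Dec ((Off k × k ≢ y) ⊎ k ≡ j)
    without? y k = (off? k ×-dec ¬? (k ≟ y)) ⊎-dec (k ≟ j)

    count-without : ∀ y → Off y → count (without? y) ℕ.≤ p
    count-without y oy = ℕ.≤-trans (count-insert (λ k → off? k ×-dec ¬? (k ≟ y)) j)
      (ℕ.≤-trans (ℕ.≤-reflexive (sym (count-remove off? y oy))) few)

    -- Take a hyperplane through i that misses j and all points off the line except possibly y′. If
    -- y were on the line through i and y′, the hyperplane could not contain y′ without containing
    -- y, so it would be tangent at i.
    not-collinear : ∀ y y′ → Off y → Off y′ → y′ ≢ y → ¬ (v y′ ∈⟨ v y ∷ v i ∷ [] ⟩)
    not-collinear y y′ oy oy′ y′≢y y′∈ =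
      let f , kills , f≢0 = avoid-span (v i ∷ []) (without? y′) free (count-without y′ oy′)
          fi = kills (∈-head (v i ∷ []))
      in not-tangent f fi (f≢0 j (inj₂ refl)) λ k ok fk → case f fi f≢0 k ok fk (k ≟ y′)
      where
      free : ∀ k → (Off k × k ≢ y′) ⊎ k ≡ j → ¬ (v k ∈⟨ v i ∷ [] ⟩)
      free k (inj₁ ((_ , k∉) , _)) k∈ = k∉ (∈₁-sub ∈₂-left k∈)
      free k (inj₂ refl) k∈ = i≢j (sym (same-point k∈))
      case : ∀ f → f · v i ≡ 0# → (∀ k → (Off k × k ≢ y′) ⊎ k ≡ j → f · v k ≢ 0#) → ∀ k → Off k → f · v k ≡ 0# → Dec (k ≡ y′) → ⊥
      case f fi f≢0 k ok fk (no k≢y′) = f≢0 k (inj₁ (ok , k≢y′)) fk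
      case f fi f≢0 k ok fk (yes refl) = f≢0 y (inj₁ (oy , y′≢y ∘ sym))
        (·-span f (v y′ ∷ v i ∷ []) (λ { zero → fk ; (suc zero) → fi })
          (exchange y′∈ (λ y′∈i → proj₂ oy′ (∈₁-sub ∈₂-left y′∈i))))

    -- By `not-collinear` the line through i and y contains none of the points to be avoided. So
    -- some hyperplane meets the support in i and y only, and the two values sum to zero.
    opposite : ∀ y → Off y → c i + c y ≡ 0#
    opposite y oy =
      let f , kills , f≢0 = avoid-span (v y ∷ v i ∷ []) (without? y) free (count-without y oy)
      in pair f (kills ∈₂-right) (kills ∈₂-left) f≢0
      where
      free : ∀ k → (Off k × k ≢ y) ⊎ k ≡ j → ¬ (v k ∈⟨ v y ∷ v i ∷ [] ⟩)
      free k (inj₁ (ok , k≢y)) = not-collinear y k oy ok k≢y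
      free k (inj₂ refl) j∈ = proj₂ oy (∈₂-swap (exchange j∈ (λ j∈i → i≢j (sym (same-point j∈i)))))
      pair : ∀ f → f · v i ≡ 0# → f · v y ≡ 0# → (∀ k → (Off k × k ≢ y) ⊎ k ≡ j → f · v k ≢ 0#) → c i + c y ≡ 0#
      pair f fi fy f≢0 = begin
        c i + c y                       ≡⟨ cong₂ _+_ (sym (keep-yes (f · v i ≟ 0#) fi)) (sym (keep-yes (f · v y ≟ 0#) fy)) ⟩
        restrict f c i + restrict f c y ≡⟨ sym (sum-pair i y (λ { refl → proj₂ oy ∈₂-left }) vanish) ⟩
        sum (restrict f c)              ≡⟨ dual f ⟩
        0#                              ∎
        where
        open ≡-Reasoning
        not-on : ∀ k → f · v k ≡ 0# → c k ≢ 0# → k ≢ i → k ≢ y → Dec (v k ∈⟨ v i ∷ v j ∷ [] ⟩) → ⊥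
        not-on k fk ck k≢i k≢y (yes k∈) = f≢0 j (inj₂ refl) (spread f fi k (ck , k∈) k≢i fk)
        not-on k fk ck k≢i k≢y (no k∉) = f≢0 k (inj₁ ((ck , k∉) , k≢y)) fk
        vanish : ∀ k → k ≢ i → k ≢ y → restrict f c k ≡ 0#
        vanish k k≢i k≢y = decidable-stable (restrict f c k ≟ 0#) λ ne →
          let fk , ck = keep-≢0 (f · v k ≟ 0#) ne in not-on k fk ck k≢i k≢y (line? i j k)

    -- Otherwise a form f vanishes at i, j and y but not at y′. It splits the points off the line
    -- into two classes of fewer than p points. Some g through i is nonzero at j and on the class
    -- where f vanishes, and for a suitable t the form g + t f is also nonzero on the other class: a
    -- tangent at i.
    coplanar : ∀ y y′ → Off y → Off y′ → v y′ ∈⟨ v y ∷ v i ∷ v j ∷ [] ⟩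
    coplanar y y′ oy oy′ = decidable-stable (v y′ ∈⟨ v y ∷ v i ∷ v j ∷ [] ⟩?) λ y′∉ →
      let B = v y ∷ v i ∷ v j ∷ []
          f , kills , fy′ = separate B y′∉
          fy = kills (∈-head B)
          fi = kills (∈-member B (suc zero))
          fj = kills (∈-member B (suc (suc zero)))
          on? = λ k → off? k ×-dec (f · v k ≟ 0#)
          g , gkills , g≢0 = avoid-span (v i ∷ []) (λ k → on? k ⊎-dec (k ≟ j)) (free f)
            (ℕ.≤-trans (count-insert on? j) (ℕ.≤-trans (count-strict on? off? (λ k → proj₁) y′ oy′ (λ h → fy′ (proj₂ h))) few))
          t , t≢0 = pencil-avoid (λ k → off? k ×-dec ¬? (f · v k ≟ 0#)) f g (λ k → proj₂)
            (ℕ.≤-trans (count-strict (λ k → off? k ×-dec ¬? (f · v k ≟ 0#)) off? (λ k → proj₁) y oy (λ h → proj₂ h fy)) few)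
      in not-tangent (g ⊞ t ⊡ f) (vanish-combination (gkills (∈-head (v i ∷ []))) fi)
           (λ e → g≢0 j (inj₂ refl) (trans (sym (erase {g · v j} t fj)) e))
           (λ k ok e → case f g t g≢0 t≢0 k ok e (f · v k ≟ 0#))
      where
      erase : ∀ {x y} t → y ≡ 0# → x + t * y ≡ x
      erase t refl = trans (+-congˡ (zeroʳ t)) (+-identityʳ _)
      free : ∀ f k → (Off k × f · v k ≡ 0#) ⊎ k ≡ j → ¬ (v k ∈⟨ v i ∷ [] ⟩)
      free f k (inj₁ ((_ , k∉) , _)) k∈ = k∉ (∈₁-sub ∈₂-left k∈)
      free f k (inj₂ refl) k∈ = i≢j (sym (same-point k∈))
      case : ∀ f g t → (∀ k → (Off k × f · v k ≡ 0#) ⊎ k ≡ j → g · v k ≢ 0#) →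
        (∀ k → Off k × f · v k ≢ 0# → (g ⊞ t ⊡ f) · v k ≢ 0#) → ∀ k → Off k → (g ⊞ t ⊡ f) · v k ≡ 0# → Dec (f · v k ≡ 0#) → ⊥
      case f g t g≢0 t≢0 k ok e (no ne) = t≢0 k (ok , ne) e
      case f g t g≢0 t≢0 k ok e (yes eq) = g≢0 k (inj₁ (ok , eq)) (trans (sym (erase {g · v k} t eq)) e)

  -- Any support point k of the line can take the place of i, since k and i span the same line. So
  -- the results of `Line` for i hold for k.
  module Rerooted (c : Word) (dual : Dual 1 c) (i j : Fin N) (i≢j : i ≢ j) (ci : c i ≢ 0#) (cj : c j ≢ 0#)
    (few : count (offLine? c i j) ℕ.≤ p) where
    open Line c dual i j i≢j ci cj few

    at : ∀ k → On k → k ≢ i → Σ (count (offLine? c k i) ℕ.≤ p) λ _ → ∀ y → Off y → c y ≢ 0# × ¬ (v y ∈⟨ v k ∷ v i ∷ [] ⟩)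
    at k (ck , k∈) k≢i = ℕ.≤-trans (count-mono (offLine? c k i) off? (λ { l (cl , l∉) → cl , λ l∈ → l∉ (rebase (∈₂-swap k∈) (λ h → k≢i (same-point h)) (∈₂-swap l∈)) })) few ,
      λ { y (cy , y∉) → cy , λ y∈ → y∉ (∈₂-sub k∈ ∈₂-left y∈) }

    not-collinear-at : ∀ k → On k → ∀ y y′ → Off y → Off y′ → y′ ≢ y → ¬ (v y′ ∈⟨ v y ∷ v k ∷ [] ⟩)
    not-collinear-at k ok y y′ oy oy′ with k ≟ i
    ... | yes refl = not-collinear y y′ oy oy′
    ... | no k≢i = let few′ , off′ = at k ok k≢i in
      Line.not-collinear c dual k i k≢i (proj₁ ok) ci few′ y y′ (off′ y oy) (off′ y′ oy′)

    opposite-at : ∀ k → On k → ∀ y → Off y → c k + c y ≡ 0#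
    opposite-at k ok y oy with k ≟ i
    ... | yes refl = opposite y oy
    ... | no k≢i = let few′ , off′ = at k ok k≢i in
      Line.opposite c dual k i k≢i (proj₁ ok) ci few′ y (off′ y oy)

  record LineQuad (c : Word) (i j : Fin N) : Set where
    field
      {y} : Fin N
      {z} : Vect m
      quad : Quad c (v i) (v y) z (c i)
      on-line  : ∀ k → c k ≢ 0# → v k ∈⟨ v i ∷ v j ∷ [] ⟩ → v k ∈⟨ v i ∷ z ∷ [] ⟩
      off-line′ : ∀ k → c k ≢ 0# → ¬ (v k ∈⟨ v i ∷ v j ∷ [] ⟩) → v k ∈⟨ v y ∷ z ∷ [] ⟩

  -- The line through two support points y and y′ off the rich line meets the rich line in z. By
  -- `not-collinear` z is not a support point. Each of the two lines through z has p other points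
  -- and carries at least p support points, so it is filled.
  line-quad : Dual 1 c → ∀ i j → i ≢ j → c i ≢ 0# → c j ≢ 0# → p ℕ.≤ count (onLine? c i j) → weight c ≡ p ℕ.+ p → LineQuad c i j
  line-quad {c} dual i j i≢j ci cj many w =
    let y , oy = count-find off? (ℕ.≤-trans (ℕ.<⇒≤ 1<p) many-off)
        y′ , oy′ , y′≢y = count-find (λ k → off? k ×-dec ¬? (k ≟ y))
          (ℕ.≤-pred (ℕ.≤-trans 1<p (ℕ.≤-trans many-off (ℕ.≤-reflexive (count-remove off? y oy)))))
        s , z , z∈L , eq = ∈-uncons (v y ∷ v i ∷ v j ∷ []) (coplanar y y′ oy oy′)
    in WithApex.result y oy z z∈L (residue-nonzero y y′ oy oy′ y′≢y s z eq) (residue-apex y y′ oy oy′ y′≢y s z z∈L eq)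
    where
    few : count (offLine? c i j) ℕ.≤ p
    few = ℕ.+-cancelˡ-≤ p _ _ (ℕ.≤-trans (ℕ.+-monoˡ-≤ (count (offLine? c i j)) many)
      (ℕ.≤-reflexive (trans (sym (weight-line {c} i j)) w)))
    open Line c dual i j i≢j ci cj few
    open Rerooted c dual i j i≢j ci cj few
    many-off : p ℕ.≤ count off?
    many-off = off-line {c} dual i j i≢j ci cj

    residue-nonzero : ∀ y y′ → Off y → Off y′ → y′ ≢ y → ∀ s x → (∀ l → v y′ l ≡ x l + s * v y l) → ¬ (x ∈⟨ [] ⟩)
    residue-nonzero y y′ oy oy′ y′≢y s x eq x∈[] = y′≢y (same-point (∈-cons (v y ∷ []) s eq x∈[]))

    residue-apex : ∀ y y′ → Off y → Off y′ → y′ ≢ y → ∀ s x → x ∈⟨ v i ∷ v j ∷ [] ⟩ → (∀ l → v y′ l ≡ x l + s * v y l) →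
      ∀ k → v k ∈⟨ x ∷ [] ⟩ → c k ≡ 0#
    residue-apex y y′ oy oy′ y′≢y s x x∈L eq k k∈ = decidable-stable (c k ≟ 0#) λ ck →
      not-collinear-at k (ck , ∈₁-sub x∈L k∈) y y′ oy oy′ y′≢y
        (∈-cons (v y ∷ v k ∷ []) s eq (∈₁-reverse k∈))

    module WithApex (y : Fin N) (oy : Off y) (z : Vect m) (z∈L : z ∈⟨ v i ∷ v j ∷ [] ⟩) (z≢ : ¬ (z ∈⟨ [] ⟩))
      (apex : ∀ k → v k ∈⟨ z ∷ [] ⟩ → c k ≡ 0#) where

      i∉z : ¬ (v i ∈⟨ z ∷ [] ⟩)
      i∉z i∈ = ci (apex i i∈)
      y∉z : ¬ (v y ∈⟨ z ∷ [] ⟩)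
      y∉z y∈ = proj₁ oy (apex y y∈)
      z∉i : ¬ (z ∈⟨ v i ∷ [] ⟩)
      z∉i z∈ = i∉z (exchange z∈ z≢)
      L⊂iz : ∀ {x} → x ∈⟨ v i ∷ v j ∷ [] ⟩ → x ∈⟨ v i ∷ z ∷ [] ⟩
      L⊂iz x∈ = ∈₂-swap (rebase (∈₂-swap z∈L) z∉i (∈₂-swap x∈))
      iz⊂L : ∀ {x} → x ∈⟨ v i ∷ z ∷ [] ⟩ → x ∈⟨ v i ∷ v j ∷ [] ⟩
      iz⊂L = ∈₂-sub ∈₂-left z∈L
      on-sub : ∀ k → On k → v k ∈⟨ v i ∷ z ∷ [] ⟩ × ¬ (v k ∈⟨ z ∷ [] ⟩)
      on-sub k (ck , k∈) = L⊂iz k∈ , ck ∘ apex k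
      fill-on : ∀ {x} → x ∈⟨ v i ∷ z ∷ [] ⟩ → ¬ (x ∈⟨ z ∷ [] ⟩) → ∃ λ k → On k × v k ∈⟨ x ∷ [] ⟩
      fill-on = fill-line i∉z z≢ (onLine? c i j) on-sub many
      off-in : ∀ k → Off k → v k ∈⟨ v y ∷ z ∷ [] ⟩
      off-in k ok with k ≟ y
      ... | yes refl = ∈₂-left
      ... | no k≢y =
        let s , x , x∈L , eq = ∈-uncons (v y ∷ v i ∷ v j ∷ []) (coplanar y k oy ok)
            -- The line through y and k meets the rich line in x, which is outside the support for
            -- the same reason as z; but every point of the rich line other than z is a support
            -- point.
            x∈z = decidable-stable (x ∈⟨ z ∷ [] ⟩?) λ x∉z →
              let l , (cl , _) , l∈x = fill-on (L⊂iz x∈L) x∉z in cl (residue-apex y k oy ok k≢y s x x∈L eq l l∈x)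
        in ∈-cons (v y ∷ z ∷ []) s eq x∈z
      fill-off : ∀ {x} → x ∈⟨ v y ∷ z ∷ [] ⟩ → ¬ (x ∈⟨ z ∷ [] ⟩) → ∃ λ k → Off k × v k ∈⟨ x ∷ [] ⟩
      fill-off = fill-line y∉z z≢ off? (λ k ok → off-in k ok , proj₁ ok ∘ apex k) many-off

      left : ∀ k → v k ∈⟨ v i ∷ z ∷ [] ⟩ → ¬ (v k ∈⟨ z ∷ [] ⟩) → c k ≡ c i
      left k k∈ k∉ = let l , ol , l∈ = fill-on k∈ k∉ in
        +-cancel-zero (opposite-at k (subst On (same-point l∈) ol) y oy) (opposite y oy)
      right : ∀ k → v k ∈⟨ v y ∷ z ∷ [] ⟩ → ¬ (v k ∈⟨ z ∷ [] ⟩) → c k ≡ - c i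
      right k k∈ k∉ = let l , ol , l∈ = fill-off k∈ k∉ in
        +-cancel-zero {c = c i} (trans (+-comm _ _) (opposite k (subst Off (same-point l∈) ol))) (-‿inverseˡ (c i))

      result : LineQuad c i j
      result = record
        { y = y ; z = z
        ; quad = record
          { independent = independent-∷ (v i ∷ v y ∷ z ∷ []) (independent-pair y∉z z≢)
              (λ i∈ → proj₂ oy (iz⊂L (exchange i∈ i∉z)))
          ; left = left ; right = right ; apex = apex
          ; off = λ k k∈ k∉ k∉′ → decidable-stable (c k ≟ 0#) λ ck → outside k ck k∉ k∉′ (line? i j k) }
        ; on-line = λ k ck k∈ → L⊂iz k∈
        ; off-line′ = λ k ck k∉ → off-in k (ck , k∉) }
        where
        outside : ∀ k → c k ≢ 0# → ¬ (v k ∈⟨ v i ∷ z ∷ [] ⟩) → ¬ (v k ∈⟨ v y ∷ z ∷ [] ⟩) → Dec (v k ∈⟨ v i ∷ v j ∷ [] ⟩) → ⊥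
        outside k ck k∉ k∉′ (yes k∈) = k∉ (L⊂iz k∈)
        outside k ck k∉ k∉′ (no k∉L) = k∉′ (off-in k (ck , k∉L))

  count≥3 : {P : Fin N → Set} (P? : ∀ i → Dec (P i)) → ∀ i j k → P i → P j → P k → i ≢ j → i ≢ k → j ≢ k → 3 ℕ.≤ count P?
  count≥3 P? i j k pi pj pk i≢j i≢k j≢k = ℕ.≤-trans
    (s≤s (count≥2 (λ l → P? l ×-dec ¬? (l ≟ i)) j k (pj , i≢j ∘ sym) (pk , i≢k ∘ sym) j≢k))
    (ℕ.≤-reflexive (sym (count-remove P? i pi)))

  double≢0 : 2 ℕ.< p → ∀ {a} → a ≢ 0# → a + a ≢ 0#
  double≢0 2<p {a} a≢0 eq = a≢0 (zero-product {cast 2}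
    (trans (solve 1 (λ a → (con (ℤ.+ 1) :+ (con (ℤ.+ 1) :+ con (ℤ.+ 0))) :* a := a :+ a) refl a) eq)
    (characteristic-minimal 2 (s≤s z≤n) 2<p))

  count≤2 : {P : Fin N → Set} (P? : ∀ i → Dec (P i)) → ∀ i j → (∀ k → P k → k ≡ i ⊎ k ≡ j) → count P? ℕ.≤ 2
  count≤2 P? i j sub = ℕ.≤-trans (count-mono P? (λ k → (none? k ⊎-dec (k ≟ i)) ⊎-dec (k ≟ j)) (λ k pk → [ inj₁ ∘ inj₂ , inj₂ ]′ (sub k pk)))
    (ℕ.≤-trans (count-insert (λ k → none? k ⊎-dec (k ≟ i)) j) (s≤s (ℕ.≤-trans (count-insert none? i)
      (s≤s (ℕ.≤-reflexive (count-zero none? (λ _ ())))))))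
    where
    none? : ∀ (k : Fin N) → Dec ⊥
    none? _ = no (λ ())

  -- A form with three zeros in the support leaves degree p - 2 and weight at most 2p - 3, from
  -- which `rich-line` produces p points. To find it, let f₂ vanish at i and j but not at k. If it
  -- has no third zero, then 2p - 2 support points are spread over the p members f₁ + t f₂ of a
  -- pencil through i. As 2p - 2 > p, some member contains two of them, and it misses j.
  rich-line-exists : 2 ℕ.< p → Dual 1 c → weight c ≡ p ℕ.+ p → ∀ i → c i ≢ 0# → RichLine c p
  rich-line-exists {c} 2<p dual w i ci =
    let j , cj , j≢i = another-point {c} i ci (ℕ.≤-trans (ℕ.<⇒≤ 2<p) (ℕ.≤-trans (ℕ.m≤m+n p p) (ℕ.≤-reflexive (sym w))))
        k , ck , k∉ = count-find (offLine? c i j) (ℕ.≤-trans (ℕ.<⇒≤ 1<p) (off-line {c} dual i j (j≢i ∘ sym) ci cj))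
        f₁ , kills₁ , f₁j = separate (v i ∷ []) (λ j∈ → j≢i (same-point j∈))
        f₂ , kills₂ , f₂k = separate (v i ∷ v j ∷ []) k∉
    in from-pencil j k cj ck (j≢i ∘ sym) f₁ f₂ (kills₁ (∈-head (v i ∷ []))) f₁j (kills₂ ∈₂-left) (kills₂ ∈₂-right) f₂k
    where
    q = p ℕ.∸ 2
    p≡2+q : suc (suc q) ≡ p
    p≡2+q = ℕ.m+[n∸m]≡n 1<p

    zero? : ∀ f k → Dec (c k ≢ 0# × f · v k ≡ 0#)
    zero? f k = supp? c k ×-dec (f · v k ≟ 0#)

    from-form : ∀ f k → 3 ℕ.≤ count (zero? f) → c k ≢ 0# → f · v k ≢ 0# → RichLine c p
    from-form f k three ck fk = subst (RichLine c) p≡2+q (rich-line-multiply {c} f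
      (rich-line {c ⊙ f} q (ℕ.≤-trans (ℕ.n≤1+n _) (ℕ.≤-reflexive p≡2+q))
        (Perp-multiply (ℕ.≤-reflexive p≡2+q) (subst (λ d → Perp d c) (cong (ℕ._∸ 1) (sym p≡2+q)) (Dual⇒Perp dual)) f)
        k (*-nonzero ck fk)
        (ℕ.+-cancelˡ-≤ 3 _ _ (ℕ.≤-trans (ℕ.+-monoˡ-≤ (weight (c ⊙ f)) three) (ℕ.≤-trans (weight-multiply {c} f)
          (ℕ.≤-reflexive (trans w (trans (cong (λ x → x ℕ.+ x) (sym p≡2+q)) (cong (λ x → suc (suc x)) (trans (ℕ.+-suc q (suc q)) (cong suc (ℕ.+-suc q q)))))))))) ))

    from-pencil : ∀ j k → c j ≢ 0# → c k ≢ 0# → i ≢ j → ∀ f₁ f₂ → f₁ · v i ≡ 0# → f₁ · v j ≢ 0# → f₂ · v i ≡ 0# → f₂ · v j ≡ 0# → f₂ · v k ≢ 0# → RichLine c p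
    from-pencil j k cj ck i≢j f₁ f₂ f₁i f₁j f₂i f₂j f₂k = decide (Fin.any? (λ l → zero? f₂ l ×-dec (¬? (l ≟ i) ×-dec ¬? (l ≟ j))))
      where
      rest? : ∀ l → Dec (c l ≢ 0# × f₂ · v l ≢ 0#)
      rest? l = supp? c l ×-dec ¬? (f₂ · v l ≟ 0#)
      member : F → Form m
      member t = f₁ ⊞ t ⊡ f₂
      class? : ∀ t l → Dec ((c l ≢ 0# × f₂ · v l ≢ 0#) × member t · v l ≡ 0#)
      class? t l = rest? l ×-dec (member t · v l ≟ 0#)

      many : ∀ t → 2 ℕ.≤ count (class? t) → RichLine c p
      many t two = from-form (member t) j
        (ℕ.≤-trans (s≤s (ℕ.≤-trans two (count-mono (class? t) (λ l → zero? (member t) l ×-dec ¬? (l ≟ i))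
            (λ { l ((cl , f₂l) , e) → (cl , e) , λ { refl → f₂l f₂i } }))))
          (ℕ.≤-reflexive (sym (count-remove (zero? (member t)) i (ci , vanish-combination f₁i f₂i)))))
        cj (λ e → f₁j (trans (sym (absorb f₂j)) e))

      decide : Dec (∃ λ l → (c l ≢ 0# × f₂ · v l ≡ 0#) × (l ≢ i × l ≢ j)) → RichLine c p
      decide (yes (l , zl , l≢i , l≢j)) = from-form f₂ k (count≥3 (zero? f₂) i j l (ci , f₂i) (cj , f₂j) zl i≢j (l≢i ∘ sym) (l≢j ∘ sym)) ck f₂k
      decide (no none) = pigeon (Fin.any? (λ t → 2 ℕ.≤? count (class? t)))
        where
        few-zero : count (zero? f₂) ℕ.≤ 2
        few-zero = count≤2 (zero? f₂) i j λ l zl → two l zl (l ≟ i) (l ≟ j)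
          where
          two : ∀ l → c l ≢ 0# × f₂ · v l ≡ 0# → Dec (l ≡ i) → Dec (l ≡ j) → l ≡ i ⊎ l ≡ j
          two l zl (yes e) _ = inj₁ e
          two l zl (no _) (yes e) = inj₂ e
          two l zl (no l≢i) (no l≢j) = ⊥-elim (none (l , zl , l≢i , l≢j))
        large : p ℕ.+ p ℕ.≤ 2 ℕ.+ count rest?
        large = ℕ.≤-trans (ℕ.≤-reflexive (trans (sym w) (count-split (supp? c) (λ l → f₂ · v l ≟ 0#)))) (ℕ.+-monoˡ-≤ (count rest?) few-zero)
        pigeon : Dec (∃ λ t → 2 ℕ.≤ count (class? t)) → RichLine c p
        pigeon (yes (t , two)) = many t two
        pigeon (no none′) = ⊥-elim (ℕ.<⇒≱ 2<p (ℕ.+-cancelʳ-≤ p _ _ (ℕ.≤-trans large (ℕ.+-monoʳ-≤ 2 small))))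
          where
          small : count rest? ℕ.≤ p
          small = ℕ.≤-trans (ℕ.≤-reflexive (pencil-partition rest? f₂ f₁ (λ l → proj₂)))
            (ℕ.≤-trans (sum-mono (λ t → count (class? t)) (λ _ → 1) (λ t → ℕ.≤-pred (ℕ.≰⇒> (λ two → none′ (t , two)))))
              (ℕ.≤-reflexive (trans (sum-const p 1) (ℕ.*-identityʳ p))))

  Quad-rebaseʳ : ∀ {P Q Q′ z α} → Quad c P Q z α → Q′ ∈⟨ Q ∷ z ∷ [] ⟩ → ¬ (Q′ ∈⟨ z ∷ [] ⟩) → Quad c P Q′ z α
  Quad-rebaseʳ {c} {α = α} quad Q′∈ Q′∉ = subst (Quad c _ _ _) (solve 1 (λ a → :- (:- a) := a) refl α)
    (Quad-swap (Quad-rebase (Quad-swap quad) Q′∈ Q′∉))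

  self-opposite : 2 ℕ.< p → ∀ {a} → a ≢ 0# → a ≢ - a
  self-opposite 2<p {a} a≢0 eq = double≢0 2<p a≢0 (trans (+-congˡ eq) (-‿inverseʳ a))

  two-lines : ∀ {i j} (L : LineQuad c i j) → ∀ l → c l ≢ 0# → Dec (v l ∈⟨ v i ∷ v j ∷ [] ⟩) →
    v l ∈⟨ v i ∷ LineQuad.z L ∷ [] ⟩ ⊎ v l ∈⟨ v (LineQuad.y L) ∷ LineQuad.z L ∷ [] ⟩
  two-lines L l cl (yes l∈) = inj₁ (LineQuad.on-line L l cl l∈)
  two-lines L l cl (no l∉) = inj₂ (LineQuad.off-line′ L l cl l∉)

  from-rich-line : Dual 1 c → weight c ≡ p ℕ.+ p → (R : RichLine c p) → LineQuad c (RichLine.i R) (RichLine.j R)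
  from-rich-line {c} dual w R = line-quad {c} dual (RichLine.i R) (RichLine.j R) (RichLine.distinct R) (RichLine.suppᵢ R) (RichLine.suppⱼ R) (RichLine.rich R) w

  -- For p = 2 any two support points make a line with p of them, so the line of the quad can be
  -- prescribed.
  from-two : ¬ (2 ℕ.< p) → Dual 1 c → weight c ≡ p ℕ.+ p → ∀ i k → i ≢ k → c i ≢ 0# → c k ≢ 0# → LineQuad c i k
  from-two {c} p≯2 dual w i k i≢k ci ck = line-quad {c} dual i k i≢k ci ck
    (ℕ.≤-trans (ℕ.≮⇒≥ p≯2) (count≥2 (onLine? c i k) i k (ci , ∈₂-left) (ck , ∈₂-right) i≢k)) w

  two-values : Dual 1 c → weight c ≡ p ℕ.+ p → ∀ i k → c i ≢ 0# → c k ≢ 0# → c k ≡ c i ⊎ c k ≡ - c i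
  two-values {c} dual w i k ci ck = decide (2 ℕ.<? p)
    where
    large : ∀ {i′ j′} → LineQuad c i′ j′ → c k ≡ c i ⊎ c k ≡ - c i
    large {i′} {j′} L = compare (value i ci) (value k ck)
      where
      open LineQuad L
      value : ∀ l → c l ≢ 0# → c l ≡ c i′ ⊎ c l ≡ - c i′
      value l cl with two-lines L l cl (line? i′ j′ l)
      ... | inj₁ l∈ = inj₁ (Quad.left quad l l∈ (λ h → cl (Quad.apex quad l h)))
      ... | inj₂ l∈ = inj₂ (Quad.right quad l l∈ (λ h → cl (Quad.apex quad l h)))
      compare : c i ≡ c i′ ⊎ c i ≡ - c i′ → c k ≡ c i′ ⊎ c k ≡ - c i′ → c k ≡ c i ⊎ c k ≡ - c i
      compare (inj₁ a) (inj₁ b) = inj₁ (trans b (sym a))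
      compare (inj₁ a) (inj₂ b) = inj₂ (trans b (cong -_ (sym a)))
      compare (inj₂ a) (inj₁ b) = inj₂ (trans b (trans (solve 1 (λ a → a := :- (:- a)) refl (c i′)) (cong -_ (sym a))))
      compare (inj₂ a) (inj₂ b) = inj₁ (trans b (sym a))
    small : ¬ (2 ℕ.< p) → Dec (i ≡ k) → c k ≡ c i ⊎ c k ≡ - c i
    small p≯2 (yes refl) = inj₁ refl
    small p≯2 (no i≢k) = inj₁ (Quad.left (LineQuad.quad L) k (LineQuad.on-line L k ck ∈₂-right) (λ h → ck (Quad.apex (LineQuad.quad L) k h)))
      where
      L : LineQuad c i k
      L = from-two p≯2 dual w i k i≢k ci ck
    decide : Dec (2 ℕ.< p) → c k ≡ c i ⊎ c k ≡ - c i
    decide (yes 2<p) = large (from-rich-line dual w (rich-line-exists {c} 2<p dual w i ci))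
    decide (no p≯2) = small p≯2 (i ≟ k)

  RelativeQuad : Word → Fin N → Fin N → Fin N → Set
  RelativeQuad c i j k = ∃ λ z → Quad c (v i) (v j) z (c i) × v k ∈⟨ v i ∷ z ∷ [] ⟩

  -- For p > 2 the values tell the two lines of any quad apart: k is on the line of i, and j on the
  -- other. For p = 2 they do not, and the line is taken through i and k; it carries at most two
  -- support points, so j is off it.
  relative-quad : Dual 1 c → weight c ≡ p ℕ.+ p → ∀ i j k → c i ≢ 0# → c k ≡ c i → c i + c j ≡ 0# → j ≢ i → k ≢ i → k ≢ j → RelativeQuad c i j k
  relative-quad {c} dual w i j k ci ck≡ cij j≢i k≢i k≢j = decide (2 ℕ.<? p)
    where
    ck : c k ≢ 0#
    ck = ci ∘ trans (sym ck≡)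
    cj : c j ≢ 0#
    cj e = ci (trans (sym (trans (+-congˡ e) (+-identityʳ _))) cij)

    place : 2 ℕ.< p → ∀ {P Q z α} → Quad c P Q z α → (∀ l → c l ≢ 0# → v l ∈⟨ P ∷ z ∷ [] ⟩ ⊎ v l ∈⟨ Q ∷ z ∷ [] ⟩) →
      v i ∈⟨ P ∷ z ∷ [] ⟩ → RelativeQuad c i j k
    place 2<p {P} {Q} {z} {α} quad cover i∈ = z ,
      Quad-rebaseʳ (Quad-rebase (subst (Quad c P Q z) (sym ci≡α) quad) i∈ (λ h → ci (apex i h))) j∈ (λ h → cj (apex j h)) ,
      rebase i∈ (λ h → ci (apex i h)) k∈
      where
      open Quad quad
      ci≡α : c i ≡ α
      ci≡α = left i i∈ (λ h → ci (apex i h))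
      k∈ : v k ∈⟨ P ∷ z ∷ [] ⟩
      k∈ = [ id , (λ h → ⊥-elim (self-opposite 2<p ci (trans (sym ck≡) (trans (right k h (λ h′ → ck (apex k h′))) (cong -_ (sym ci≡α)))))) ]′ (cover k ck)
      j∈ : v j ∈⟨ Q ∷ z ∷ [] ⟩
      j∈ = [ (λ h → ⊥-elim (double≢0 2<p ci (trans (+-congˡ (trans ci≡α (sym (left j h (λ h′ → cj (apex j h′)))))) cij))) , id ]′ (cover j cj)

    swap⊎ : ∀ {A B : Set} → A ⊎ B → B ⊎ A
    swap⊎ (inj₁ a) = inj₂ a
    swap⊎ (inj₂ b) = inj₁ b

    from-line : 2 ℕ.< p → ∀ {i′ j′} → LineQuad c i′ j′ → RelativeQuad c i j k
    from-line 2<p {i′} {j′} L = [ place 2<p (LineQuad.quad L) cover , place 2<p (Quad-swap (LineQuad.quad L)) (λ l cl → swap⊎ (cover l cl)) ]′ (cover i ci)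
      where
      cover : ∀ l → c l ≢ 0# → v l ∈⟨ v i′ ∷ LineQuad.z L ∷ [] ⟩ ⊎ v l ∈⟨ v (LineQuad.y L) ∷ LineQuad.z L ∷ [] ⟩
      cover l cl = two-lines L l cl (line? i′ j′ l)

    from-secant : ¬ (v j ∈⟨ v i ∷ v k ∷ [] ⟩) → LineQuad c i k → RelativeQuad c i j k
    from-secant j∉ L = LineQuad.z L , Quad-rebaseʳ (LineQuad.quad L) (LineQuad.off-line′ L j cj j∉) (λ h → cj (Quad.apex (LineQuad.quad L) j h)) ,
      LineQuad.on-line L k ck ∈₂-right

    decide : Dec (2 ℕ.< p) → RelativeQuad c i j k
    decide (yes 2<p) = from-line 2<p (from-rich-line dual w (rich-line-exists {c} 2<p dual w i ci))
    decide (no p≯2) = from-secant j∉ (from-two p≯2 dual w i k (k≢i ∘ sym) ci ck)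
      where
      p≤2 : p ℕ.≤ 2
      p≤2 = ℕ.≮⇒≥ p≯2
      on≤p : count (onLine? c i k) ℕ.≤ p
      on≤p = ℕ.+-cancelʳ-≤ p _ _ (ℕ.≤-trans (ℕ.+-monoʳ-≤ (count (onLine? c i k)) (off-line {c} dual i k (k≢i ∘ sym) ci ck))
          (ℕ.≤-reflexive (trans (sym (weight-line {c} i k)) w)))
      j∉ : ¬ (v j ∈⟨ v i ∷ v k ∷ [] ⟩)
      j∉ j∈ = ℕ.<⇒≱ (s≤s p≤2) (ℕ.≤-trans
        (count≥3 (onLine? c i k) i k j (ci , ∈₂-left) (ck , ∈₂-right) (cj , j∈) (k≢i ∘ sym) (j≢i ∘ sym) k≢j) on≤p)

  -- Secant subspaces and the minimum weight

  restrictAll : (Fin r → Form m) → Word → Word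
  restrictAll {zero}  fs c = c
  restrictAll {suc r} fs c = restrictAll (fs ∘ suc) (restrict (fs zero) c)

  restrict-killed : ∀ f c k → f · v k ≡ 0# → restrict f c k ≡ c k
  restrict-killed f c k fk = keep-yes (f · v k ≟ 0#) fk

  restrict-supp : ∀ f c k → restrict f c k ≢ 0# → f · v k ≡ 0# × c k ≢ 0#
  restrict-supp f c k = keep-≢0 (f · v k ≟ 0#)

  restrictAll-killed : (fs : Fin r → Form m) → ∀ c k → Kills fs (v k) → restrictAll fs c k ≡ c k
  restrictAll-killed {zero}  fs c k kills = refl
  restrictAll-killed {suc r} fs c k kills = trans
    (restrictAll-killed (fs ∘ suc) (restrict (fs zero) c) k (kills ∘ suc)) (restrict-killed (fs zero) c k (kills zero))

  restrictAll-supp : (fs : Fin r → Form m) → ∀ c k → restrictAll fs c k ≢ 0# → Kills fs (v k) × c k ≢ 0#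
  restrictAll-supp {zero}  fs c k ne = (λ ()) , ne
  restrictAll-supp {suc r} fs c k ne =
    let kills , ne′ = restrictAll-supp (fs ∘ suc) (restrict (fs zero) c) k ne
        kill₀ , ne″ = restrict-supp (fs zero) c k ne′
    in (λ { zero → kill₀ ; (suc l) → kills l }) , ne″

  Dual-restrictAll : (fs : Fin r → Form m) → ∀ {c} → Dual r c → sum (restrictAll fs c) ≡ 0#
  Dual-restrictAll {zero}  fs dual = dual
  Dual-restrictAll {suc r} fs dual = Dual-restrictAll (fs ∘ suc) (dual (fs zero))

  module _ {k} (B : Fin k → Vect m) where

    outside? : (c : Word) → ∀ i → Dec (c i ≢ 0# × ¬ (v i ∈⟨ B ⟩))
    outside? c i = supp? c i ×-dec ¬? (v i ∈⟨ B ⟩?)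

    -- `average` is applied r times, each time keeping at most a p-th part of the support points
    -- outside ⟨B⟩.
    thin : ∀ r c → ∃ λ (fs : Fin r → Form m) → (∀ {u} → u ∈⟨ B ⟩ → Kills fs u) ×
      p ℕ.^ r ℕ.* count (λ i → outside? c i ×-dec kills? fs (v i)) ℕ.≤ count (outside? c)
    thin zero c = none , (λ _ ()) , ℕ.≤-trans (ℕ.≤-reflexive (ℕ.*-identityˡ _))
      (count-mono (λ i → outside? c i ×-dec kills? none (v i)) (outside? c) (λ i → proj₁))
      where
      none : Fin 0 → Form m
      none ()
    thin (suc r) c =
      let f , fkills , f≤ = average (Annihilator.forms A) (outside? c) (λ i out kv → proj₂ out (Annihilator.complete A (v i) kv))
          fs , kills , fs≤ = thin r (restrict f c)
      in f ∷ fs , (λ u∈ → λ { zero → fkills (kills-span A u∈) ; (suc l) → kills u∈ l }) , bound f fs f≤ fs≤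
      where
      A = annihilator B
      bound : ∀ f (fs : Fin r → Form m) → p ℕ.* count (λ i → outside? c i ×-dec (f · v i ≟ 0#)) ℕ.≤ count (outside? c) →
        p ℕ.^ r ℕ.* count (λ i → outside? (restrict f c) i ×-dec kills? fs (v i)) ℕ.≤ count (outside? (restrict f c)) →
        p ℕ.^ suc r ℕ.* count (λ i → outside? c i ×-dec kills? (f ∷ fs) (v i)) ℕ.≤ count (outside? c)
      bound f fs f≤ fs≤ = begin
        p ℕ.* p ℕ.^ r ℕ.* count (λ i → outside? c i ×-dec kills? (f ∷ fs) (v i))
          ≡⟨ ℕ.*-assoc p (p ℕ.^ r) _ ⟩
        p ℕ.* (p ℕ.^ r ℕ.* count (λ i → outside? c i ×-dec kills? (f ∷ fs) (v i)))
          ≤⟨ ℕ.*-monoʳ-≤ p (ℕ.*-monoʳ-≤ (p ℕ.^ r) (count-mono (λ i → outside? c i ×-dec kills? (f ∷ fs) (v i))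
               (λ i → outside? (restrict f c) i ×-dec kills? fs (v i))
               (λ { i ((ci , i∉) , kv) → ((λ e → ci (trans (sym (restrict-killed f c i (kv zero))) e)) , i∉) , kv ∘ suc }))) ⟩
        p ℕ.* (p ℕ.^ r ℕ.* count (λ i → outside? (restrict f c) i ×-dec kills? fs (v i)))
          ≤⟨ ℕ.*-monoʳ-≤ p fs≤ ⟩
        p ℕ.* count (outside? (restrict f c))
          ≤⟨ ℕ.*-monoʳ-≤ p (count-mono (outside? (restrict f c)) (λ i → outside? c i ×-dec (f · v i ≟ 0#))
               (λ { i (ne , i∉) → let fi , ci = restrict-supp f c i ne in (ci , i∉) , fi })) ⟩
        p ℕ.* count (λ i → outside? c i ×-dec (f · v i ≟ 0#))
          ≤⟨ f≤ ⟩
        count (outside? c) ∎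
        where open ℕ.≤-Reasoning

  record Secant (r : ℕ) (c : Word) (i j : Fin N) : Set where
    field
      forms  : Fin r → Form m
      killsᵢ : Kills forms (v i)
      killsⱼ : Kills forms (v j)
      only   : ∀ k → c k ≢ 0# → Kills forms (v k) → k ≡ i ⊎ k ≡ j

  at-most-one : {P : Fin N → Set} (P? : ∀ k → Dec (P k)) → count P? ℕ.≤ 1 → ∀ {i j} → P i → P j → i ≡ j
  at-most-one P? le {i} {j} pi pj with i ≟ j
  ... | yes eq = eq
  ... | no i≢j = ⊥-elim (ℕ.<⇒≱ (count≥2 P? i j pi pj i≢j) le)

  p^r>0 : ∀ r → 0 ℕ.< p ℕ.^ r
  p^r>0 r = ℕ.m^n>0 p {{ℕ.>-nonZero (ℕ.<⇒≤ 1<p)}} r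

  cancel-power : ∀ r {a b} → p ℕ.^ r ℕ.* a ℕ.≤ b → b ℕ.< 2 ℕ.* p ℕ.^ r → a ℕ.≤ 1
  cancel-power r {a} le lt = ℕ.≤-pred (ℕ.*-cancelˡ-< (p ℕ.^ r) a 2
    (ℕ.≤-trans (ℕ.≤-trans (s≤s le) lt) (ℕ.≤-reflexive (ℕ.*-comm 2 (p ℕ.^ r)))))

  module _ {k} (B : Fin k → Vect m) {r : ℕ} {c : Word} (dual : Dual r c) (i : Fin N) (ci : c i ≢ 0#) (i∈ : v i ∈⟨ B ⟩)
    (small : weight c ℕ.≤ 2 ℕ.* p ℕ.^ r) where

    thinned? : (fs : Fin r → Form m) → ∀ k → Dec ((c k ≢ 0# × ¬ (v k ∈⟨ B ⟩)) × Kills fs (v k))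
    thinned? fs k = outside? B c k ×-dec kills? fs (v k)

    -- Since v i lies in ⟨B⟩, fewer than 2p^r support points are outside, so fewer than two survive
    -- the thinning.
    thinned : ∃ λ (fs : Fin r → Form m) → (∀ {u} → u ∈⟨ B ⟩ → Kills fs u) × count (thinned? fs) ℕ.≤ 1
    thinned =
      let fs , kills , le = thin B r c
      in fs , kills , cancel-power r le (ℕ.≤-trans (count-strict (outside? B c) (supp? c) (λ k → proj₁) i ci (λ h → proj₂ h i∈)) small)

  -- At most one support point besides i survives. One does survive, with the opposite value,
  -- because c sums to zero on the subspace.
  secant-through : Dual r c → ∀ i → c i ≢ 0# → weight c ℕ.≤ 2 ℕ.* p ℕ.^ r →
    ∃ λ j → j ≢ i × c j ≢ 0# × c i + c j ≡ 0# × Secant r c i j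
  secant-through {r} {c} dual i ci small =
    let fs , kills , le = thinned B dual i ci (∈-head B) small
    in decide fs (kills (∈-head B)) le (Fin.any? (thinned? B dual i ci (∈-head B) small fs))
    where
    B = v i ∷ []
    Other : (Fin r → Form m) → Fin N → Set
    Other fs k = (c k ≢ 0# × ¬ (v k ∈⟨ B ⟩)) × Kills fs (v k)
    other : ∀ fs k → restrictAll fs c k ≢ 0# → k ≢ i → Other fs k
    other fs k ne k≢i = let kv , ck = restrictAll-supp fs c k ne in (ck , k≢i ∘ same-point) , kv
    decide : ∀ fs → Kills fs (v i) → count (thinned? B dual i ci (∈-head B) small fs) ℕ.≤ 1 → Dec (∃ (Other fs)) →
      ∃ λ j → j ≢ i × c j ≢ 0# × c i + c j ≡ 0# × Secant r c i j
    decide fs ki le (no none) = ⊥-elim (ci (begin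
      c i                      ≡⟨ sym (restrictAll-killed fs c i ki) ⟩
      restrictAll fs c i       ≡⟨ sym (sum-single i (λ k k≢i → decidable-stable (restrictAll fs c k ≟ 0#) (λ ne → none (k , other fs k ne k≢i)))) ⟩
      sum (restrictAll fs c)   ≡⟨ Dual-restrictAll fs dual ⟩
      0#                       ∎))
      where open ≡-Reasoning
    decide fs ki le (yes (j , oj@((cj , j∉) , kj))) = j , j≢i , cj , (begin
      c i + c j                                ≡⟨ cong₂ _+_ (sym (restrictAll-killed fs c i ki)) (sym (restrictAll-killed fs c j kj)) ⟩
      restrictAll fs c i + restrictAll fs c j  ≡⟨ sym (sum-pair i j (j≢i ∘ sym) (λ k k≢i k≢j → decidable-stable (restrictAll fs c k ≟ 0#) (λ ne → k≢j (unique-other (other fs k ne k≢i))))) ⟩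
      sum (restrictAll fs c)                   ≡⟨ Dual-restrictAll fs dual ⟩
      0#                                       ∎) , record
      { forms = fs ; killsᵢ = ki ; killsⱼ = kj ; only = λ k ck kk → only k ck kk (k ≟ i) }
      where
      open ≡-Reasoning
      j≢i : j ≢ i
      j≢i refl = j∉ (∈-head B)
      unique-other : ∀ {k} → Other fs k → k ≡ j
      unique-other ok = at-most-one (thinned? B dual i ci (∈-head B) small fs) le ok oj
      only : ∀ k → c k ≢ 0# → Kills fs (v k) → Dec (k ≡ i) → k ≡ i ⊎ k ≡ j
      only k ck kk (yes e) = inj₁ e
      only k ck kk (no k≢i) = inj₂ (unique-other ((ck , k≢i ∘ same-point) , kk))

  -- Now ⟨B⟩ is the line through i and j. A further support point k in the thinned subspace would be
  -- the only one, and as c i and c j cancel, the sum over the subspace would be c k.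
  secant-pair : Dual r c → ∀ i j → i ≢ j → c i ≢ 0# → c i + c j ≡ 0# → weight c ℕ.≤ 2 ℕ.* p ℕ.^ r →
    (∀ k → c k ≢ 0# → v k ∈⟨ v i ∷ v j ∷ [] ⟩ → k ≡ i ⊎ k ≡ j) → Secant r c i j
  secant-pair {r} {c} dual i j i≢j ci cij small line =
    let fs , kills , le = thinned B dual i ci ∈₂-left small
    in record { forms = fs ; killsᵢ = kills ∈₂-left ; killsⱼ = kills ∈₂-right
              ; only = λ k ck kk → decidable-stable ((k ≟ i) ⊎-dec (k ≟ j)) λ ne → contradict fs (kills ∈₂-left) (kills ∈₂-right) le k ck kk ne }
    where
    B = v i ∷ v j ∷ []
    contradict : ∀ fs → Kills fs (v i) → Kills fs (v j) → count (thinned? B dual i ci ∈₂-left small fs) ℕ.≤ 1 →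
      ∀ k → c k ≢ 0# → Kills fs (v k) → ¬ (k ≡ i ⊎ k ≡ j) → ⊥
    contradict fs ki kj le k ck kk ne = ck (begin
      c k                                                  ≡⟨ sym (restrictAll-killed fs c k kk) ⟩
      restrictAll fs c k                                   ≡⟨ sym (keep-yes (k ≟ k) refl) ⟩
      part k                                               ≡⟨ sym (sum-single k (λ l l≢k → keep-no (l ≟ k) l≢k)) ⟩
      sum part                                             ≡⟨ sym (+-identityʳ _) ⟩
      sum part + 0#                                        ≡⟨ +-congˡ (sym cij) ⟩
      sum part + (c i + c j)                               ≡⟨ +-congˡ (cong₂ _+_ (sym (rest-at i ki (ne ∘ inj₁ ∘ sym))) (sym (rest-at j kj (ne ∘ inj₂ ∘ sym)))) ⟩
      sum part + (rest i + rest j)                         ≡⟨ +-congˡ (sym (sum-pair i j i≢j rest-off)) ⟩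
      sum part + sum rest                                  ≡⟨ sym (sum-+ _ _) ⟩
      sum (λ l → part l + rest l)                          ≡⟨ sum-cong (λ l → parts l (l ≟ k)) ⟩
      sum (restrictAll fs c)                               ≡⟨ Dual-restrictAll fs dual ⟩
      0#                                                   ∎)
      where
      open ≡-Reasoning
      part rest : Fin N → F
      part l = keep (l ≟ k) (restrictAll fs c l)
      rest l = keep (¬? (l ≟ k)) (restrictAll fs c l)
      parts : ∀ l (d : Dec (l ≡ k)) → keep d (restrictAll fs c l) + keep (¬? d) (restrictAll fs c l) ≡ restrictAll fs c l
      parts l (yes _) = +-identityʳ _
      parts l (no _)  = +-identityˡ _
      rest-at : ∀ l → Kills fs (v l) → l ≢ k → rest l ≡ c l
      rest-at l kl l≢k = trans (keep-yes (¬? (l ≟ k)) l≢k) (restrictAll-killed fs c l kl)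
      rest-off : ∀ l → l ≢ i → l ≢ j → rest l ≡ 0#
      rest-off l l≢i l≢j = decidable-stable (rest l ≟ 0#) λ nz →
        let l≢k , ne′ = keep-≢0 (¬? (l ≟ k)) nz
            kl , cl = restrictAll-supp fs c l ne′
        in l≢k (at-most-one (thinned? B dual i ci ∈₂-left small fs) le
             ((cl , λ l∈ → [ l≢i , l≢j ]′ (line l cl l∈)) , kl) ((ck , λ k∈ → ne (line k ck k∈)) , kk))

  -- A subspace through i, j and k to which the results on weight 2p apply; what they say about
  -- these three points carries over to c.
  record Subword (c : Word) (i j k : Fin N) : Set where
    field
      {size} : ℕ
      forms  : Fin size → Form m
      killsᵢ : Kills forms (v i)
      killsⱼ : Kills forms (v j)
      killsₖ : Kills forms (v k)
      dual   : Dual 1 (restrictAll forms c)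
      minimal : weight (restrictAll forms c) ≡ p ℕ.+ p

  extend : ∀ {i j k} f → f · v i ≡ 0# → f · v j ≡ 0# → f · v k ≡ 0# → Subword (restrict f c) i j k → Subword c i j k
  extend f fi fj fk S = record
    { forms = f ∷ forms ; killsᵢ = cons fi killsᵢ ; killsⱼ = cons fj killsⱼ ; killsₖ = cons fk killsₖ ; dual = dual ; minimal = minimal }
    where
    open Subword S
    cons : ∀ {k} → f · v k ≡ 0# → Kills forms (v k) → Kills (f ∷ forms) (v k)
    cons e kv zero    = e
    cons e kv (suc l) = kv l

  off? : (c : Word) (f : Form m) → ∀ k → Dec (c k ≢ 0# × f · v k ≢ 0#)
  off? c f k = supp? c k ×-dec ¬? (f · v k ≟ 0#)

  weight-restrict : ∀ f → weight c ≡ weight (restrict f c) ℕ.+ count (off? c f)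
  weight-restrict {c} f = trans (count-split (supp? c) (λ k → f · v k ≟ 0#)) (cong (ℕ._+ count (off? c f))
    (count-cong (λ k → supp? c k ×-dec (f · v k ≟ 0#)) (supp? (restrict f c))
      (λ { k (ck , fk) e → ck (trans (sym (restrict-killed f c k fk)) e) })
      (λ k ne → let fk , ck = restrict-supp f c k ne in ck , fk)))

  -- The number 2p - 2: what a word of the case r = 1 has at least in its support besides the two
  -- points of a secant.
  twice-pred : ℕ
  twice-pred = (p ℕ.∸ 1) ℕ.+ (p ℕ.∸ 1)

  2+twice-pred : 2 ℕ.+ twice-pred ≡ p ℕ.+ p
  2+twice-pred = trans (cong suc (sym (ℕ.+-suc (p ℕ.∸ 1) (p ℕ.∸ 1)))) (cong (λ x → x ℕ.+ x) suc-pred-p)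

  -- The members of the fan through the secant are the common kernels of the forms fs l + t l f, one for each t.
  module Fan {i j : Fin N} (i≢j : i ≢ j) (f : Form m) (fi : f · v i ≡ 0#) (fj : f · v j ≡ 0#) where

    record Hypotheses (r : ℕ) (c : Word) (fs : Fin r → Form m) : Set where
      field
        dual   : Dual (suc r) c
        suppᵢ  : c i ≢ 0#
        suppⱼ  : c j ≢ 0#
        killsᵢ : Kills fs (v i)
        killsⱼ : Kills fs (v j)
        only   : ∀ k → c k ≢ 0# → f · v k ≡ 0# → Kills fs (v k) → k ≡ i ⊎ k ≡ j

    slice : ∀ {fs : Fin (suc r) → Form m} → Hypotheses (suc r) c fs → ∀ t → Hypotheses r (restrict (fs zero ⊞ t ⊡ f) c) (fs ∘ suc)
    slice {c = c} {fs} H t = record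
      { dual = dual (fs zero ⊞ t ⊡ f)
      ; suppᵢ = λ e → suppᵢ (trans (sym (restrict-killed (fs zero ⊞ t ⊡ f) c i (on (killsᵢ zero) fi))) e)
      ; suppⱼ = λ e → suppⱼ (trans (sym (restrict-killed (fs zero ⊞ t ⊡ f) c j (on (killsⱼ zero) fj))) e)
      ; killsᵢ = killsᵢ ∘ suc ; killsⱼ = killsⱼ ∘ suc
      ; only = λ k ne fk kk → let gk , ck = restrict-supp (fs zero ⊞ t ⊡ f) c k ne in
          only k ck fk (λ { zero → trans (sym (absorb fk)) gk ; (suc l) → kk l }) }
      where
      open Hypotheses H
      on : ∀ {x y} → x ≡ 0# → y ≡ 0# → x + t * y ≡ 0#
      on refl refl = trans (+-identityˡ _) (zeroʳ t)

    slices : ∀ (g : Form m) → count (off? c f) ≡ Counting.sum (λ t → count (off? (restrict (g ⊞ t ⊡ f) c) f))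
    slices {c} g = trans (pencil-partition (off? c f) f g (λ k → proj₂)) (Counting.sum-cong λ t →
      count-cong (λ k → off? c f k ×-dec ((g ⊞ t ⊡ f) · v k ≟ 0#)) (off? (restrict (g ⊞ t ⊡ f) c) f)
        (λ { k ((ck , fk) , e) → (λ e′ → ck (trans (sym (restrict-killed (g ⊞ t ⊡ f) c k e)) e′)) , fk })
        (λ { k (ne , fk) → let e , ck = restrict-supp (g ⊞ t ⊡ f) c k ne in (ck , fk) , e }))

    kernel-two : ∀ {fs : Fin 0 → Form m} → Hypotheses 0 c fs → weight (restrict f c) ≡ 2
    kernel-two {c} H = ℕ.≤-antisym
      (count≤2 (supp? (restrict f c)) i j (λ k ne → let fk , ck = restrict-supp f c k ne in only k ck fk (λ ())))
      (count≥2 (supp? (restrict f c)) i j (λ e → suppᵢ (trans (sym (restrict-killed f c i fi)) e))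
        (λ e → suppⱼ (trans (sym (restrict-killed f c j fj)) e)) i≢j)
      where open Hypotheses H

    -- A point where f is nonzero lies on exactly one of the p^r members of the fan. On each member
    -- c has weight at least 2p, and only i and j of these support points are zeros of f. The
    -- members are separated one form at a time.
    lower-bound : ∀ r {c} (fs : Fin r → Form m) → Hypotheses r c fs → p ℕ.^ r ℕ.* twice-pred ℕ.≤ count (off? c f)
    lower-bound zero {c} fs H = ℕ.+-cancelˡ-≤ 2 _ _ (begin
      2 ℕ.+ (1 ℕ.* twice-pred)       ≡⟨ cong (2 ℕ.+_) (ℕ.*-identityˡ twice-pred) ⟩
      2 ℕ.+ twice-pred               ≡⟨ 2+twice-pred ⟩
      p ℕ.+ p                        ≤⟨ weight≥2p {c} (Hypotheses.dual H) i (Hypotheses.suppᵢ H) ⟩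
      weight c                       ≡⟨ weight-restrict {c} f ⟩
      weight (restrict f c) ℕ.+ count (off? c f) ≡⟨ cong (ℕ._+ count (off? c f)) (kernel-two H) ⟩
      2 ℕ.+ count (off? c f)         ∎)
      where open ℕ.≤-Reasoning
    lower-bound (suc r) {c} fs H = begin
      p ℕ.* p ℕ.^ r ℕ.* twice-pred   ≡⟨ ℕ.*-assoc p (p ℕ.^ r) twice-pred ⟩
      p ℕ.* (p ℕ.^ r ℕ.* twice-pred) ≡⟨ sym (sum-const p (p ℕ.^ r ℕ.* twice-pred)) ⟩
      Counting.sum {p} (λ _ → p ℕ.^ r ℕ.* twice-pred) ≤⟨ sum-mono _ _ (λ t → lower-bound r (fs ∘ suc) (slice H t)) ⟩
      Counting.sum (λ t → count (off? (restrict (fs zero ⊞ t ⊡ f) c) f)) ≡⟨ sym (slices {c} (fs zero)) ⟩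
      count (off? c f)               ∎
      where open ℕ.≤-Reasoning

    -- When the total equals the sum of the lower bounds, each slice attains its own. The slice
    -- through k is the one whose parameter makes the form vanish at k.
    equality : ∀ r {c} (fs : Fin r → Form m) → Hypotheses r c fs → count (off? c f) ℕ.≤ p ℕ.^ r ℕ.* twice-pred →
      ∀ k → c k ≢ 0# → f · v k ≢ 0# → Subword c i j k
    equality zero {c} fs H le k ck fk = record
      { forms = fs ; killsᵢ = λ () ; killsⱼ = λ () ; killsₖ = λ () ; dual = Hypotheses.dual H
      ; minimal = ℕ.≤-antisym (begin
          weight c                       ≡⟨ weight-restrict {c} f ⟩
          weight (restrict f c) ℕ.+ count (off? c f) ≡⟨ cong (ℕ._+ count (off? c f)) (kernel-two H) ⟩
          2 ℕ.+ count (off? c f)         ≤⟨ ℕ.+-monoʳ-≤ 2 le ⟩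
          2 ℕ.+ (1 ℕ.* twice-pred)       ≡⟨ cong (2 ℕ.+_) (ℕ.*-identityˡ twice-pred) ⟩
          2 ℕ.+ twice-pred               ≡⟨ 2+twice-pred ⟩
          p ℕ.+ p                        ∎) (weight≥2p {c} (Hypotheses.dual H) i (Hypotheses.suppᵢ H)) }
      where open ℕ.≤-Reasoning
    equality (suc r) {c} fs H le k ck fk =
      let t , e = solve-linear fk (fs zero · v k)
          g = fs zero ⊞ t ⊡ f
          open Hypotheses H
          on = λ {l} (a : fs zero · v l ≡ 0#) (b : f · v l ≡ 0#) → vanish-combination a b
      in extend {c} g (on {i} (killsᵢ zero) fi) (on {j} (killsⱼ zero) fj) e
           (equality r (fs ∘ suc) (slice H t) (ℕ.≤-reflexive (all-minimal t)) k (λ e′ → ck (trans (sym (restrict-killed g c k e)) e′)) fk)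
      where
      all-minimal : ∀ t → count (off? (restrict (fs zero ⊞ t ⊡ f) c) f) ≡ p ℕ.^ r ℕ.* twice-pred
      all-minimal = sum-≤⇒≡ (λ t → count (off? (restrict (fs zero ⊞ t ⊡ f) c) f)) (λ t → lower-bound r (fs ∘ suc) (slice H t))
        (ℕ.≤-trans (ℕ.≤-reflexive (sym (slices {c} (fs zero)))) (ℕ.≤-trans le (ℕ.≤-reflexive (ℕ.*-assoc p (p ℕ.^ r) twice-pred))))

  total-weight : ∀ r → 2 ℕ.* p ℕ.^ r ℕ.+ p ℕ.^ r ℕ.* twice-pred ≡ 2 ℕ.* p ℕ.^ suc r
  total-weight r = begin
    2 ℕ.* p ℕ.^ r ℕ.+ p ℕ.^ r ℕ.* twice-pred  ≡⟨ cong (ℕ._+ p ℕ.^ r ℕ.* twice-pred) (ℕ.*-comm 2 (p ℕ.^ r)) ⟩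
    p ℕ.^ r ℕ.* 2 ℕ.+ p ℕ.^ r ℕ.* twice-pred  ≡⟨ sym (ℕ.*-distribˡ-+ (p ℕ.^ r) 2 twice-pred) ⟩
    p ℕ.^ r ℕ.* (2 ℕ.+ twice-pred)            ≡⟨ cong (p ℕ.^ r ℕ.*_) 2+twice-pred ⟩
    p ℕ.^ r ℕ.* (p ℕ.+ p)                     ≡⟨ cong (p ℕ.^ r ℕ.*_) (cong (p ℕ.+_) (sym (ℕ.+-identityʳ p))) ⟩
    p ℕ.^ r ℕ.* (2 ℕ.* p)                     ≡⟨ ℕ.*-comm (p ℕ.^ r) (2 ℕ.* p) ⟩
    2 ℕ.* p ℕ.* p ℕ.^ r                       ≡⟨ ℕ.*-assoc 2 p (p ℕ.^ r) ⟩
    2 ℕ.* p ℕ.^ suc r                         ∎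
    where open ≡-Reasoning

  module _ {i j : Fin N} (i≢j : i ≢ j) where

    restrict-secant : ∀ {r c} → (S : Secant (suc r) c i j) → let f = Secant.forms S zero in Secant r (restrict f c) i j
    restrict-secant {c = c} S = record
      { forms = forms ∘ suc ; killsᵢ = killsᵢ ∘ suc ; killsⱼ = killsⱼ ∘ suc
      ; only = λ k ne kk → let fk , ck = restrict-supp (forms zero) c k ne in only k ck (λ { zero → fk ; (suc l) → kk l }) }
      where open Secant S

    fan : ∀ {r c} → Dual (suc r) c → c i ≢ 0# → c j ≢ 0# → (S : Secant (suc r) c i j) →
      let f = Secant.forms S zero in Fan.Hypotheses i≢j f (Secant.killsᵢ S zero) (Secant.killsⱼ S zero) r c (Secant.forms S ∘ suc)
    fan dual ci cj S = record
      { dual = dual ; suppᵢ = ci ; suppⱼ = cj ; killsᵢ = killsᵢ ∘ suc ; killsⱼ = killsⱼ ∘ suc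
      ; only = λ k ck fk kk → only k ck (λ { zero → fk ; (suc l) → kk l }) }
      where open Secant S

    secant-supp : ∀ f c {k} → f · v k ≡ 0# → c k ≢ 0# → restrict f c k ≢ 0#
    secant-supp f c {k} fk ck e = ck (trans (sym (restrict-killed f c k fk)) e)

    -- On the kernel of the first form f the same secant serves with r lowered by one; the fan
    -- counts the points off this kernel. Unfolding the recursion gives the geometric sum for 2p^r.
    secant-bound : ∀ r {c} → Dual r c → c i ≢ 0# → c j ≢ 0# → Secant r c i j → 2 ℕ.* p ℕ.^ r ℕ.≤ weight c
    secant-bound zero {c} dual ci cj S = count≥2 (supp? c) i j ci cj i≢j
    secant-bound (suc r) {c} dual ci cj S = begin
      2 ℕ.* p ℕ.^ suc r                              ≡⟨ sym (total-weight r) ⟩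
      2 ℕ.* p ℕ.^ r ℕ.+ p ℕ.^ r ℕ.* twice-pred       ≤⟨ ℕ.+-mono-≤
        (secant-bound r (dual f) (secant-supp f c (killsᵢ zero) ci) (secant-supp f c (killsⱼ zero) cj) (restrict-secant S))
        (Fan.lower-bound i≢j f (killsᵢ zero) (killsⱼ zero) r (forms ∘ suc) (fan dual ci cj S)) ⟩
      weight (restrict f c) ℕ.+ count (off? c f)     ≡⟨ sym (weight-restrict {c} f) ⟩
      weight c                                       ∎
      where
      open ℕ.≤-Reasoning
      open Secant S
      f = forms zero

    subword : ∀ r {c} → Dual r c → c i ≢ 0# → c j ≢ 0# → Secant r c i j → weight c ℕ.≤ 2 ℕ.* p ℕ.^ r →
      ∀ k → c k ≢ 0# → k ≢ i → k ≢ j → Subword c i j k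
    subword zero dual ci cj S le k ck k≢i k≢j = ⊥-elim ([ k≢i , k≢j ]′ (Secant.only S k ck (λ ())))
    subword (suc r) {c} dual ci cj S le k ck k≢i k≢j = decide (f · v k ≟ 0#)
      where
      open Secant S
      f = forms zero
      bound : weight (restrict f c) ℕ.+ count (off? c f) ℕ.≤ 2 ℕ.* p ℕ.^ r ℕ.+ p ℕ.^ r ℕ.* twice-pred
      bound = ℕ.≤-trans (ℕ.≤-reflexive (sym (weight-restrict {c} f))) (ℕ.≤-trans le (ℕ.≤-reflexive (sym (total-weight r))))
      S′ : Secant r (restrict f c) i j
      S′ = restrict-secant S
      ci′ = secant-supp f c (killsᵢ zero) ci
      cj′ = secant-supp f c (killsⱼ zero) cj
      decide : Dec (f · v k ≡ 0#) → Subword c i j k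
      decide (yes fk) = extend {c} f (killsᵢ zero) (killsⱼ zero) fk
        (subword r (dual f) ci′ cj′ S′
          (ℕ.+-cancelʳ-≤ (p ℕ.^ r ℕ.* twice-pred) _ _ (ℕ.≤-trans
            (ℕ.+-monoʳ-≤ (weight (restrict f c)) (Fan.lower-bound i≢j f (killsᵢ zero) (killsⱼ zero) r (forms ∘ suc) (fan dual ci cj S))) bound))
          k (secant-supp f c fk ck) k≢i k≢j)
      decide (no fk) = Fan.equality i≢j f (killsᵢ zero) (killsⱼ zero) r (forms ∘ suc) (fan dual ci cj S)
        (ℕ.+-cancelˡ-≤ (2 ℕ.* p ℕ.^ r) _ _ (ℕ.≤-trans
          (ℕ.+-monoˡ-≤ (count (off? c f)) (secant-bound r (dual f) ci′ cj′ S′)) bound)) k ck fk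

  minimum-distance : ∀ r → Dual r c → ∀ i → c i ≢ 0# → 2 ℕ.* p ℕ.^ r ℕ.≤ weight c
  minimum-distance {c} r dual i ci = ℕ.≮⇒≥ λ small →
    let j , j≢i , cj , _ , S = secant-through {r} {c} dual i ci (ℕ.<⇒≤ small)
    in ℕ.<⇒≱ small (secant-bound (j≢i ∘ sym) r dual ci cj S)

-- `locate` says that every point of the space occurs among the v i. It is called upon whenever a
-- vector formed as a linear combination has to be a point at which c has a value.
module Projective {p} (K : PrimeField p) {m N : ℕ} (v : Fin N → Linear.Vect K m)
  (nonzero : ∀ i → ¬ (∀ j → v i j ≡ PrimeField.0# K))
  (unique : ∀ {i j} s → (∀ l → v i l ≡ PrimeField._*_ K s (v j l)) → i ≡ j)
  (locate : ∀ u → ¬ (Linear._∈⟨_⟩ K u []) → ∃ λ i → Linear._∈⟨_⟩ K (v i) (u ∷ [])) where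
  open PrimeField K
  open ZSolver K using (solve; _:+_; _:*_; :-_; _:-_; _:=_; con)
  open Linear K
  open SmallSpans K
  open Powers K
  open Orthogonality K v
  open PointSet K v nonzero unique
  open Counting hiding (sum; sum-empty; sum-suc; sum-cong; sum-+; sum-comm; sum-*ˡ; sum-*ʳ; sum-0; sum-remove; sum-zero; sum-single; sum-pair)

  private variable
    c : Word
    r s : ℕ

  -- Words of minimum weight

  secant-swap : ∀ {i j} → Secant r c i j → Secant r c j i
  secant-swap S = record { forms = forms ; killsᵢ = killsⱼ ; killsⱼ = killsᵢ ; only = λ k ck kk → [ inj₂ , inj₁ ]′ (only k ck kk) }
    where open Secant S

  opposite-swap : ∀ {a b} → a + b ≡ 0# → b + a ≡ 0#
  opposite-swap = trans (+-comm _ _)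

  opposite-nonzero : ∀ {a b} → a ≢ 0# → a + b ≡ 0# → b ≢ 0#
  opposite-nonzero a≢0 eq refl = a≢0 (trans (sym (+-identityʳ _)) eq)

  negate : ∀ {a b} → a + b ≡ 0# → b ≡ - a
  negate {a} {b} eq = +-cancel-zero {c = a} (opposite-swap eq) (-‿inverseˡ a)

  restrict-quad : ∀ {s} (fs : Fin s → Form m) {P Q z α} → (∀ {u} → u ∈⟨ P ∷ Q ∷ z ∷ [] ⟩ → Kills fs u) →
    Quad (restrictAll fs c) P Q z α → Quad c P Q z α
  restrict-quad {c} fs {P} {Q} {z} kills quad = record
    { independent = independent
    ; left = λ k k∈ k∉ → trans (same k (Pz k∈)) (left k k∈ k∉)
    ; right = λ k k∈ k∉ → trans (same k (∈-weaken P k∈)) (right k k∈ k∉)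
    ; apex = λ k k∈ → trans (same k (∈-weaken P (∈-weaken Q k∈))) (apex k k∈)
    ; off = λ k k∈ k∉ k∉′ → trans (same k k∈) (off k k∈ k∉ k∉′) }
    where
    open Quad quad
    same : ∀ k → v k ∈⟨ P ∷ Q ∷ z ∷ [] ⟩ → c k ≡ restrictAll fs c k
    same k k∈ = sym (restrictAll-killed fs c k (kills k∈))
    Pz : ∀ {x} → x ∈⟨ P ∷ z ∷ [] ⟩ → x ∈⟨ P ∷ Q ∷ z ∷ [] ⟩
    Pz x∈ = swap-front (∈-weaken Q x∈)

  module Minimal (r : ℕ) (c : Word) (dual : Dual r c) (w : weight c ≡ 2 ℕ.* p ℕ.^ r) where

    w≤ : weight c ℕ.≤ 2 ℕ.* p ℕ.^ r
    w≤ = ℕ.≤-reflexive w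

    sub : ∀ {i j} → Secant r c i j → j ≢ i → c i ≢ 0# → c i + c j ≡ 0# → ∀ k → c k ≢ 0# → k ≢ i → k ≢ j → Subword c i j k
    sub S j≢i ci cij k ck k≢i k≢j = subword (j≢i ∘ sym) r dual ci (opposite-nonzero ci cij) S w≤ k ck k≢i k≢j

    secant-values : ∀ {i j} → Secant r c i j → j ≢ i → c i ≢ 0# → c i + c j ≡ 0# → ∀ k → c k ≢ 0# → c k ≡ c i ⊎ c k ≡ - c i
    secant-values {i} {j} S j≢i ci cij k ck = decide (k ≟ i) (k ≟ j)
      where
      general : Subword c i j k → c k ≡ c i ⊎ c k ≡ - c i
      general W = subst₂ (λ a b → b ≡ a ⊎ b ≡ - a) eqᵢ eqₖ
        (two-values {restrictAll forms c} dual′ minimal i k (λ e → ci (trans (sym eqᵢ) e)) (λ e → ck (trans (sym eqₖ) e)))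
        where
        open Subword W renaming (dual to dual′)
        eqᵢ : restrictAll forms c i ≡ c i
        eqᵢ = restrictAll-killed forms c i killsᵢ
        eqₖ : restrictAll forms c k ≡ c k
        eqₖ = restrictAll-killed forms c k killsₖ
      decide : Dec (k ≡ i) → Dec (k ≡ j) → c k ≡ c i ⊎ c k ≡ - c i
      decide (yes refl) _ = inj₁ refl
      decide (no _) (yes refl) = inj₂ (negate cij)
      decide (no k≢i) (no k≢j) = general (sub S j≢i ci cij k ck k≢i k≢j)

    values : ∀ i k → c i ≢ 0# → c k ≢ 0# → c k ≡ c i ⊎ c k ≡ - c i
    values i k ci ck = let j , j≢i , cj , cij , S = secant-through {r} {c} dual i ci w≤ in secant-values S j≢i ci cij k ck

    secant-quad : ∀ {i j} → Secant r c i j → j ≢ i → c i ≢ 0# → c i + c j ≡ 0# → ∀ k → c k ≡ c i → k ≢ i → k ≢ j → RelativeQuad c i j k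
    secant-quad {i} {j} S j≢i ci cij k ck≡ k≢i k≢j = transfer (sub S j≢i ci cij k (ci ∘ trans (sym ck≡)) k≢i k≢j)
      where
      transfer : Subword c i j k → RelativeQuad c i j k
      transfer W =
        let z , quad , k∈ = relative-quad {restrictAll forms c} dual′ minimal i j k
              (λ e → ci (trans (sym eqᵢ) e)) (trans eqₖ (trans ck≡ (sym eqᵢ))) (trans (cong₂ _+_ eqᵢ eqⱼ) cij) j≢i k≢i k≢j
            z∈ = exchange (∈₂-swap k∈) (λ h → k≢i (same-point h))
            -- The apex z is on the line through i and k, so the plane of the quad lies in the
            -- subspace of W, where the restricted word agrees with c.
            kills : ∀ {u} → u ∈⟨ v i ∷ v j ∷ z ∷ [] ⟩ → Kills forms u
            kills u∈ l = ·-span (forms l) (v i ∷ v j ∷ z ∷ []) (λ { zero → killsᵢ l ; (suc zero) → killsⱼ l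
              ; (suc (suc zero)) → ·-span (forms l) (v k ∷ v i ∷ []) (λ { zero → killsₖ l ; (suc zero) → killsᵢ l }) z∈ }) u∈
        in z , restrict-quad forms kills (subst (Quad (restrictAll forms c) (v i) (v j) z) eqᵢ quad) , k∈
        where
        open Subword W renaming (dual to dual′)
        eqᵢ : restrictAll forms c i ≡ c i
        eqᵢ = restrictAll-killed forms c i killsᵢ
        eqⱼ : restrictAll forms c j ≡ c j
        eqⱼ = restrictAll-killed forms c j killsⱼ
        eqₖ : restrictAll forms c k ≡ c k
        eqₖ = restrictAll-killed forms c k killsₖ

    quad-secant : ∀ {a b z α} → Quad c (v a) (v b) z α → ∀ k → c k ≢ 0# → v k ∈⟨ v a ∷ v b ∷ [] ⟩ → k ≡ a ⊎ k ≡ b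
    quad-secant {a} {b} {z} quad k ck k∈ = decide (v k ∈⟨ v a ∷ z ∷ [] ⟩?) (v k ∈⟨ v b ∷ z ∷ [] ⟩?)
      where
      open Quad quad
      abz : v k ∈⟨ v a ∷ v b ∷ z ∷ [] ⟩
      abz = ∈₂-sub (∈-head (v a ∷ v b ∷ z ∷ [])) (∈-member (v a ∷ v b ∷ z ∷ []) (suc zero)) k∈
      decide : Dec (v k ∈⟨ v a ∷ z ∷ [] ⟩) → Dec (v k ∈⟨ v b ∷ z ∷ [] ⟩) → k ≡ a ⊎ k ≡ b
      decide (no k∉) (no k∉′) = ⊥-elim (ck (off k abz k∉ k∉′))
      decide (yes k∈az) _ = inj₁ (decidable-stable (k ≟ a) λ k≢a →
        independent-head (v b ∷ v a ∷ z ∷ []) (swap-independent independent)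
          (∈₂-sub k∈az ∈₂-left (exchange (∈₂-swap k∈) (λ h → k≢a (same-point h)))))
      decide (no _) (yes k∈bz) = inj₂ (decidable-stable (k ≟ b) λ k≢b →
        independent-head (v a ∷ v b ∷ z ∷ []) independent
          (∈₂-sub k∈bz ∈₂-left (exchange k∈ (λ h → k≢b (same-point h)))))

    -- This makes every opposite pair eligible for `secant-pair`. The partner j of a found by
    -- averaging may differ from b, but then b has the value of j and lies on the line of j in a
    -- quad through j and a. So b can replace j in this quad, whose two lines meet the line through
    -- a and b in these points only.
    only-two : ∀ a b → b ≢ a → c a ≢ 0# → c a + c b ≡ 0# → ∀ k → c k ≢ 0# → v k ∈⟨ v a ∷ v b ∷ [] ⟩ → k ≡ a ⊎ k ≡ b
    only-two a b b≢a ca cab k ck k∈ =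
      let j , j≢a , cj , caj , S = secant-through {r} {c} dual a ca w≤ in decide j j≢a cj caj S (b ≟ j)
      where
      decide : ∀ j → j ≢ a → c j ≢ 0# → c a + c j ≡ 0# → Secant r c a j → Dec (b ≡ j) → k ≡ a ⊎ k ≡ b
      decide j j≢a cj caj S (yes refl) = Secant.only S k ck
        (λ l → ·-span (Secant.forms S l) (v a ∷ v b ∷ []) (λ { zero → Secant.killsᵢ S l ; (suc zero) → Secant.killsⱼ S l }) k∈)
      decide j j≢a cj caj S (no b≢j) =
        let z , quad , b∈ = secant-quad (secant-swap S) (j≢a ∘ sym) cj (opposite-swap caj) b
              (+-cancel-zero (opposite-swap cab) (opposite-swap caj)) b≢j b≢a
        in quad-secant (Quad-swap (Quad-rebase quad b∈ (λ h → opposite-nonzero ca cab (Quad.apex quad b h)))) k ck k∈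

    pair-quad : ∀ a b → b ≢ a → c a ≢ 0# → c a + c b ≡ 0# → ∀ k → c k ≡ c a → k ≢ a → k ≢ b → RelativeQuad c a b k
    pair-quad a b b≢a ca cab = secant-quad
      (secant-pair {r} {c} dual a b (b≢a ∘ sym) ca cab w≤ (only-two a b b≢a ca cab)) b≢a ca cab

    -- Adding multiples of z, read projectively: x moves along its line through z without reaching
    -- z.
    Translation : Vect m → Set
    Translation z = ∀ x y → c x ≢ 0# → v y ∈⟨ v x ∷ z ∷ [] ⟩ → ¬ (v y ∈⟨ z ∷ [] ⟩) → c y ≡ c x

    module FromQuad {a b z} (ca : c a ≢ 0#) (cab : c a + c b ≡ 0#) (quad : Quad c (v a) (v b) z (c a)) where
      open Quad quad

      z≢ : ¬ (z ∈⟨ [] ⟩)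
      z≢ = independent-head (z ∷ []) (independent-tail (v b ∷ z ∷ []) (independent-tail (v a ∷ v b ∷ z ∷ []) independent))
      b∉z : ¬ (v b ∈⟨ z ∷ [] ⟩)
      b∉z = independent-head (v b ∷ z ∷ []) (independent-tail (v a ∷ v b ∷ z ∷ []) independent)
      cb : c b ≢ 0#
      cb = opposite-nonzero ca cab

      -- A second quad through b and x has the same apex, which is the only point of the line ⟨b, z⟩ outside the support.
      translate : ∀ x y → c x ≡ c a → v y ∈⟨ v x ∷ z ∷ [] ⟩ → ¬ (v y ∈⟨ z ∷ [] ⟩) → c y ≡ c x
      translate x y cx y∈ y∉ = decide (v x ∈⟨ v b ∷ z ∷ [] ⟩?)
        where
        decide : Dec (v x ∈⟨ v b ∷ z ∷ [] ⟩) → c y ≡ c x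
        -- This can happen only for p = 2, where c a and its negative coincide; x and y are then on
        -- the same line of the quad.
        decide (yes x∈) = trans (right y (∈₂-sub x∈ ∈₂-right y∈) y∉) (sym (right x x∈ (λ h → ca (trans (sym cx) (apex x h)))))
        decide (no x∉) = let l , l∈ = locate b+z b+z≢ in from-point l l∈
          where
          -- A point of the line ⟨b, z⟩ other than b and z. It has the value of b, so a second quad
          -- can be laid through b, x and this point.
          b+z : Vect m
          b+z j = v b j + 1# * z j
          b+z∈ : b+z ∈⟨ v b ∷ z ∷ [] ⟩
          b+z∈ = ∈-shift 1# ∈₂-left ∈₂-right
          z-from : ∀ {k} {B : Fin k → Vect m} → b+z ∈⟨ B ⟩ → v b ∈⟨ B ⟩ → z ∈⟨ B ⟩
          z-from s∈ b∈ = ∈-resp (λ j → solve 2 (λ b z → z := (b :+ con (ℤ.+ 1) :* z) :+ :- con (ℤ.+ 1) :* b) refl (v b j) (z j)) (∈-shift (- 1#) s∈ b∈)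
          b-from : ∀ {k} {B : Fin k → Vect m} → b+z ∈⟨ B ⟩ → z ∈⟨ B ⟩ → v b ∈⟨ B ⟩
          b-from s∈ z∈ = ∈-resp (λ j → solve 2 (λ b z → b := (b :+ con (ℤ.+ 1) :* z) :+ :- con (ℤ.+ 1) :* z) refl (v b j) (z j)) (∈-shift (- 1#) s∈ z∈)
          b+z∉z : ¬ (b+z ∈⟨ z ∷ [] ⟩)
          b+z∉z s∈ = b∉z (b-from s∈ (∈-head (z ∷ [])))
          b+z≢ : ¬ (b+z ∈⟨ [] ⟩)
          b+z≢ s∈ = b+z∉z (∈-weaken z s∈)
          z∈b : b+z ∈⟨ v b ∷ [] ⟩ → z ∈⟨ v b ∷ [] ⟩
          z∈b s∈ = z-from s∈ (∈-head (v b ∷ []))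
          finish : ∀ z′ → Quad c (v b) (v x) z′ (c b) → b+z ∈⟨ v b ∷ z′ ∷ [] ⟩ → c y ≡ c x
          finish z′ quad′ s∈ = trans (Quad.right quad′ y (∈₂-sub ∈₂-left (∈-weaken (v x) z∈z′) y∈)
              (λ h → y∉ (∈₁-sub (exchange z∈z′ z≢) h)))
            (trans (sym (negate (opposite-swap cab))) (sym cx))
            where
            -- The line of the second quad through b is again ⟨b, z⟩. If z were not its apex, z
            -- would have the value c b there, whereas the first quad gives it the value 0.
            z∈z′ : z ∈⟨ z′ ∷ [] ⟩
            z∈z′ = decidable-stable (z ∈⟨ z′ ∷ [] ⟩?) λ z∉z′ →
              let l , l∈ = locate z z≢
                  l∈′ = ∈₁-sub (z-from s∈ ∈₂-left) l∈
                  l∉ = λ h → z∉z′ (∈₁-sub h (∈₁-reverse l∈))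
              in cb (trans (sym (Quad.left quad′ l l∈′ l∉)) (apex l l∈))
          from-point : ∀ l → v l ∈⟨ b+z ∷ [] ⟩ → c y ≡ c x
          from-point l l∈ = from-quad (pair-quad b x x≢b cb (trans (+-congˡ cx) (opposite-swap cab)) l cl l≢b l≢x)
            where
            l∈bz : v l ∈⟨ v b ∷ z ∷ [] ⟩
            l∈bz = ∈₁-sub b+z∈ l∈
            l∉z : ¬ (v l ∈⟨ z ∷ [] ⟩)
            l∉z h = b+z∉z (∈₁-sub h (∈₁-reverse l∈))
            cl : c l ≡ c b
            cl = trans (right l l∈bz l∉z) (sym (negate cab))
            x≢b : x ≢ b
            x≢b refl = x∉ ∈₂-left
            l≢b : l ≢ b
            l≢b refl = b∉z (exchange (z∈b (∈₁-reverse l∈)) z≢)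
            l≢x : l ≢ x
            l≢x refl = x∉ l∈bz
            from-quad : RelativeQuad c b x l → c y ≡ c x
            from-quad (z′ , quad′ , l∈′) = finish z′ quad′ (∈₁-sub l∈′ (∈₁-reverse l∈))

    translation : ∀ {a b z} → c a ≢ 0# → c a + c b ≡ 0# → Quad c (v a) (v b) z (c a) → Translation z
    translation {a} {b} {z} ca cab quad x y cx y∈ y∉ = decide (values a x ca cx)
      where
      decide : c x ≡ c a ⊎ c x ≡ - c a → c y ≡ c x
      decide (inj₁ e) = FromQuad.translate ca cab quad x y e y∈ y∉
      decide (inj₂ e) = FromQuad.translate (opposite-nonzero ca cab) (opposite-swap cab)
        (subst (Quad c (v b) (v a) z) (sym (negate cab)) (Quad-swap quad)) x y (trans e (sym (negate cab))) y∈ y∉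

    -- The translations are composed one at a time, through the points obtained by leaving out the
    -- first one. As u is outside ⟨ws⟩, no intermediate step runs into the directions of
    -- translation.
    translate-span : ∀ {s} (ws : Fin s → Vect m) → (∀ l → Translation (ws l)) → ∀ x → c x ≢ 0# →
      ∀ {u} → u ∈⟨ v x ∷ ws ⟩ → ¬ (u ∈⟨ ws ⟩) → ∀ y → v y ∈⟨ u ∷ [] ⟩ → c y ≡ c x
    translate-span {zero} ws tr x cx {u} u∈ u∉ y y∈ = cong c (same-point (∈-trans (u ∷ []) (λ { zero →
      ∈-trans (v x ∷ ws) (λ { zero → ∈-head (v x ∷ []) }) u∈ }) y∈))
    translate-span {suc s} ws tr x cx {u} u∈ u∉ y y∈ = trans (tr zero l y cl y∈lw y∉w) cl≡
      where
      u∈′ : u ∈⟨ ws zero ∷ v x ∷ (ws ∘ suc) ⟩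
      u∈′ = ∈-trans (v x ∷ ws) (λ { zero → ∈-member (ws zero ∷ v x ∷ (ws ∘ suc)) (suc zero)
        ; (suc zero) → ∈-head (ws zero ∷ v x ∷ (ws ∘ suc)) ; (suc (suc l)) → ∈-member (ws zero ∷ v x ∷ (ws ∘ suc)) (suc (suc l)) }) u∈
      split : ∃ λ t → ∃ λ u′ → u′ ∈⟨ v x ∷ (ws ∘ suc) ⟩ × (∀ j → u j ≡ u′ j + t * ws zero j)
      split = ∈-uncons (ws zero ∷ v x ∷ (ws ∘ suc)) u∈′
      t = proj₁ split
      u′ = proj₁ (proj₂ split)
      eq : ∀ j → u j ≡ u′ j + t * ws zero j
      eq = proj₂ (proj₂ (proj₂ split))
      u′∉ : ¬ (u′ ∈⟨ ws ∘ suc ⟩)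
      u′∉ h = u∉ (∈-cons ws t eq h)
      located : ∃ λ l → v l ∈⟨ u′ ∷ [] ⟩
      located = locate u′ (λ h → u′∉ (∈-trans [] (λ ()) h))
      l = proj₁ located
      cl≡ : c l ≡ c x
      cl≡ = translate-span (ws ∘ suc) (tr ∘ suc) x cx (proj₁ (proj₂ (proj₂ split))) u′∉ l (proj₂ located)
      cl : c l ≢ 0#
      cl e = cx (trans (sym cl≡) e)
      y∈lw : v y ∈⟨ v l ∷ ws zero ∷ [] ⟩
      y∈lw = ∈-trans (u ∷ []) (λ { zero → ∈-resp eq (∈-shift t (∈₁-sub ∈₂-left (∈₁-reverse (proj₂ located))) ∈₂-right) }) y∈
      y∉w : ¬ (v y ∈⟨ ws zero ∷ [] ⟩)
      y∉w h = u∉ (∈-trans (v y ∷ []) (λ { zero → ∈-trans (ws zero ∷ []) (λ { zero → ∈-head ws }) h }) (∈₁-reverse y∈))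

    record Cone (a b : Fin N) : Set where
      field
        {size} : ℕ
        apexes : Fin size → Vect m
        independent : Independent (v a ∷ v b ∷ apexes)
        translations : ∀ l → Translation (apexes l)

    open Cone

    missing? : ∀ {a b} (C : Cone a b) → ∀ k → Dec (c k ≢ 0# × ¬ (v k ∈⟨ v a ∷ v b ∷ apexes C ⟩))
    missing? {a} {b} C k = supp? c k ×-dec ¬? (v k ∈⟨ v a ∷ v b ∷ apexes C ⟩?)

    -- The value at x is that of a or that of b. A quad through a and b whose corresponding line
    -- carries x supplies the new apex z; it is independent of the old ones because a, b and z span
    -- x.
    enlarge : ∀ {a b} → c a ≢ 0# → c a + c b ≡ 0# → b ≢ a → (C : Cone a b) → ∀ x → c x ≢ 0# → ¬ (v x ∈⟨ v a ∷ v b ∷ apexes C ⟩) →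
      Σ (Cone a b) λ C′ → count (missing? C′) ℕ.< count (missing? C)
    enlarge {a} {b} ca cab b≢a C x cx x∉ = decide (values a x ca cx)
      where
      B = v a ∷ v b ∷ apexes C
      x≢a : x ≢ a
      x≢a refl = x∉ (∈-head B)
      x≢b : x ≢ b
      x≢b refl = x∉ (∈-member B (suc zero))
      add : ∀ z → Translation z → (∀ {k} {D : Fin k → Vect m} → v a ∈⟨ D ⟩ → v b ∈⟨ D ⟩ → z ∈⟨ D ⟩ → v x ∈⟨ D ⟩) →
        Σ (Cone a b) λ C′ → count (missing? C′) ℕ.< count (missing? C)
      add z tr x-from = C′ , count-strict (missing? C′) (missing? C) (λ { k (ck , k∉) → ck , λ k∈ → k∉ (old k∈) }) x (cx , x∉)
        (λ h → proj₂ h (x-from (∈-head B′) (∈-member B′ (suc zero)) (∈-member B′ (suc (suc zero)))))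
        where
        B′ = v a ∷ v b ∷ z ∷ apexes C
        z∉ : ¬ (z ∈⟨ B ⟩)
        z∉ z∈ = x∉ (x-from (∈-head B) (∈-member B (suc zero)) z∈)
        ind-b : Independent (v b ∷ z ∷ apexes C)
        ind-b = swap-independent (independent-∷ (z ∷ v b ∷ apexes C) (independent-tail B (independent C)) (λ h → z∉ (∈-weaken (v a) h)))
        a∉ : ¬ (v a ∈⟨ v b ∷ z ∷ apexes C ⟩)
        a∉ h = z∉ (exchange (swap-front h) (independent-head B (independent C)))
        C′ : Cone a b
        C′ = record { apexes = z ∷ apexes C ; independent = independent-∷ B′ ind-b a∉
                    ; translations = λ { zero → tr ; (suc l) → translations C l } }
        old : ∀ {u} → u ∈⟨ B ⟩ → u ∈⟨ B′ ⟩
        old = ∈-trans B λ { zero → ∈-head B′ ; (suc zero) → ∈-member B′ (suc zero) ; (suc (suc l)) → ∈-member B′ (suc (suc (suc l))) }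
      decide : c x ≡ c a ⊎ c x ≡ - c a → Σ (Cone a b) λ C′ → count (missing? C′) ℕ.< count (missing? C)
      decide (inj₁ e) = let z , quad , x∈ = pair-quad a b b≢a ca cab x e x≢a x≢b in
        add z (translation ca cab quad) (λ a∈ b∈ z∈ → ∈₂-sub a∈ z∈ x∈)
      decide (inj₂ e) = let z , quad , x∈ = pair-quad b a (b≢a ∘ sym) (opposite-nonzero ca cab) (opposite-swap cab) x (trans e (sym (negate cab))) x≢b x≢a in
        add z (translation (opposite-nonzero ca cab) (opposite-swap cab) quad) (λ a∈ b∈ z∈ → ∈₂-sub b∈ z∈ x∈)

    complete-cone : ∀ {a b} → c a ≢ 0# → c a + c b ≡ 0# → b ≢ a → ∀ fuel (C : Cone a b) → count (missing? C) ℕ.≤ fuel →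
      Σ (Cone a b) λ C′ → ∀ k → c k ≢ 0# → v k ∈⟨ v a ∷ v b ∷ apexes C′ ⟩
    complete-cone {a} {b} ca cab b≢a fuel C le = decide fuel le (Fin.any? (missing? C))
      where
      decide : ∀ fuel → count (missing? C) ℕ.≤ fuel → Dec (∃ λ k → c k ≢ 0# × ¬ (v k ∈⟨ v a ∷ v b ∷ apexes C ⟩)) →
        Σ (Cone a b) λ C′ → ∀ k → c k ≢ 0# → v k ∈⟨ v a ∷ v b ∷ apexes C′ ⟩
      decide fuel le (no none) = C , λ k ck → decidable-stable (v k ∈⟨ v a ∷ v b ∷ apexes C ⟩?) (λ k∉ → none (k , ck , k∉))
      decide zero le (yes (k , h)) = ⊥-elim (ℕ.<⇒≱ (count-pos (missing? C) k h) le)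
      decide (suc fuel) le (yes (k , ck , k∉)) =
        let C′ , lt = enlarge ca cab b≢a C k ck k∉ in complete-cone ca cab b≢a fuel C′ (ℕ.≤-pred (ℕ.≤-trans lt le))

    module Completed {a b : Fin N} (ca : c a ≢ 0#) (cab : c a + c b ≡ 0#) (C : Cone a b)
      (complete : ∀ k → c k ≢ 0# → v k ∈⟨ v a ∷ v b ∷ apexes C ⟩) where
      private
        ws = apexes C
        cb = opposite-nonzero ca cab

      b∉ : ¬ (v b ∈⟨ ws ⟩)
      b∉ = independent-head (v b ∷ ws) (independent-tail (v a ∷ v b ∷ ws) (independent C))
      a∉ : ¬ (v a ∈⟨ ws ⟩)
      a∉ h = independent-head (v a ∷ v b ∷ ws) (independent C) (∈-weaken (v b) h)

      side : ∀ x → c x ≢ 0# → ∀ y → v y ∈⟨ v x ∷ ws ⟩ → ¬ (v y ∈⟨ ws ⟩) → c y ≡ c x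
      side x cx y y∈ y∉ = translate-span ws (translations C) x cx y∈ y∉ y (∈-head (v y ∷ []))

      -- A support point y in ⟨ws⟩ would put a third support point x + y on the secant through x and y.
      no-opposite : ∀ x y → c x ≢ 0# → ¬ (v x ∈⟨ ws ⟩) → v y ∈⟨ ws ⟩ → c x + c y ≢ 0#
      no-opposite x y cx x∉ y∈ cxy = let l , l∈ = locate u u≢ in third l l∈
        where
        u : Vect m
        u j = v x j + 1# * v y j
        y≢x : y ≢ x
        y≢x refl = x∉ y∈
        x-from : ∀ {k} {B : Fin k → Vect m} → u ∈⟨ B ⟩ → v y ∈⟨ B ⟩ → v x ∈⟨ B ⟩
        x-from u∈ y∈ = ∈-resp (λ j → solve 2 (λ b z → b := (b :+ con (ℤ.+ 1) :* z) :+ :- con (ℤ.+ 1) :* z) refl (v x j) (v y j)) (∈-shift (- 1#) u∈ y∈)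
        y-from : ∀ {k} {B : Fin k → Vect m} → u ∈⟨ B ⟩ → v x ∈⟨ B ⟩ → v y ∈⟨ B ⟩
        y-from u∈ x∈ = ∈-resp (λ j → solve 2 (λ b z → z := (b :+ con (ℤ.+ 1) :* z) :+ :- con (ℤ.+ 1) :* b) refl (v x j) (v y j)) (∈-shift (- 1#) u∈ x∈)
        u∉ : ¬ (u ∈⟨ ws ⟩)
        u∉ h = x∉ (x-from h y∈)
        u≢ : ¬ (u ∈⟨ [] ⟩)
        u≢ h = u∉ (∈-trans [] (λ ()) h)
        third : ∀ l → v l ∈⟨ u ∷ [] ⟩ → ⊥
        third l l∈ = [ (λ { refl → y≢x (same-point (y-from (∈₁-reverse l∈) (∈-head (v x ∷ [])))) })
                     , (λ { refl → y≢x (sym (same-point (x-from (∈₁-reverse l∈) (∈-head (v y ∷ []))))) }) ]′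
          (only-two x y y≢x cx cxy l
            (λ e → cx (trans (sym (translate-span ws (translations C) x cx (∈-shift 1# (∈-head (v x ∷ ws)) (∈-weaken (v x) y∈)) u∉ l l∈)) e))
            (∈₁-sub (∈-shift 1# ∈₂-left ∈₂-right) l∈))

      apex : ∀ y → v y ∈⟨ ws ⟩ → c y ≡ 0#
      apex y y∈ = decidable-stable (c y ≟ 0#) λ cy →
        [ (λ e → no-opposite b y cb b∉ y∈ (trans (+-congˡ e) (opposite-swap cab)))
        , (λ e → no-opposite a y ca a∉ y∈ (trans (+-congˡ e) (-‿inverseʳ (c a)))) ]′ (values a y ca cy)

      -- Modulo ⟨ws⟩ a support point y becomes a point e of the line through a and b. Translation
      -- gives e the value of y, so e is a support point, and by `only-two` it is a or b.
      two-sides : b ≢ a → ∀ y → c y ≢ 0# → v y ∈⟨ v a ∷ ws ⟩ ⊎ v y ∈⟨ v b ∷ ws ⟩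
      two-sides b≢a y cy =
        let s , u , u∈ , eq = ∈-uncons (v a ∷ v b ∷ ws) (complete y cy)
            t , u′ , u′∈ , eq′ = ∈-uncons (v b ∷ ws) u∈
        in from-coordinates s t u′ u′∈ (λ j → trans (eq j) (+-congʳ (eq′ j)))
        where
        from-coordinates : ∀ s t u′ → u′ ∈⟨ ws ⟩ → (∀ j → v y j ≡ u′ j + t * v b j + s * v a j) → v y ∈⟨ v a ∷ ws ⟩ ⊎ v y ∈⟨ v b ∷ ws ⟩
        from-coordinates s t u′ u′∈ eq = let l , l∈ = locate e (λ h → e∉ (∈-trans [] (λ ()) h)) in from-secant l l∈
          where
          e : Vect m
          e j = v y j + - 1# * u′ j
          y-from : ∀ {k} {B : Fin k → Vect m} → e ∈⟨ B ⟩ → u′ ∈⟨ B ⟩ → v y ∈⟨ B ⟩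
          y-from e∈ u∈ = ∈-resp (λ j → solve 2 (λ y u → y := (y :+ :- con (ℤ.+ 1) :* u) :+ con (ℤ.+ 1) :* u) refl (v y j) (u′ j)) (∈-shift 1# e∈ u∈)
          e∉ : ¬ (e ∈⟨ ws ⟩)
          e∉ h = cy (apex y (y-from h u′∈))
          e∈ : e ∈⟨ v a ∷ v b ∷ [] ⟩
          e∈ = ∈₂-intro s t (λ j → trans (cong (_+ - 1# * u′ j) (eq j))
            (solve 5 (λ u t b s a → u :+ t :* b :+ s :* a :+ :- con (ℤ.+ 1) :* u := s :* a :+ t :* b) refl (u′ j) t (v b j) s (v a j)))
          on-side : ∀ {x l} → l ≡ x → v l ∈⟨ e ∷ [] ⟩ → v y ∈⟨ v x ∷ ws ⟩
          on-side {x} refl l∈ = y-from (∈₁-sub (∈-head (v x ∷ ws)) (∈₁-reverse l∈)) (∈-weaken (v x) u′∈)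
          from-secant : ∀ l → v l ∈⟨ e ∷ [] ⟩ → v y ∈⟨ v a ∷ ws ⟩ ⊎ v y ∈⟨ v b ∷ ws ⟩
          from-secant l l∈ = [ (λ l≡ → inj₁ (on-side l≡ l∈)) , (λ l≡ → inj₂ (on-side l≡ l∈)) ]′
            (only-two a b b≢a ca cab l
              (λ e0 → cy (trans (sym (translate-span ws (translations C) y cy (∈-shift (- 1#) (∈-head (v y ∷ ws)) (∈-weaken (v y) u′∈)) e∉ l l∈)) e0))
              (∈₁-sub e∈ l∈))

  record Shape (c : Word) : Set where
    field
      {a b}  : Fin N
      {size} : ℕ
      apexes : Fin size → Vect m
      independent : Independent (v a ∷ v b ∷ apexes)
      suppₐ  : c a ≢ 0#
      left   : ∀ y → v y ∈⟨ v a ∷ apexes ⟩ → ¬ (v y ∈⟨ apexes ⟩) → c y ≡ c a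
      right  : ∀ y → v y ∈⟨ v b ∷ apexes ⟩ → ¬ (v y ∈⟨ apexes ⟩) → c y ≡ - c a
      apex   : ∀ y → v y ∈⟨ apexes ⟩ → c y ≡ 0#
      support : ∀ y → c y ≢ 0# → v y ∈⟨ v a ∷ apexes ⟩ ⊎ v y ∈⟨ v b ∷ apexes ⟩

  shape : ∀ r → Dual r c → weight c ≡ 2 ℕ.* p ℕ.^ r → Shape c
  shape {c} r dual w =
    let a , ca = count-find (supp? c) (ℕ.≤-trans (ℕ.*-mono-≤ (s≤s (z≤n {1})) (p^r>0 r)) (ℕ.≤-reflexive (sym w)))
        b , b≢a , cb , cab , _ = secant-through {r} {c} dual a ca (ℕ.≤-reflexive w)
    in from-points a b ca b≢a cab
    where
    open Minimal r c dual w
    from-points : ∀ a b → c a ≢ 0# → b ≢ a → c a + c b ≡ 0# → Shape c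
    from-points a b ca b≢a cab =
      let C , complete = complete-cone ca cab b≢a (count (missing? initial)) initial ℕ.≤-refl in from-cone C complete
      where
      initial : Cone a b
      initial = record { apexes = [] ; independent = independent-pair (λ h → b≢a (sym (same-point h))) (point∉[] b) ; translations = λ () }
      from-cone : (C : Cone a b) → (∀ k → c k ≢ 0# → v k ∈⟨ v a ∷ v b ∷ Cone.apexes C ⟩) → Shape c
      from-cone C complete = record
        { apexes = Cone.apexes C ; independent = Cone.independent C ; suppₐ = ca
        ; left = side a ca
        ; right = λ y y∈ y∉ → trans (side b (opposite-nonzero ca cab) y y∈ y∉) (negate cab)
        ; apex = apex ; support = two-sides b≢a }
        where open Completed ca cab C complete

  -- Counting points of subspaces

  add-multiple : Vect m → F → Vect m → Vect m
  add-multiple u t w j = u j + t * w j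

  subtract-multiple : ∀ {k} {B : Fin k → Vect m} {u w t} → add-multiple u t w ∈⟨ B ⟩ → w ∈⟨ B ⟩ → u ∈⟨ B ⟩
  subtract-multiple {t = t} s∈ w∈ = ∈-resp (λ j → solve 3 (λ u t w → u := (u :+ t :* w) :+ :- t :* w) refl _ t _) (∈-shift (- t) s∈ w∈)

  -- Apart from b₁, the hyperplanes of ⟨B⟩ through the codimension-two space U form a pencil parametrised by t.
  module Pencil (B : Fin (suc (suc s)) → Vect m) (indB : Independent B) where
    b₁ b₂ : Vect m
    b₁ = B zero
    b₂ = B (suc zero)
    U : Fin s → Vect m
    U l = B (suc (suc l))

    member : F → Fin (suc s) → Vect m
    member t = add-multiple b₂ t b₁ ∷ U

    b₂∉U : ¬ (b₂ ∈⟨ U ⟩)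
    b₂∉U = independent-head (B ∘ suc) (independent-tail B indB)
    independent-U : Independent U
    independent-U = independent-tail (B ∘ suc) (independent-tail B indB)
    b₁∉ : ¬ (b₁ ∈⟨ B ∘ suc ⟩)
    b₁∉ = independent-head B indB
    b₁∉U : ¬ (b₁ ∈⟨ U ⟩)
    b₁∉U h = b₁∉ (∈-tail (B ∘ suc) h)
    b₂∉ : ¬ (b₂ ∈⟨ b₁ ∷ U ⟩)
    b₂∉ h = b₁∉ (∈-trans (b₂ ∷ U) (λ { zero → ∈-head (B ∘ suc) ; (suc l) → ∈-member (B ∘ suc) (suc l) }) (exchange h b₂∉U))

    independent-first : Independent (b₁ ∷ U)
    independent-first = independent-∷ (b₁ ∷ U) independent-U b₁∉U

    member∉ : ∀ t → ¬ (add-multiple b₂ t b₁ ∈⟨ b₁ ∷ U ⟩)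
    member∉ t h = b₂∉ (subtract-multiple h (∈-head (b₁ ∷ U)))

    independent-member : ∀ t → Independent (member t)
    independent-member t = independent-∷ (member t) independent-U (λ h → member∉ t (∈-weaken b₁ h))

    first⊂ : ∀ {x} → x ∈⟨ b₁ ∷ U ⟩ → x ∈⟨ B ⟩
    first⊂ = ∈-trans (b₁ ∷ U) λ { zero → ∈-head B ; (suc l) → ∈-member B (suc (suc l)) }

    member⊂ : ∀ t {x} → x ∈⟨ member t ⟩ → x ∈⟨ B ⟩
    member⊂ t = ∈-trans (member t) λ { zero → ∈-shift t (∈-member B (suc zero)) (∈-head B) ; (suc l) → ∈-member B (suc (suc l)) }

    first∩member : ∀ t {x} → x ∈⟨ b₁ ∷ U ⟩ → x ∈⟨ member t ⟩ → x ∈⟨ U ⟩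
    first∩member t {x} x∈ x∈′ = decidable-stable (x ∈⟨ U ⟩?) λ x∉ →
      member∉ t (∈-trans (x ∷ U) (λ { zero → x∈ ; (suc l) → ∈-weaken b₁ (∈-member U l) }) (exchange x∈′ x∉))

    some-member : ∀ {x} → x ∈⟨ B ⟩ → ¬ (x ∈⟨ b₁ ∷ U ⟩) → ∃ λ t → x ∈⟨ member t ⟩
    some-member {x} x∈ x∉ =
      let r₁ , y , y∈ , eq = ∈-uncons B x∈
          r₂ , u , u∈ , eq′ = ∈-uncons (B ∘ suc) y∈
      in from-coordinates r₁ r₂ u u∈ (λ j → trans (eq j) (+-congʳ (eq′ j))) (r₂ ≟ 0#)
      where
      from-coordinates : ∀ r₁ r₂ u → u ∈⟨ U ⟩ → (∀ j → x j ≡ u j + r₂ * b₂ j + r₁ * b₁ j) → Dec (r₂ ≡ 0#) → ∃ λ t → x ∈⟨ member t ⟩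
      from-coordinates r₁ r₂ u u∈ eq (yes refl) = ⊥-elim (x∉ (∈-cons (b₁ ∷ U) r₁
        (λ j → trans (eq j) (+-congʳ (trans (+-congˡ (zeroˡ _)) (+-identityʳ _)))) u∈))
      from-coordinates r₁ r₂ u u∈ eq (no r₂≢0) = let i , e = inverse r₂ r₂≢0 in i * r₁ , ∈-cons (member (i * r₁)) r₂ (λ j → begin
        x j                                    ≡⟨ eq j ⟩
        u j + r₂ * b₂ j + r₁ * b₁ j            ≡⟨ +-congˡ (*-congʳ (sym (*-identityˡ r₁))) ⟩
        u j + r₂ * b₂ j + 1# * r₁ * b₁ j       ≡⟨ +-congˡ (*-congʳ (*-congʳ (sym e))) ⟩
        u j + r₂ * b₂ j + r₂ * i * r₁ * b₁ j   ≡⟨ solve 6 (λ u r b i q a → u :+ r :* b :+ r :* i :* q :* a := u :+ r :* (b :+ i :* q :* a)) refl (u j) r₂ (b₂ j) i r₁ (b₁ j) ⟩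
        u j + r₂ * (b₂ j + i * r₁ * b₁ j)      ∎) u∈
        where open ≡-Reasoning

    unique-member : ∀ {x} → ¬ (x ∈⟨ U ⟩) → ∀ {t t′} → x ∈⟨ member t ⟩ → x ∈⟨ member t′ ⟩ → t ≡ t′
    unique-member {x} x∉ {t} {t′} x∈ x∈′ = decidable-stable (t ≟ t′) λ t≢t′ →
      let w∈ = ∈-trans (x ∷ U) (λ { zero → x∈′ ; (suc l) → ∈-tail (member t′) (∈-member U l) }) (exchange x∈ x∉)
          d , e = inverse (t + - t′) (difference≢0 t≢t′)
          b₁∈ = ∈-scale d (λ j → begin
            b₁ j                                                    ≡⟨ sym (*-identityˡ _) ⟩
            1# * b₁ j                                               ≡⟨ *-congʳ (sym e) ⟩
            (t + - t′) * d * b₁ j                                   ≡⟨ solve 5 (λ t t′ d b a → (t :- t′) :* d :* a := d :* ((b :+ t :* a) :+ :- con (ℤ.+ 1) :* (b :+ t′ :* a))) refl t t′ d (b₂ j) (b₁ j) ⟩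
            d * (b₂ j + t * b₁ j + - 1# * (b₂ j + t′ * b₁ j))       ∎)
            (∈-shift (- 1#) w∈ (∈-head (member t′)))
      in b₁∉U (first∩member t′ (∈-head (b₁ ∷ U)) b₁∈)
      where open ≡-Reasoning

    -- Each point of ⟨U⟩ is on all p + 1 hyperplanes of the pencil, and each other point of ⟨B⟩ on
    -- exactly one. The surplus stands on the left, which avoids subtraction.
    pencil : ∀ x → ind (x ∈⟨ B ⟩?) ℕ.+ p ℕ.* ind (x ∈⟨ U ⟩?) ≡ ind (x ∈⟨ b₁ ∷ U ⟩?) ℕ.+ Counting.sum (λ t → ind (x ∈⟨ member t ⟩?))
    pencil x = cases (x ∈⟨ B ⟩?) (x ∈⟨ U ⟩?) (x ∈⟨ b₁ ∷ U ⟩?)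
      where
      cases : (dB : Dec (x ∈⟨ B ⟩)) (dU : Dec (x ∈⟨ U ⟩)) (d₁ : Dec (x ∈⟨ b₁ ∷ U ⟩)) →
        ind dB ℕ.+ p ℕ.* ind dU ≡ ind d₁ ℕ.+ Counting.sum (λ t → ind (x ∈⟨ member t ⟩?))
      cases (no ∉B) (yes ∈U) _ = ⊥-elim (∉B (first⊂ (∈-weaken b₁ ∈U)))
      cases (no ∉B) (no _) (yes ∈₁) = ⊥-elim (∉B (first⊂ ∈₁))
      cases (yes _) (yes ∈U) (no ∉₁) = ⊥-elim (∉₁ (∈-weaken b₁ ∈U))
      cases (no ∉B) (no _) (no _) = trans (ℕ.*-zeroʳ p) (sym (Counting.sum-zero (λ t → ind-no (x ∈⟨ member t ⟩?) (∉B ∘ member⊂ t))))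
      cases (yes _) (yes ∈U) (yes _) = cong suc (trans (ℕ.*-identityʳ p) (sym (count-all (λ t → x ∈⟨ member t ⟩?) (λ t → ∈-tail (member t) ∈U))))
      cases (yes _) (no ∉U) (yes ∈₁) = cong suc (trans (ℕ.*-zeroʳ p) (sym (Counting.sum-zero (λ t → ind-no (x ∈⟨ member t ⟩?) (λ h → ∉U (first∩member t ∈₁ h))))))
      cases (yes ∈B) (no ∉U) (no ∉₁) = trans (cong suc (ℕ.*-zeroʳ p)) (let t , h = some-member ∈B ∉₁ in
        sym (count-single (λ t → x ∈⟨ member t ⟩?) t h (λ t′ h′ → unique-member ∉U h′ h)))

  spanCount : (Fin s → Vect m) → ℕ
  spanCount B = count (λ i → v i ∈⟨ B ⟩?)

  -- 1 + p + ... + p^(s-1), the number of points in a space of vector dimension s.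
  pointCount : ℕ → ℕ
  pointCount zero    = 0
  pointCount (suc s) = pointCount s ℕ.+ p ℕ.^ s

  single-count : (B : Fin 1 → Vect m) → Independent B → ∃ λ i → v i ∈⟨ B ⟩ × (∀ j → v j ∈⟨ B ⟩ → j ≡ i)
  single-count B ind =
    let i , i∈ = locate (B zero) (λ h → independent-head B ind (∈-trans [] (λ ()) h))
    in i , ∈-trans (B zero ∷ []) (λ { zero → ∈-head B }) i∈ ,
       λ j j∈ → same-line (∈-trans B (λ { zero → ∈-head (B zero ∷ []) }) j∈) i∈

  spanCount-pencil : (B : Fin (suc (suc s)) → Vect m) (ind : Independent B) → let open Pencil B ind in
    spanCount B ℕ.+ p ℕ.* spanCount U ≡ spanCount (b₁ ∷ U) ℕ.+ Counting.sum (λ t → spanCount (member t))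
  spanCount-pencil B ind = begin
    spanCount B ℕ.+ p ℕ.* spanCount U
      ≡⟨ cong (spanCount B ℕ.+_) (Counting.sum-*ˡ p _) ⟩
    spanCount B ℕ.+ Counting.sum (λ i → p ℕ.* Counting.ind (v i ∈⟨ U ⟩?))
      ≡⟨ sym (Counting.sum-+ _ _) ⟩
    Counting.sum (λ i → Counting.ind (v i ∈⟨ B ⟩?) ℕ.+ p ℕ.* Counting.ind (v i ∈⟨ U ⟩?))
      ≡⟨ Counting.sum-cong (λ i → pencil (v i)) ⟩
    Counting.sum (λ i → Counting.ind (v i ∈⟨ b₁ ∷ U ⟩?) ℕ.+ Counting.sum (λ t → Counting.ind (v i ∈⟨ member t ⟩?)))
      ≡⟨ Counting.sum-+ _ _ ⟩
    spanCount (b₁ ∷ U) ℕ.+ Counting.sum (λ i → Counting.sum (λ t → Counting.ind (v i ∈⟨ member t ⟩?)))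
      ≡⟨ cong (spanCount (b₁ ∷ U) ℕ.+_) (Counting.sum-comm (λ i t → Counting.ind (v i ∈⟨ member t ⟩?))) ⟩
    spanCount (b₁ ∷ U) ℕ.+ Counting.sum (λ t → spanCount (member t)) ∎
    where
    open Pencil B ind
    open ≡-Reasoning

  spanCount-independent : ∀ s (B : Fin s → Vect m) → Independent B → spanCount B ≡ pointCount s
  spanCount-independent zero B ind = count-zero (λ i → v i ∈⟨ B ⟩?) (λ i h → point∉[] i (∈-trans B (λ ()) h))
  spanCount-independent (suc zero) B ind = let i , i∈ , uniq = single-count B ind in count-single (λ i → v i ∈⟨ B ⟩?) i i∈ uniq
  spanCount-independent (suc (suc s)) B ind = ℕ.+-cancelʳ-≡ (p ℕ.* pointCount s) _ _ (begin
    spanCount B ℕ.+ p ℕ.* pointCount s   ≡⟨ cong (λ x → spanCount B ℕ.+ p ℕ.* x) (sym (spanCount-independent s U independent-U)) ⟩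
    spanCount B ℕ.+ p ℕ.* spanCount U    ≡⟨ spanCount-pencil B ind ⟩
    spanCount (b₁ ∷ U) ℕ.+ Counting.sum (λ t → spanCount (member t))
      ≡⟨ cong₂ ℕ._+_ (spanCount-independent (suc s) (b₁ ∷ U) independent-first)
           (trans (Counting.sum-cong (λ t → spanCount-independent (suc s) (member t) (independent-member t))) (sum-const p _)) ⟩
    pointCount (suc s) ℕ.+ p ℕ.* (pointCount s ℕ.+ p ℕ.^ s)
      ≡⟨ +-*-Solver.solve 4 (λ n p c q → n +-*-Solver.:+ p +-*-Solver.:* (c +-*-Solver.:+ q) +-*-Solver.:= n +-*-Solver.:+ p +-*-Solver.:* q +-*-Solver.:+ p +-*-Solver.:* c) refl (pointCount (suc s)) p (pointCount s) (p ℕ.^ s) ⟩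
    pointCount (suc (suc s)) ℕ.+ p ℕ.* pointCount s ∎)
    where
    open Pencil B ind
    open ≡-Reasoning

  difference-count : (D : Fin s → Vect m) (S : Fin (suc s) → Vect m) → Independent D → Independent S → (∀ {x} → x ∈⟨ D ⟩ → x ∈⟨ S ⟩) →
    count (λ i → (v i ∈⟨ S ⟩?) ×-dec ¬? (v i ∈⟨ D ⟩?)) ≡ p ℕ.^ s
  difference-count {s} D S indD indS sub = ℕ.+-cancelˡ-≡ (pointCount s) _ _ (begin
    pointCount s ℕ.+ count (λ i → (v i ∈⟨ S ⟩?) ×-dec ¬? (v i ∈⟨ D ⟩?))
      ≡⟨ cong (ℕ._+ count (λ i → (v i ∈⟨ S ⟩?) ×-dec ¬? (v i ∈⟨ D ⟩?))) (trans (sym (spanCount-independent s D indD))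
           (count-cong (λ i → v i ∈⟨ D ⟩?) (λ i → (v i ∈⟨ S ⟩?) ×-dec (v i ∈⟨ D ⟩?)) (λ i h → sub h , h) (λ i → proj₂))) ⟩
    count (λ i → (v i ∈⟨ S ⟩?) ×-dec (v i ∈⟨ D ⟩?)) ℕ.+ count (λ i → (v i ∈⟨ S ⟩?) ×-dec ¬? (v i ∈⟨ D ⟩?))
      ≡⟨ sym (count-split (λ i → v i ∈⟨ S ⟩?) (λ i → v i ∈⟨ D ⟩?)) ⟩
    spanCount S ≡⟨ spanCount-independent (suc s) S indS ⟩
    pointCount s ℕ.+ p ℕ.^ s ∎)
    where open ≡-Reasoning

  mask : (Fin s → Vect m) → Word → Word
  mask B g i = keep (v i ∈⟨ B ⟩?) (g i)

  spanSum : (Fin s → Vect m) → Word → F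
  spanSum B g = sum (mask B g)

  open ZSolver K using (cast-+; cast-*)

  cast-sum : ∀ {n} (f : Fin n → ℕ) → cast (Counting.sum f) ≡ sum (λ i → cast (f i))
  cast-sum {zero}  f = trans (cong cast (Counting.sum-empty f)) (sym (sum-empty _))
  cast-sum {suc n} f = trans (cong cast (Counting.sum-suc f)) (trans (cast-+ (f zero) _)
    (trans (+-congˡ (cast-sum (f ∘ suc))) (sym (sum-suc _))))

  keep-ind : {A : Set} (d : Dec A) → ∀ a → keep d a ≡ cast (ind d) * a
  keep-ind (yes _) a = sym (trans (*-congʳ (+-identityʳ 1#)) (*-identityˡ a))
  keep-ind (no _)  a = sym (zeroˡ a)

  -- The count of `pencil` read in the field, where the p-fold surplus on ⟨U⟩ disappears.
  spanSum-pencil : ∀ g (B : Fin (suc (suc s)) → Vect m) (ind : Independent B) → let open Pencil B ind in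
    spanSum B g ≡ spanSum (b₁ ∷ U) g + sum (λ t → spanSum (member t) g)
  spanSum-pencil g B ind = begin
    spanSum B g
      ≡⟨ sum-cong (λ i → pointwise (v i) (g i)) ⟩
    sum (λ i → keep (v i ∈⟨ b₁ ∷ U ⟩?) (g i) + sum (λ t → keep (v i ∈⟨ member t ⟩?) (g i)))
      ≡⟨ sum-+ _ _ ⟩
    spanSum (b₁ ∷ U) g + sum (λ i → sum (λ t → keep (v i ∈⟨ member t ⟩?) (g i)))
      ≡⟨ +-congˡ (sum-comm (λ i t → keep (v i ∈⟨ member t ⟩?) (g i))) ⟩
    spanSum (b₁ ∷ U) g + sum (λ t → spanSum (member t) g) ∎
    where
    open Pencil B ind
    open ≡-Reasoning
    module ℕΣ = Counting
    pointwise : ∀ x a → keep (x ∈⟨ B ⟩?) a ≡ keep (x ∈⟨ b₁ ∷ U ⟩?) a + sum (λ t → keep (x ∈⟨ member t ⟩?) a)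
    pointwise x a = begin
      keep (x ∈⟨ B ⟩?) a                                                ≡⟨ keep-ind (x ∈⟨ B ⟩?) a ⟩
      cast (ℕΣ.ind (x ∈⟨ B ⟩?)) * a                                      ≡⟨ *-congʳ (sym (+-identityʳ _)) ⟩
      (cast (ℕΣ.ind (x ∈⟨ B ⟩?)) + 0#) * a                               ≡⟨ *-congʳ (+-congˡ (sym (trans (cast-* p _) (trans (*-congʳ characteristic) (zeroˡ _))))) ⟩
      (cast (ℕΣ.ind (x ∈⟨ B ⟩?)) + cast (p ℕ.* ℕΣ.ind (x ∈⟨ U ⟩?))) * a   ≡⟨ *-congʳ (sym (cast-+ (ℕΣ.ind (x ∈⟨ B ⟩?)) _)) ⟩
      cast (ℕΣ.ind (x ∈⟨ B ⟩?) ℕ.+ p ℕ.* ℕΣ.ind (x ∈⟨ U ⟩?)) * a          ≡⟨ *-congʳ (cong cast (pencil x)) ⟩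
      cast (ℕΣ.ind (x ∈⟨ b₁ ∷ U ⟩?) ℕ.+ ℕΣ.sum (λ t → ℕΣ.ind (x ∈⟨ member t ⟩?))) * a ≡⟨ *-congʳ (cast-+ (ℕΣ.ind (x ∈⟨ b₁ ∷ U ⟩?)) _) ⟩
      (cast (ℕΣ.ind (x ∈⟨ b₁ ∷ U ⟩?)) + cast (ℕΣ.sum (λ t → ℕΣ.ind (x ∈⟨ member t ⟩?)))) * a ≡⟨ *-congʳ (+-congˡ (cast-sum _)) ⟩
      (cast (ℕΣ.ind (x ∈⟨ b₁ ∷ U ⟩?)) + sum (λ t → cast (ℕΣ.ind (x ∈⟨ member t ⟩?)))) * a ≡⟨ distribʳ _ _ _ ⟩
      cast (ℕΣ.ind (x ∈⟨ b₁ ∷ U ⟩?)) * a + sum (λ t → cast (ℕΣ.ind (x ∈⟨ member t ⟩?))) * a ≡⟨ +-congˡ (sum-*ʳ a _) ⟩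
      cast (ℕΣ.ind (x ∈⟨ b₁ ∷ U ⟩?)) * a + sum (λ t → cast (ℕΣ.ind (x ∈⟨ member t ⟩?)) * a)
        ≡⟨ cong₂ _+_ (sym (keep-ind (x ∈⟨ b₁ ∷ U ⟩?) a)) (sum-cong (λ t → sym (keep-ind (x ∈⟨ member t ⟩?) a))) ⟩
      keep (x ∈⟨ b₁ ∷ U ⟩?) a + sum (λ t → keep (x ∈⟨ member t ⟩?) a) ∎

  sum-constant : ∀ n a → sum {n} (λ _ → a) ≡ cast n * a
  sum-constant zero    a = trans (sum-empty _) (sym (zeroˡ a))
  sum-constant (suc n) a = trans (sum-suc _) (trans (cong₂ _+_ (sym (*-identityˡ a)) (sum-constant n a)) (sym (distribʳ a 1# (cast n))))

  -- The pencil has p + 1 members, each with sum a, and p + 1 is 1 in the field.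
  spanSum-step : ∀ g a s → (∀ (B : Fin (suc s) → Vect m) → Independent B → spanSum B g ≡ a) →
    ∀ (B : Fin (suc (suc s)) → Vect m) → Independent B → spanSum B g ≡ a
  spanSum-step g a s smaller B ind = begin
    spanSum B g                                              ≡⟨ spanSum-pencil g B ind ⟩
    spanSum (b₁ ∷ U) g + sum (λ t → spanSum (member t) g)    ≡⟨ cong₂ _+_ (smaller (b₁ ∷ U) independent-first) (sum-cong (λ t → smaller (member t) (independent-member t))) ⟩
    a + sum (λ (_ : F) → a)                                  ≡⟨ +-congˡ (trans (sum-constant p a) (trans (*-congʳ characteristic) (zeroˡ a))) ⟩
    a + 0#                                                   ≡⟨ +-identityʳ a ⟩
    a                                                        ∎
    where
    open Pencil B ind
    open ≡-Reasoning

  spanSum-constant : ∀ g a d → (∀ (B : Fin (suc d) → Vect m) → Independent B → spanSum B g ≡ a) →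
    ∀ s → suc d ℕ.≤ s → ∀ (B : Fin s → Vect m) → Independent B → spanSum B g ≡ a
  spanSum-constant g a d base s d<s = subst (λ s → ∀ (B : Fin s → Vect m) → Independent B → spanSum B g ≡ a)
    (trans (cong suc (ℕ.+-comm (s ℕ.∸ suc d) d)) (ℕ.m+[n∸m]≡n d<s)) (above (s ℕ.∸ suc d))
    where
    above : ∀ e (B : Fin (suc (e ℕ.+ d)) → Vect m) → Independent B → spanSum B g ≡ a
    above zero    = base
    above (suc e) = spanSum-step g a (e ℕ.+ d) (above e)

  spanSum-one : ∀ s → 1 ℕ.≤ s → ∀ (B : Fin s → Vect m) → Independent B → spanSum B (λ _ → 1#) ≡ 1#
  spanSum-one = spanSum-constant (λ _ → 1#) 1# 0 λ B ind → let i , i∈ , uniq = single-count B ind in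
    trans (sum-single i (λ j j≢i → keep-no (v j ∈⟨ B ⟩?) (j≢i ∘ uniq j))) (keep-yes (v i ∈⟨ B ⟩?) i∈)

  -- Every form costs at most one dimension, so after r of them at least d + 1 are left, where the
  -- sum is zero by `spanSum-constant`.
  mask-dual : ∀ {c d} → (∀ (B : Fin (suc d) → Vect m) → Independent B → spanSum B c ≡ 0#) →
    ∀ r {s} → suc d ℕ.+ r ℕ.≤ s → (E : Fin s → Vect m) → Independent E → Dual r (mask E c)
  mask-dual {c} {d} zero-on zero {s} le E ind = spanSum-constant c 0# d zero-on s (ℕ.≤-trans (ℕ.≤-reflexive (sym (ℕ.+-identityʳ _))) le) E ind
  mask-dual {c} {d} zero-on (suc r) {s} le E ind f = Dual-cong r (λ i → same i (v i ∈⟨ basis ⟩?) (f · v i ≟ 0#) (v i ∈⟨ E ⟩?))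
    (mask-dual zero-on r (ℕ.≤-pred (ℕ.≤-trans (ℕ.≤-reflexive (sym (ℕ.+-suc (suc d) r))) (ℕ.≤-trans le bound))) basis independent)
    where
    open Kernel (kernel E ind f)
    same : ∀ i (dk : Dec (v i ∈⟨ basis ⟩)) (df : Dec (f · v i ≡ 0#)) (dE : Dec (v i ∈⟨ E ⟩)) → keep dk (c i) ≡ keep df (keep dE (c i))
    same i (yes k) (yes f) (yes E) = refl
    same i (yes k) (yes f) (no ∉E) = ⊥-elim (∉E (proj₁ (sound k)))
    same i (yes k) (no ≢0) _ = ⊥-elim (≢0 (proj₂ (sound k)))
    same i (no ∉k) (yes f) (yes E) = ⊥-elim (∉k (complete E f))
    same i (no ∉k) (yes f) (no _) = refl
    same i (no ∉k) (no _) _ = refl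

  unit : Fin m → Vect m
  unit i j = keep (i ≟ j) 1#

  comb-unit : ∀ a j → comb a unit j ≡ a j
  comb-unit a j = trans (sum-single j (λ i i≢j → trans (*-congˡ (keep-no (i ≟ j) i≢j)) (zeroʳ _)))
    (trans (*-congˡ (keep-yes (j ≟ j) refl)) (*-identityʳ _))

  unit-independent : Independent unit
  unit-independent a eq i = trans (sym (comb-unit a i)) (eq i)

  dual-from-subspaces : ∀ {c d} → (∀ (B : Fin (suc d) → Vect m) → Independent B → spanSum B c ≡ 0#) →
    ∀ r → suc d ℕ.+ r ℕ.≤ m → Dual r c
  dual-from-subspaces {c} zero-on r le = Dual-cong r (λ i → keep-yes (v i ∈⟨ unit ⟩?) (v i , λ j → sym (comb-unit (v i) j)))
    (mask-dual zero-on r le unit unit-independent)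

  kernels : ∀ {q} (fs : Fin q → Form m) {s} (E : Fin s → Vect m) → Independent E →
    ∃ λ e → Σ (Fin e → Vect m) λ E′ → Independent E′ × s ℕ.≤ q ℕ.+ e × (∀ {x} → x ∈⟨ E′ ⟩ → x ∈⟨ E ⟩ × Kills fs x) × (∀ {x} → x ∈⟨ E ⟩ → Kills fs x → x ∈⟨ E′ ⟩)
  kernels {zero} fs {s} E ind = s , E , ind , ℕ.≤-refl , (λ x∈ → x∈ , λ ()) , λ x∈ _ → x∈
  kernels {suc q} fs E ind =
    let open Kernel (kernel E ind (fs zero))
        e , E′ , ind′ , le , sound′ , complete′ = kernels (fs ∘ suc) basis independent
    in e , E′ , ind′ , ℕ.≤-trans bound (s≤s le) ,
       (λ x∈ → let x∈k , kx = sound′ x∈ ; x∈E , k₀ = sound x∈k in x∈E , λ { zero → k₀ ; (suc l) → kx l }) ,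
       (λ x∈ kx → complete′ (complete x∈ (kx zero)) (kx ∘ suc))

  -- The intersection of the two subspaces is nonempty, so its number of points is 1 modulo p.
  intersection-sum : ∀ {s k} (S : Fin s → Vect m) (T : Fin k → Vect m) → Independent S → Independent T → m ℕ.< s ℕ.+ k →
    sum (λ i → keep (v i ∈⟨ S ⟩?) 1# * keep (v i ∈⟨ T ⟩?) 1#) ≡ 1#
  intersection-sum {s} {k} S T indS indT m< =
    let e , E , indE , le , sound , complete = kernels forms S indS
    in trans (sum-cong (λ i → same i (λ h → let i∈S , kills = sound h in i∈S , Annihilator.complete A (v i) kills) (λ i∈S i∈T → complete i∈S (kills-span A i∈T))
                              (v i ∈⟨ S ⟩?) (v i ∈⟨ T ⟩?) (v i ∈⟨ E ⟩?)))
             (spanSum-one e (positive e le) E indE)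
    where
    A = annihilator T
    open Annihilator A using (size; forms; dimension)
    positive : ∀ e → s ℕ.≤ size ℕ.+ e → 1 ℕ.≤ e
    positive zero le = ⊥-elim (ℕ.<⇒≱ m< (ℕ.≤-trans (ℕ.+-monoˡ-≤ k (ℕ.≤-trans le (ℕ.≤-reflexive (ℕ.+-identityʳ size)))) (ℕ.≤-reflexive (dimension indT))))
    positive (suc e) le = s≤s z≤n
    same : ∀ i {E : Set} → (E → v i ∈⟨ S ⟩ × v i ∈⟨ T ⟩) → (v i ∈⟨ S ⟩ → v i ∈⟨ T ⟩ → E) →
      (dS : Dec (v i ∈⟨ S ⟩)) (dT : Dec (v i ∈⟨ T ⟩)) (dE : Dec E) → keep dS 1# * keep dT 1# ≡ keep dE 1#
    same i to from (yes a) (yes b) (yes _) = *-identityˡ 1#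
    same i to from (yes a) (yes b) (no ¬e) = ⊥-elim (¬e (from a b))
    same i to from (no ¬a) _ (yes e) = ⊥-elim (¬a (proj₁ (to e)))
    same i to from (no ¬a) _ (no _) = zeroˡ _
    same i to from (yes a) (no ¬b) (yes e) = ⊥-elim (¬b (proj₂ (to e)))
    same i to from (yes a) (no ¬b) (no _) = zeroʳ _

  -- Differences of subspaces

  indicator : (Fin s → Vect m) → Word
  indicator S i = keep (v i ∈⟨ S ⟩?) 1#

  difference : F → (Fin s → Vect m) → (Fin s → Vect m) → Word
  difference l S₁ S₂ i = l * (indicator S₁ i + - indicator S₂ i)

  module Weight {l : F} (l≢0 : l ≢ 0#) {S₁ S₂ : Fin (suc s) → Vect m} {D : Fin s → Vect m}
    (ind₁ : Independent S₁) (ind₂ : Independent S₂) (indD : Independent D)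
    (meet : ∀ {x} → x ∈⟨ S₁ ⟩ → x ∈⟨ S₂ ⟩ → x ∈⟨ D ⟩) (D⊂₁ : ∀ {x} → x ∈⟨ D ⟩ → x ∈⟨ S₁ ⟩) (D⊂₂ : ∀ {x} → x ∈⟨ D ⟩ → x ∈⟨ S₂ ⟩) where

    both : ∀ {a b} → a ≡ b → l * (a + - b) ≡ 0#
    both refl = trans (*-congˡ (-‿inverseʳ _)) (zeroʳ l)

    one : l * (1# + - 0#) ≢ 0#
    one e = l≢0 (trans (solve 1 (λ l → l := l :* (con (ℤ.+ 1) :- con (ℤ.+ 0))) refl l) e)

    minus-one : l * (0# + - 1#) ≢ 0#
    minus-one e = l≢0 (trans (solve 1 (λ l → l := :- (l :* (con (ℤ.+ 0) :- con (ℤ.+ 1)))) refl l) (trans (cong -_ e) (solve 0 (:- con (ℤ.+ 0) := con (ℤ.+ 0)) refl)))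

    pointwise : ∀ {A B C : Set} (dA : Dec A) (dB : Dec B) (dC : Dec C) → (A → B → C) → (C → A) → (C → B) →
      ind (¬? (l * (keep dA 1# + - keep dB 1#) ≟ 0#)) ≡ ind (dA ×-dec ¬? dC) ℕ.+ ind (dB ×-dec ¬? dC)
    pointwise (yes a) (yes b) (no ¬c) f _ _ = ⊥-elim (¬c (f a b))
    pointwise (yes a) (yes b) (yes c) f _ _ = ind-no (¬? (_ ≟ 0#)) (λ ne → ne (both refl))
    pointwise (yes a) (no ¬b) (yes c) _ _ g = ⊥-elim (¬b (g c))
    pointwise (yes a) (no ¬b) (no ¬c) _ _ _ = ind-yes (¬? (_ ≟ 0#)) one
    pointwise (no ¬a) _ (yes c) _ g _ = ⊥-elim (¬a (g c))
    pointwise (no ¬a) (yes b) (no ¬c) _ _ _ = ind-yes (¬? (_ ≟ 0#)) minus-one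
    pointwise (no ¬a) (no ¬b) (no ¬c) _ _ _ = ind-no (¬? (_ ≟ 0#)) (λ ne → ne (both refl))

    weight-difference : weight (difference l S₁ S₂) ≡ 2 ℕ.* p ℕ.^ s
    weight-difference = begin
      weight (difference l S₁ S₂)
        ≡⟨ Counting.sum-cong (λ i → pointwise (v i ∈⟨ S₁ ⟩?) (v i ∈⟨ S₂ ⟩?) (v i ∈⟨ D ⟩?) meet D⊂₁ D⊂₂) ⟩
      Counting.sum (λ i → ind ((v i ∈⟨ S₁ ⟩?) ×-dec ¬? (v i ∈⟨ D ⟩?)) ℕ.+ ind ((v i ∈⟨ S₂ ⟩?) ×-dec ¬? (v i ∈⟨ D ⟩?)))
        ≡⟨ Counting.sum-+ _ _ ⟩
      count (λ i → (v i ∈⟨ S₁ ⟩?) ×-dec ¬? (v i ∈⟨ D ⟩?)) ℕ.+ count (λ i → (v i ∈⟨ S₂ ⟩?) ×-dec ¬? (v i ∈⟨ D ⟩?))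
        ≡⟨ cong₂ ℕ._+_ (difference-count D S₁ indD ind₁ D⊂₁) (difference-count D S₂ indD ind₂ D⊂₂) ⟩
      p ℕ.^ s ℕ.+ p ℕ.^ s
        ≡⟨ cong (p ℕ.^ s ℕ.+_) (sym (ℕ.+-identityʳ _)) ⟩
      2 ℕ.* p ℕ.^ s ∎
      where open ≡-Reasoning

  weight-cong : ∀ {c c′ : Word} → (∀ i → c i ≡ c′ i) → weight c ≡ weight c′
  weight-cong {c} {c′} eq = Counting.count-cong (supp? c) (supp? c′) (λ i ne e → ne (trans (eq i) e)) (λ i ne e → ne (trans (sym (eq i)) e))

  difference-orthogonal : ∀ {k} l (S₁ S₂ : Fin s → Vect m) (T : Fin k → Vect m) → Independent S₁ → Independent S₂ → Independent T →
    m ℕ.< s ℕ.+ k → sum (λ i → difference l S₁ S₂ i * indicator T i) ≡ 0#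
  difference-orthogonal l S₁ S₂ T ind₁ ind₂ indT m< = begin
    sum (λ i → difference l S₁ S₂ i * indicator T i)
      ≡⟨ sum-cong (λ i → solve 4 (λ l a b t → l :* (a :+ :- b) :* t := l :* (a :* t) :+ :- l :* (b :* t)) refl l (indicator S₁ i) (indicator S₂ i) (indicator T i)) ⟩
    sum (λ i → l * (indicator S₁ i * indicator T i) + - l * (indicator S₂ i * indicator T i))
      ≡⟨ sum-+ _ _ ⟩
    sum (λ i → l * (indicator S₁ i * indicator T i)) + sum (λ i → - l * (indicator S₂ i * indicator T i))
      ≡⟨ cong₂ _+_ (sym (sum-*ˡ l _)) (sym (sum-*ˡ (- l) _)) ⟩
    l * sum (λ i → indicator S₁ i * indicator T i) + - l * sum (λ i → indicator S₂ i * indicator T i)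
      ≡⟨ cong₂ (λ a b → l * a + - l * b) (intersection-sum S₁ T ind₁ indT m<) (intersection-sum S₂ T ind₂ indT m<) ⟩
    l * 1# + - l * 1#
      ≡⟨ solve 1 (λ l → l :* con (ℤ.+ 1) :+ :- l :* con (ℤ.+ 1) := con (ℤ.+ 0)) refl l ⟩
    0# ∎
    where open ≡-Reasoning

  spanSum-indicator : (c : Word) (T : Fin s → Vect m) → sum (λ i → c i * indicator T i) ≡ spanSum T c
  spanSum-indicator c T = sum-cong (λ i → pointwise (v i ∈⟨ T ⟩?) (c i))
    where
    pointwise : ∀ {A : Set} (d : Dec A) a → a * keep d 1# ≡ keep d a
    pointwise (yes _) a = *-identityʳ a
    pointwise (no _)  a = zeroʳ a

  orthogonal-combination : ∀ {k} (c : Word) (a : Fin k → F) (χ : Fin k → Word) → (∀ j → sum (λ i → c i * χ j i) ≡ 0#) →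
    sum (λ i → c i * sum (λ j → a j * χ j i)) ≡ 0#
  orthogonal-combination c a χ orth = begin
    sum (λ i → c i * sum (λ j → a j * χ j i))     ≡⟨ sum-cong (λ i → sum-*ˡ (c i) _) ⟩
    sum (λ i → sum (λ j → c i * (a j * χ j i)))   ≡⟨ sum-comm _ ⟩
    sum (λ j → sum (λ i → c i * (a j * χ j i)))
      ≡⟨ sum-zero (λ j → trans (sum-cong (λ i → solve 3 (λ c a x → c :* (a :* x) := a :* (c :* x)) refl (c i) (a j) (χ j i)))
           (trans (sym (sum-*ˡ (a j) _)) (trans (*-congˡ (orth j)) (zeroʳ (a j))))) ⟩
    0#                                            ∎
    where open ≡-Reasoning

  keep-intro : {A : Set} (d : Dec A) {x : F} → (A → x ≡ 1#) → (¬ A → x ≡ 0#) → x ≡ keep d 1#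
  keep-intro (yes a) f g = f a
  keep-intro (no ¬a) f g = g ¬a

  cone-meet : ∀ {P Q} {D : Fin s → Vect m} → Independent (P ∷ Q ∷ D) → ∀ {x} → x ∈⟨ P ∷ D ⟩ → x ∈⟨ Q ∷ D ⟩ → x ∈⟨ D ⟩
  cone-meet {P = P} {Q} {D} indep {x} x∈ x∈′ = decidable-stable (x ∈⟨ D ⟩?) λ x∉ →
    independent-head (P ∷ Q ∷ D) indep (∈-trans (x ∷ D) (λ { zero → x∈′ ; (suc l) → ∈-weaken Q (∈-member D l) }) (exchange x∈ x∉))

  independent-left : ∀ {P Q} {D : Fin s → Vect m} → Independent (P ∷ Q ∷ D) → Independent (P ∷ D)
  independent-left {P = P} {Q} {D} indep = independent-tail (Q ∷ P ∷ D) (swap-independent indep)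

  record DifferenceOfCones (s : ℕ) (c : Word) : Set where
    field
      scalar : F
      scalar≢0 : scalar ≢ 0#
      P Q : Vect m
      D : Fin s → Vect m
      independent : Independent (P ∷ Q ∷ D)
      equation : ∀ i → c i ≡ difference scalar (P ∷ D) (Q ∷ D) i

  weight-cones : ∀ {c} → DifferenceOfCones s c → weight c ≡ 2 ℕ.* p ℕ.^ s
  weight-cones {c = c} C = trans (weight-cong {c} equation)
    (Weight.weight-difference scalar≢0 (independent-left independent) (independent-tail (P ∷ Q ∷ D) independent)
      (independent-tail (Q ∷ D) (independent-tail (P ∷ Q ∷ D) independent)) (cone-meet independent) (∈-weaken P) (∈-weaken Q))
    where open DifferenceOfCones C

  shape-cones : ∀ {c} (S : Shape c) → DifferenceOfCones (Shape.size S) c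
  shape-cones {c} S = record { scalar≢0 = suppₐ ; independent = independent
    ; equation = λ i → pointwise i (v i ∈⟨ v a ∷ apexes ⟩?) (v i ∈⟨ v b ∷ apexes ⟩?) (v i ∈⟨ apexes ⟩?) }
    where
    open Shape S
    pointwise : ∀ i (d₁ : Dec (v i ∈⟨ v a ∷ apexes ⟩)) (d₂ : Dec (v i ∈⟨ v b ∷ apexes ⟩)) → Dec (v i ∈⟨ apexes ⟩) →
      c i ≡ c a * (keep d₁ 1# + - keep d₂ 1#)
    pointwise i (yes h₁) (yes h₂) _ = trans (apex i (cone-meet independent h₁ h₂)) (sym (trans (*-congˡ (-‿inverseʳ 1#)) (zeroʳ _)))
    pointwise i (yes h₁) (no h₂) (yes h) = ⊥-elim (h₂ (∈-weaken (v b) h))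
    pointwise i (yes h₁) (no h₂) (no h) = trans (left i h₁ h) (solve 1 (λ l → l := l :* (con (ℤ.+ 1) :- con (ℤ.+ 0))) refl (c a))
    pointwise i (no h₁) (yes h₂) (yes h) = ⊥-elim (h₁ (∈-weaken (v a) h))
    pointwise i (no h₁) (yes h₂) (no h) = trans (right i h₂ h) (solve 1 (λ l → :- l := l :* (con (ℤ.+ 0) :- con (ℤ.+ 1))) refl (c a))
    pointwise i (no h₁) (no h₂) _ = trans (decidable-stable (c i ≟ 0#) (λ ne → [ h₁ , h₂ ]′ (support i ne)))
      (sym (trans (*-congˡ (-‿inverseʳ 0#)) (zeroʳ _)))

  power-injective : ∀ r s → 2 ℕ.* p ℕ.^ r ≡ 2 ℕ.* p ℕ.^ s → r ≡ s
  power-injective r s eq = decide (ℕ.<-cmp r s)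
    where
    powers : p ℕ.^ r ≡ p ℕ.^ s
    powers = ℕ.*-cancelˡ-≡ (p ℕ.^ r) (p ℕ.^ s) 2 eq
    decide : Tri (r ℕ.< s) (r ≡ s) (s ℕ.< r) → r ≡ s
    decide (tri< lt _ _) = ⊥-elim (ℕ.<⇒≢ (ℕ.^-monoʳ-< p 1<p lt) powers)
    decide (tri≈ _ e _)  = e
    decide (tri> _ _ gt) = ⊥-elim (ℕ.<⇒≢ (ℕ.^-monoʳ-< p 1<p gt) (sym powers))

  -- The number of apexes is not tracked while the cone grows. It is recovered from the weight of
  -- the resulting difference, as powers of p determine their exponents.
  minimal-cones : ∀ {c} r → Dual r c → weight c ≡ 2 ℕ.* p ℕ.^ r → DifferenceOfCones r c
  minimal-cones {c} r dual w = subst (λ s → DifferenceOfCones s c)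
    (power-injective (Shape.size S) r (trans (sym (weight-cones (shape-cones S))) w)) (shape-cones S)
    where
    S : Shape c
    S = shape r dual w

  coordinate-cones : suc (suc s) ℕ.≤ m → ∃ (DifferenceOfCones s)
  coordinate-cones {s} le = difference 1# (P ∷ D) (Q ∷ D) , record
    { scalar≢0 = 1≢0 ; independent = independent ; equation = λ i → refl }
    where
    index : Fin (suc (suc s)) → Fin m
    index l = inject≤ l le
    P Q : Vect m
    P = unit (index zero)
    Q = unit (index (suc zero))
    D : Fin s → Vect m
    D l = unit (index (suc (suc l)))
    entry : ∀ l j → (P ∷ Q ∷ D) l j ≡ unit (index l) j
    entry zero j          = refl
    entry (suc zero) j    = refl
    entry (suc (suc l)) j = refl
    independent : Independent (P ∷ Q ∷ D)
    independent a e l = begin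
      a l                                                ≡⟨ sym (*-identityʳ (a l)) ⟩
      a l * 1#                                           ≡⟨ *-congˡ (sym (trans (entry l (index l)) (keep-yes (index l ≟ index l) refl))) ⟩
      a l * (P ∷ Q ∷ D) l (index l)                      ≡⟨ sym (sum-single l (λ i i≢l → trans (*-congˡ
        (trans (entry i (index l)) (keep-no (index i ≟ index l) (λ eq → i≢l (Fin.inject≤-injective le le i l eq))))) (zeroʳ (a i)))) ⟩
      comb a (P ∷ Q ∷ D) (index l)                       ≡⟨ e (index l) ⟩
      0#                                                 ∎
      where open ≡-Reasoning

-- The integers modulo p

module Residues (p : ℕ) (pr : Prime p) where
  private instance
    p≢0 : NonZero p
    p≢0 = primeNZ pr
  open PG p

  residue : ℕ → F
  residue n = n mod p

  negF : F → F
  negF a = residue (p ℕ.∸ toℕ a)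

  toℕ-residue : ∀ n → toℕ (residue n) ≡ n % p
  toℕ-residue n = Fin.toℕ-fromℕ< (m%n<n n p)

  residue-cong : ∀ {m n} → m % p ≡ n % p → residue m ≡ residue n
  residue-cong {m} {n} eq = Fin.toℕ-injective (trans (toℕ-residue m) (trans eq (sym (toℕ-residue n))))

  residue-toℕ : ∀ a → residue (toℕ a) ≡ a
  residue-toℕ a = Fin.toℕ-injective (trans (toℕ-residue (toℕ a)) (m<n⇒m%n≡m (Fin.toℕ<n a)))

  +-residue : ∀ m n → residue m +F residue n ≡ residue (m ℕ.+ n)
  +-residue m n = residue-cong (trans (cong₂ (λ a b → (a ℕ.+ b) % p) (toℕ-residue m) (toℕ-residue n)) (sym (%-distribˡ-+ m n p)))

  *-residue : ∀ m n → residue m *F residue n ≡ residue (m ℕ.* n)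
  *-residue m n = residue-cong (trans (cong₂ (λ a b → (a ℕ.* b) % p) (toℕ-residue m) (toℕ-residue n)) (sym (%-distribˡ-* m n p)))

  -- Every scalar is a residue, so the ring laws are inherited from the natural numbers through
  -- `+-residue` and `*-residue`.
  residues : (P : F → Set) → (∀ n → P (residue n)) → ∀ a → P a
  residues P f a = subst P (residue-toℕ a) (f (toℕ a))

  residue-p : residue p ≡ 0F
  residue-p = residue-cong (trans (n%n≡0 p) (sym (m*n%n≡0 0 p)))

  negF-inverse : ∀ a → a +F negF a ≡ 0F
  negF-inverse a = trans (cong (_+F negF a) (sym (residue-toℕ a))) (trans (+-residue (toℕ a) (p ℕ.∸ toℕ a))
    (trans (cong residue (ℕ.m+[n∸m]≡n (ℕ.<⇒≤ (Fin.toℕ<n a)))) residue-p))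

  -F≡+negF : ∀ a b → a -F b ≡ a +F negF b
  -F≡+negF a b = trans (sym (+-residue (toℕ a) (p ℕ.∸ toℕ b))) (cong (_+F negF b) (residue-toℕ a))

  +F-comm : ∀ a b → a +F b ≡ b +F a
  +F-comm a b = cong residue (ℕ.+-comm (toℕ a) (toℕ b))

  *F-comm : ∀ a b → a *F b ≡ b *F a
  *F-comm a b = cong residue (ℕ.*-comm (toℕ a) (toℕ b))

  +F-assoc : ∀ a b c → (a +F b) +F c ≡ a +F (b +F c)
  +F-assoc = residues _ λ x → residues _ λ y → residues _ λ z →
    trans (cong (_+F residue z) (+-residue x y)) (trans (+-residue (x ℕ.+ y) z) (trans (cong residue (ℕ.+-assoc x y z))
      (sym (trans (cong (residue x +F_) (+-residue y z)) (+-residue x (y ℕ.+ z))))))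

  *F-assoc : ∀ a b c → (a *F b) *F c ≡ a *F (b *F c)
  *F-assoc = residues _ λ x → residues _ λ y → residues _ λ z →
    trans (cong (_*F residue z) (*-residue x y)) (trans (*-residue (x ℕ.* y) z) (trans (cong residue (ℕ.*-assoc x y z))
      (sym (trans (cong (residue x *F_) (*-residue y z)) (*-residue x (y ℕ.* z))))))

  *F-distribˡ : ∀ a b c → a *F (b +F c) ≡ (a *F b) +F (a *F c)
  *F-distribˡ = residues _ λ x → residues _ λ y → residues _ λ z →
    trans (cong (residue x *F_) (+-residue y z)) (trans (*-residue x (y ℕ.+ z)) (trans (cong residue (ℕ.*-distribˡ-+ x y z))
      (sym (trans (cong₂ _+F_ (*-residue x y) (*-residue x z)) (+-residue (x ℕ.* y) (x ℕ.* z))))))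

  +F-identityˡ : ∀ a → 0F +F a ≡ a
  +F-identityˡ a = trans (cong (0F +F_) (sym (residue-toℕ a))) (trans (+-residue 0 (toℕ a)) (residue-toℕ a))

  *F-identityˡ : ∀ a → 1F *F a ≡ a
  *F-identityˡ a = trans (cong (1F *F_) (sym (residue-toℕ a))) (trans (*-residue 1 (toℕ a)) (trans (cong residue (ℕ.*-identityˡ (toℕ a))) (residue-toℕ a)))

  isCommutativeRing : Structures.IsCommutativeRing _≡_ _+F_ _*F_ negF 0F 1F
  isCommutativeRing = record
    { isRing = record
      { +-isAbelianGroup = record
        { isGroup = record
          { isMonoid = record
            { isSemigroup = record
              { isMagma = record { isEquivalence = isEquivalence ; ∙-cong = cong₂ _+F_ }
              ; assoc = +F-assoc }
            ; identity = +F-identityˡ , λ a → trans (+F-comm a 0F) (+F-identityˡ a) }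
          ; inverse = (λ a → trans (+F-comm (negF a) a) (negF-inverse a)) , negF-inverse
          ; ⁻¹-cong = cong negF }
        ; comm = +F-comm }
      ; *-cong = cong₂ _*F_
      ; *-assoc = *F-assoc
      ; *-identity = *F-identityˡ , λ a → trans (*F-comm a 1F) (*F-identityˡ a)
      ; distrib = *F-distribˡ , λ a b c → trans (*F-comm (b +F c) a) (trans (*F-distribˡ a b c) (cong₂ _+F_ (*F-comm a b) (*F-comm a c))) }
    ; *-comm = *F-comm }

  residueRing : CommutativeRing _ _
  residueRing = record { isCommutativeRing = isCommutativeRing }

  residue≡0 : ∀ n → residue n ≡ 0F → n % p ≡ 0
  residue≡0 n eq = trans (sym (toℕ-residue n)) (trans (cong toℕ eq) (trans (toℕ-residue 0) (m*n%n≡0 0 p)))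

  1<p : 1 ℕ.< p
  1<p = ℕ.nonTrivial⇒n>1 p {{prime⇒nonTrivial pr}}

  inverseF : ∀ a → a ≢ 0F → ∃ λ b → a *F b ≡ 1F
  inverseF a a≢0 = from-Bézout (coprime-Bézout (prime⇒coprime pr {{ℕ.≢-nonZero n≢0}} (Fin.toℕ<n a)))
    where
    open CommutativeRing residueRing using (ring; +-assoc; +-identityʳ; -‿inverseʳ)
    open RingProperties ring using (-‿distribʳ-*)
    n = toℕ a
    n≢0 : n ≢ 0
    n≢0 eq = a≢0 (trans (sym (residue-toℕ a)) (cong residue eq))
    times : ∀ y → a *F residue y ≡ residue (n ℕ.* y)
    times y = trans (cong (_*F residue y) (sym (residue-toℕ a))) (*-residue n y)
    from-Bézout : Bézout.Identity 1 p n → ∃ λ b → a *F b ≡ 1F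
    from-Bézout (Bézout.-+ x y eq) = residue y , trans (times y) (trans (cong residue (trans (ℕ.*-comm n y) (sym eq))) (residue-cong ([m+kn]%n≡m%n 1 x p)))
    -- Here 1 + y n = x p, so the inverse is the residue of y with the opposite sign.
    from-Bézout (Bézout.+- x y eq) = negF (residue y) , trans (sym (-‿distribʳ-* a (residue y)))
      (trans (sym (+F-identityˡ _)) (trans (cong (_+F negF (a *F residue y)) (sym zero-sum)) (trans (+-assoc 1F _ _) (trans (cong (1F +F_) (-‿inverseʳ _)) (+-identityʳ 1F)))))
      where
      zero-sum : 1F +F (a *F residue y) ≡ 0F
      zero-sum = trans (cong (1F +F_) (times y)) (trans (+-residue 1 (n ℕ.* y))
        (trans (cong residue (trans (cong suc (ℕ.*-comm n y)) eq)) (residue-cong (trans (m*n%n≡0 x p) (sym (m*n%n≡0 0 p))))))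

  iterate-residue : ∀ n → iterate (1F +F_) 0F n ≡ residue n
  iterate-residue zero    = refl
  iterate-residue (suc n) = trans (cong (1F +F_) (iterate-residue n)) (+-residue 1 n)

  field-p : PrimeField p
  field-p = record
    { _+_ = _+F_ ; _*_ = _*F_ ; -_ = negF ; 0# = 0F ; 1# = 1F
    ; isCommutativeRing = isCommutativeRing
    ; inverse = inverseF
    ; 1≢0 = λ eq → ℕ.1+n≢0 (trans (sym (m<n⇒m%n≡m 1<p)) (residue≡0 1 eq))
    ; characteristic = trans (iterate-residue p) residue-p
    ; characteristic-minimal = λ n 0<n n<p eq →
        ℕ.<⇒≢ 0<n (sym (trans (sym (m<n⇒m%n≡m n<p)) (residue≡0 n (trans (sym (iterate-residue n)) eq))))
    }

-- Points of PG(n, p)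

lookup-distinct : ∀ {A : Set} {E : A → A → Set} → (∀ {x y} → E x y → E y x) → ∀ {xs} → AllPairs (λ x y → ¬ E x y) xs →
  ∀ i j → E (lookup xs i) (lookup xs j) → i ≡ j
lookup-distinct E-sym (_ AllPairs.∷ _) zero zero e = refl
lookup-distinct E-sym (x≉ AllPairs.∷ _) zero (suc j) e = ⊥-elim (All.lookup x≉ (∈-lookup j) e)
lookup-distinct E-sym (x≉ AllPairs.∷ _) (suc i) zero e = ⊥-elim (All.lookup x≉ (∈-lookup i) (E-sym e))
lookup-distinct E-sym (_ AllPairs.∷ xs!) (suc i) (suc j) e = cong suc (lookup-distinct E-sym xs! i j e)

length-filter-tabulate : ∀ {A : Set} (q : A → Bool) n (f : Fin n → A) →
  length (filterᵇ q (tabulate f)) ≡ Counting.sum (λ i → if q (f i) then 1 else 0)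
length-filter-tabulate q zero f = sym (Counting.sum-empty _)
length-filter-tabulate q (suc n) f with q (f zero) in eq
... | true  = trans (cong suc (length-filter-tabulate q n (f ∘ suc))) (sym (trans (Counting.sum-suc _) (cong (λ b → (if b then 1 else 0) ℕ.+ Counting.sum (λ i → if q (f (suc i)) then 1 else 0)) eq)))
... | false = trans (length-filter-tabulate q n (f ∘ suc)) (sym (trans (Counting.sum-suc _) (cong (λ b → (if b then 1 else 0) ℕ.+ Counting.sum (λ i → if q (f (suc i)) then 1 else 0)) eq)))

module NormalizedPoints (p : ℕ) (pr : Prime p) where
  private instance
    p≢0 : NonZero p
    p≢0 = primeNZ pr
  open PG p
  open Residues p pr using (field-p)
  private module K = PrimeField field-p

  allVecs-complete : ∀ m (x : Vect m) → Any (_≗ x) (allVecs m)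
  allVecs-complete zero    x = here (λ ())
  allVecs-complete (suc m) x = Any.concatMap⁺ (λ a → map (cons a) (allVecs m)) (Any.map
    (λ { refl → Any.map⁺ (Any.map (λ e → λ { zero → refl ; (suc j) → e j }) (allVecs-complete m (x ∘ suc))) }) (∈-allFin (x zero)))

  allVecs-distinct : ∀ m → AllPairs (λ u w → ¬ (u ≗ w)) (allVecs m)
  allVecs-distinct zero    = All.[] AllPairs.∷ AllPairs.[]
  allVecs-distinct (suc m) = AllPairs.concat⁺
    (All.map⁺ (All.universal (λ a → AllPairs.map⁺ (AllPairs.map (λ u≉w e → u≉w (e ∘ suc)) (allVecs-distinct m))) (allFin p)))
    (AllPairs.map⁺ (AllPairs.tabulate⁺ λ a≢b → All.map⁺ (All.universal (λ u → All.map⁺ (All.universal (λ w e → a≢b (e zero)) (allVecs m))) (allVecs m))))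

  isZero-true : ∀ {a} → isZero a ≡ true → a ≡ 0F
  isZero-true {a} eq with a ≟ 0F
  ... | yes e = e
  isZero-true {a} () | no _

  isZero-false : ∀ {a} → isZero a ≡ false → a ≢ 0F
  isZero-false {a} eq with a ≟ 0F
  ... | no ne = ne
  isZero-false {a} () | yes _

  isOne : ∀ {a} → T (does (a ≟ 1F)) → a ≡ 1F
  isOne {a} t with a ≟ 1F
  ... | yes e = e

  normalized-nonzero : ∀ {m} (u : Vect m) → T (normalized u) → ¬ (∀ j → u j ≡ 0F)
  normalized-nonzero {suc m} u t all0 with isZero (u zero) in eq
  ... | true  = normalized-nonzero (u ∘ suc) t (all0 ∘ suc)
  ... | false = isZero-false eq (all0 zero)

  normalized-resp : ∀ {m} {u w : Vect m} → u ≗ w → T (normalized u) → T (normalized w)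
  normalized-resp {suc m} {u} {w} e t with isZero (u zero) | isZero (w zero) | cong isZero (e zero)
  ... | true  | true  | refl = normalized-resp (e ∘ suc) t
  ... | false | false | refl = subst (λ a → T (does (a ≟ 1F))) (e zero) t

  -- Proportional vectors have their first nonzero coordinate in the same place, and there both
  -- entries are 1.
  normalized-scalar : ∀ {m} (u w : Vect m) s → s ≢ 0F → T (normalized u) → T (normalized w) → (∀ j → u j ≡ s *F w j) → s ≡ 1F
  normalized-scalar {suc m} u w s s≢0 tu tw e with isZero (u zero) in equ | isZero (w zero) in eqw
  ... | true  | true  = normalized-scalar (u ∘ suc) (w ∘ suc) s s≢0 tu tw (e ∘ suc)
  ... | true  | false = ⊥-elim (Linear.*-nonzero field-p s≢0 (isZero-false eqw) (trans (sym (e zero)) (isZero-true equ)))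
  ... | false | true  = ⊥-elim (isZero-false equ (trans (e zero) (trans (cong (s *F_) (isZero-true eqw)) (K.zeroʳ s))))
  ... | false | false = trans (sym (trans (e zero) (trans (cong (s *F_) (isOne tw)) (K.*-identityʳ s)))) (isOne tu)

  normalize : ∀ {m} (u : Vect m) → ¬ (∀ j → u j ≡ 0F) → ∃ λ b → T (normalized (λ j → b *F u j))
  normalize {zero}  u u≢0 = ⊥-elim (u≢0 (λ ()))
  normalize {suc m} u u≢0 = decide (u zero ≟ 0F)
    where
    head-zero : ∀ b → b *F u zero ≡ 0F → T (normalized (λ j → b *F u (suc j))) → T (normalized (λ j → b *F u j))
    head-zero b e t with isZero (b *F u zero) in eq
    ... | true  = t
    ... | false = ⊥-elim (isZero-false eq e)
    head-one : ∀ b → b *F u zero ≡ 1F → T (normalized (λ j → b *F u j))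
    head-one b e with isZero (b *F u zero) in eq
    ... | true  = ⊥-elim (K.1≢0 (trans (sym e) (isZero-true eq)))
    ... | false = Equivalence.from T-≡ (dec-true (b *F u zero ≟ 1F) e)
    decide : Dec (u zero ≡ 0F) → ∃ λ b → T (normalized (λ j → b *F u j))
    decide (yes u₀≡0) =
      let b , t = normalize (u ∘ suc) (λ rest → u≢0 (λ { zero → u₀≡0 ; (suc j) → rest j }))
      in b , head-zero b (trans (cong (b *F_) u₀≡0) (K.zeroʳ b)) t
    decide (no u₀≢0) = let b , e = K.inverse (u zero) u₀≢0 in b , head-one b (trans (K.*-comm b _) e)

  module _ (n : ℕ) where

    point-normalized : ∀ i → T (normalized (point n i))
    point-normalized i = proj₂ (∈-filter⁻ (T? ∘ normalized) {xs = allVecs (suc n)} (∈-lookup {xs = points n} i))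

    point-nonzero : ∀ i → ¬ (∀ j → point n i j ≡ 0F)
    point-nonzero i = normalized-nonzero (point n i) (point-normalized i)

    point-unique : ∀ {i j} s → (∀ l → point n i l ≡ s *F point n j l) → i ≡ j
    point-unique {i} {j} s e = lookup-distinct (λ e j → sym (e j)) (AllPairs.filter⁺ (T? ∘ normalized) (allVecs-distinct (suc n))) i j
      (λ l → trans (e l) (trans (cong (_*F point n j l) s≡1) (K.*-identityˡ _)))
      where
      s≡1 : s ≡ 1F
      s≡1 = normalized-scalar (point n i) (point n j) s
        (λ { refl → point-nonzero i (λ l → trans (e l) (K.zeroˡ _)) }) (point-normalized i) (point-normalized j) e

    find-point : ∀ (u : Vect (suc n)) → T (normalized u) → ∃ λ i → point n i ≗ u
    find-point u t =
      let w , w∈ , w≗u = find (allVecs-complete (suc n) u)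
          w∈points = ∈-filter⁺ (T? ∘ normalized) w∈ (normalized-resp (λ j → sym (w≗u j)) t)
      in Any.index w∈points , λ j → trans (cong (λ x → x j) (sym (Any.lookup-index w∈points))) (w≗u j)

    locate-point : ∀ u → ¬ (Linear._∈⟨_⟩ field-p u Vector.[]) → ∃ λ i → Linear._∈⟨_⟩ field-p (point n i) (u Vector.∷ Vector.[])
    locate-point u u∉ =
      let b , t = normalize u (λ all0 → u∉ (Linear.zero∈ field-p all0))
          i , e = find-point (λ j → b *F u j) t
      in i , SmallSpans.∈₁-intro field-p b e

-- The codes of the statement

open import Data.Nat using (_*_; _^_; _∸_; _≤_)

module Codes (p n : ℕ) (pr : Prime p) where
  private instance
    p≢0 : NonZero p
    p≢0 = primeNZ pr
  open PG p hiding (F; Vect; comb; Independent; Word; weight)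
  private module Geometry = PG p
  open Residues p pr using (field-p; -F≡+negF)
  open NormalizedPoints p pr
  open PrimeField field-p hiding (_*_)
  open Linear field-p
  open SmallSpans field-p
  open PointSet field-p (point n) (point-nonzero n) (point-unique n)
  open Projective field-p (point n) (point-nonzero n) (point-unique n) (locate-point n)

  sumF≡sum : ∀ {m} (f : Fin m → F) → sumF f ≡ sum f
  sumF≡sum {zero}  f = sym (sum-empty f)
  sumF≡sum {suc m} f = trans (cong (f zero +F_) (sumF≡sum (f ∘ suc))) (sym (sum-suc f))

  weight≡ : ∀ (c : Word) → Geometry.weight c ≡ weight c
  weight≡ c = length-filter-tabulate _ (N n) id

  module _ {d : ℕ} where

    toIndependent : {B : Geometry.Basis n d} → Geometry.Independent B → Independent B
    toIndependent ind a e = ind a (λ j → trans (sumF≡sum _) (e j))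

    fromIndependent : {B : Geometry.Basis n d} → Independent B → Geometry.Independent B
    fromIndependent ind a e = ind a (λ j → trans (sym (sumF≡sum _)) (e j))

    toSpan : (S : Subspace n d) → ∀ {x} → x ∈S S → x ∈⟨ basis S ⟩
    toSpan S (a , e) = a , λ j → trans (e j) (sumF≡sum _)

    fromSpan : (S : Subspace n d) → ∀ {x} → x ∈⟨ basis S ⟩ → x ∈S S
    fromSpan S (a , e) = a , λ j → trans (e j) (sym (sumF≡sum _))

    subspace : (B : Geometry.Basis n d) → Independent B → Subspace n d
    subspace B ind = record { basis = B ; indep = fromIndependent ind }

    indicator-incidence : (B : Geometry.Basis n d) (ind : Independent B) → IsIncidence (indicator B) (subspace B ind)
    indicator-incidence B ind i = (λ i∈ → keep-yes (point n i ∈⟨ B ⟩?) (toSpan (subspace B ind) {point n i} i∈) {1F}) ,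
      (λ i∉ → keep-no (point n i ∈⟨ B ⟩?) (λ i∈ → i∉ (fromSpan (subspace B ind) {point n i} i∈)) {1F})

    incidence-indicator : (S : Subspace n d) → ∀ {χ} → IsIncidence χ S → ∀ i → χ i ≡ indicator (basis S) i
    incidence-indicator S {χ} inc i = keep-intro (point n i ∈⟨ basis S ⟩?) {χ i} (proj₁ (inc i) ∘ fromSpan S) (λ i∉ → proj₂ (inc i) (i∉ ∘ toSpan S))

  InDual⇒Dual : ∀ k r {c} → r ℕ.+ k ≡ n → InDual n k c → Dual r c
  InDual⇒Dual k r {c} r+k inDual = dual-from-subspaces zero-on r (s≤s (ℕ.≤-reflexive (trans (ℕ.+-comm k r) r+k)))
    where
    zero-on : ∀ (B : Fin (suc k) → Vect (suc n)) → Independent B → spanSum B c ≡ 0F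
    zero-on B ind = trans (sym (spanSum-indicator c B)) (trans (sym (sumF≡sum (λ i → c i *F indicator B i))) (inDual (indicator B) in-code))
      where
      S : Subspace n k
      S = subspace B ind
      in-code : InC n k (indicator B)
      in-code = 1 , (λ _ → 1F) , (λ _ → S) , (λ _ → indicator B) , (λ _ → indicator-incidence B ind) ,
        λ i → sym (trans (+-identityʳ (1F *F indicator B i)) (*-identityˡ (indicator B i)))

  difference-InDual : ∀ k d l (B₁ B₂ : Fin (suc d) → Vect (suc n)) → d ℕ.+ k ≡ n → Independent B₁ → Independent B₂ →
    ∀ {c} → (∀ i → c i ≡ difference l B₁ B₂ i) → InDual n k c
  difference-InDual k d l B₁ B₂ d+k ind₁ ind₂ {c} eq w (m , a , S , χ , inc , w≡) =
    trans (sumF≡sum (λ i → c i *F w i)) (trans (sum-cong {f = λ i → c i *F w i} {g = λ i → c i *F sum (λ j → a j *F indicator (basis (S j)) i)} (λ i → cong (c i *F_) (expand i)))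
      (orthogonal-combination c a (λ j → indicator (basis (S j))) orthogonal))
    where
    expand : ∀ i → w i ≡ sum (λ j → a j *F indicator (basis (S j)) i)
    expand i = trans (w≡ i) (trans (sumF≡sum (λ j → a j *F χ j i))
      (sum-cong {f = λ j → a j *F χ j i} {g = λ j → a j *F indicator (basis (S j)) i} (λ j → cong (a j *F_) (incidence-indicator (S j) (inc j) i))))
    -- The vector dimensions d + 1 and k + 1 add up to n + 2, one more than that of the whole space,
    -- so each k-space meets each of the two d-spaces.
    large : suc n ℕ.< suc d ℕ.+ suc k
    large = s≤s (ℕ.≤-reflexive (sym (trans (ℕ.+-suc d k) (cong suc d+k))))
    orthogonal : ∀ j → sum (λ i → c i *F indicator (basis (S j)) i) ≡ 0F
    orthogonal j = trans (sum-cong {f = λ i → c i *F indicator (basis (S j)) i} {g = λ i → difference l B₁ B₂ i *F indicator (basis (S j)) i} (λ i → cong (_*F indicator (basis (S j)) i) (eq i)))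
      (difference-orthogonal l B₁ B₂ (basis (S j)) ind₁ ind₂ (toIndependent (indep (S j))) large)

  ScalarMultOfDiff⇒ : ∀ k {d c} → suc d ℕ.+ k ≡ n → ScalarMultOfDiff n (suc d) c → InDual n k c × weight c ≡ 2 * p ^ suc d
  ScalarMultOfDiff⇒ k {d} {c} d+k (l , l≢0 , S₁ , S₂ , (D , meet) , χ₁ , χ₂ , inc₁ , inc₂ , c≡) =
    difference-InDual k (suc d) l (basis S₁) (basis S₂) d+k ind₁ ind₂ {c} equation ,
    trans (weight-cong {c} {difference l (basis S₁) (basis S₂)} equation)
      (Weight.weight-difference {l = l} l≢0 {basis S₁} {basis S₂} {basis D} ind₁ ind₂ (toIndependent (indep D)) to-meet (proj₁ ∘ from-meet) (proj₂ ∘ from-meet))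
    where
    ind₁ : Independent (basis S₁)
    ind₁ = toIndependent (indep S₁)
    ind₂ : Independent (basis S₂)
    ind₂ = toIndependent (indep S₂)
    to-meet : ∀ {x} → x ∈⟨ basis S₁ ⟩ → x ∈⟨ basis S₂ ⟩ → x ∈⟨ basis D ⟩
    to-meet {x} x∈ x∈′ = toSpan D (Equivalence.to (meet x) (fromSpan S₁ x∈ , fromSpan S₂ x∈′))
    from-meet : ∀ {x} → x ∈⟨ basis D ⟩ → x ∈⟨ basis S₁ ⟩ × x ∈⟨ basis S₂ ⟩
    from-meet {x} x∈ = let x∈₁ , x∈₂ = Equivalence.from (meet x) (fromSpan D x∈) in toSpan S₁ x∈₁ , toSpan S₂ x∈₂
    equation : ∀ i → c i ≡ difference l (basis S₁) (basis S₂) i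
    equation i = trans (c≡ i) (cong (l *F_) (trans (-F≡+negF (χ₁ i) (χ₂ i))
      (cong₂ (λ a b → a + - b) (incidence-indicator S₁ inc₁ i) (incidence-indicator S₂ inc₂ i))))

  cones⇒ScalarMultOfDiff : ∀ {d c} → DifferenceOfCones (suc d) c → ScalarMultOfDiff n (suc d) c
  cones⇒ScalarMultOfDiff {d} {c} C = scalar , scalar≢0 , S₁ , S₂ , meet , χ₁ , χ₂ , inc₁ , inc₂ , expand
    where
    open DifferenceOfCones C
    indP : Independent (P ∷ D)
    indP = independent-left {P = P} {Q} {D} independent
    indQ : Independent (Q ∷ D)
    indQ = independent-tail (P ∷ Q ∷ D) independent
    indD : Independent D
    indD = independent-tail (Q ∷ D) indQ
    S₁ S₂ : Subspace n (suc d)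
    S₁ = subspace (P ∷ D) indP
    S₂ = subspace (Q ∷ D) indQ
    S₀ : Subspace n d
    S₀ = subspace D indD
    to-meet : ∀ x → x ∈S S₁ × x ∈S S₂ → x ∈S S₀
    to-meet x (x∈ , x∈′) = fromSpan S₀ {x} (cone-meet {P = P} {Q} {D} independent {x} (toSpan S₁ {x} x∈) (toSpan S₂ {x} x∈′))
    from-meet : ∀ x → x ∈S S₀ → x ∈S S₁ × x ∈S S₂
    from-meet x x∈ = fromSpan S₁ {x} (∈-weaken {B = D} {x} P (toSpan S₀ {x} x∈)) , fromSpan S₂ {x} (∈-weaken {B = D} {x} Q (toSpan S₀ {x} x∈))
    meet : MeetIn S₁ S₂
    meet = S₀ , λ x → mk⇔ (to-meet x) (from-meet x)
    χ₁ χ₂ : Word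
    χ₁ = indicator (P ∷ D)
    χ₂ = indicator (Q ∷ D)
    inc₁ : IsIncidence χ₁ S₁
    inc₁ = indicator-incidence (P ∷ D) indP
    inc₂ : IsIncidence χ₂ S₂
    inc₂ = indicator-incidence (Q ∷ D) indQ
    expand : ∀ i → c i ≡ scalar *F (χ₁ i -F χ₂ i)
    expand i = trans (equation i) (cong (scalar *F_) (sym (-F≡+negF (χ₁ i) (χ₂ i))))

  -- The dimension n - k is passed as d with d + k = n. Matching it as a successor lets the `d ∸ 1`
  -- of `MeetIn` compute to the dimension spanned by the apexes.
  minimum-words : ∀ k d → 1 ≤ k → 1 ≤ d → d ℕ.+ k ≡ n →
    (Σ (Geometry.Word n) λ c → InDual n k c × Geometry.weight c ≡ 2 * p ^ d)
    × (∀ c → InDual n k c → NonZeroWord c → 2 * p ^ d ≤ Geometry.weight c)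
    × (∀ c → (InDual n k c × Geometry.weight c ≡ 2 * p ^ d) ⇔ ScalarMultOfDiff n d c)
  minimum-words k (suc d) 1≤k (s≤s z≤n) d+k =
    (let c , C = coordinate-cones (s≤s (ℕ.≤-trans (ℕ.≤-reflexive (ℕ.+-comm 1 (suc d))) (ℕ.≤-trans (ℕ.+-monoʳ-≤ (suc d) 1≤k) (ℕ.≤-reflexive d+k))))
     in c , attained c (cones⇒ScalarMultOfDiff C)) ,
    (λ { c inDual (i , ci) → ℕ.≤-trans (minimum-distance {c} (suc d) (InDual⇒Dual k (suc d) d+k inDual) i ci) (ℕ.≤-reflexive (sym (weight≡ c))) }) ,
    λ c → mk⇔ (λ { (inDual , w) → cones⇒ScalarMultOfDiff (minimal-cones (suc d) (InDual⇒Dual k (suc d) d+k inDual) (trans (sym (weight≡ c)) w)) }) (attained c)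
    where
    attained : ∀ c → ScalarMultOfDiff n (suc d) c → InDual n k c × Geometry.weight c ≡ 2 * p ^ suc d
    attained c S = let inDual , w = ScalarMultOfDiff⇒ k d+k S in inDual , trans (weight≡ c) w

theorem4p5 : (p n k : ℕ) (pr : Prime p) → 2 ≤ n → 1 ≤ k → k ≤ n ∸ 1 →
    let open PG p {{primeNZ pr}} in
    (Σ (Word n) λ c → InDual n k c × weight c ≡ 2 * p ^ (n ∸ k))
    × (∀ c → InDual n k c → NonZeroWord c → 2 * p ^ (n ∸ k) ≤ weight c)
    × (∀ c → (InDual n k c × weight c ≡ 2 * p ^ (n ∸ k)) ⇔ ScalarMultOfDiff n (n ∸ k) c)
theorem4p5 p (suc n) k pr 2≤n 1≤k k≤n = Codes.minimum-words p (suc n) pr k (suc n ∸ k) 1≤k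
  (ℕ.m<n⇒0<n∸m (s≤s k≤n)) (ℕ.m∸n+n≡m (ℕ.m≤n⇒m≤1+n k≤n))
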